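{- Let $\mathcal{P}\subseteq 2^\omega$ be a nonempty additively homogeneous $\Pi^0_1$ class and suppose that the limiting relative measure $\lambda_{\mathcal{P}}(\sigma)$ is defined for all $\sigma\in T_{\mathcal{P}}$. Then for $X\in\mathcal{P}$, the following are equivalent: (a) $X$ is a randomly produced path through $T_{\mathcal{P}}$; (b) $X$ is $T_{\mathcal{P}}$-incompressible; (c) $X$ is globally random in $\mathcal{P}$.
   Context: Notation: $2^\omega$ is the set of infinite binary sequences, $2^{<\omega}$ the set of finite binary strings, $|\sigma|$ the length of $\sigma$, $X\upharpoonright n$ (or $\sigma\upharpoonright n$) the initial segment of length $n$, $[\![\sigma]\!]=\{X\in2^\omega:\sigma\prec X\}$, and $[\![S]\!]=\bigcup_{\sigma\in S}[\![\sigma]\!]$ for $S\subseteq 2^{<\omega}$. $\lambda$ is the Lebesgue measure on $2^\omega$. For nonempty $\sigma$, $\sigma^{\curvearrowright}$ is the string obtained by flipping the last bit of $\sigma$. A $\Pi^0_1$ class is the set of infinite paths through a computable tree $T\subseteq 2^{<\omega}$. For a closed set $\mathcal{P}$, $T_{\mathcal{P}}=\{\sigma:\mathcal{P}\cap[\![\sigma]\!]\neq\emptyset\}$ and $T_{\mathcal{P}}\upharpoonright n=T_{\mathcal{P}}\cap\{0,1\}^n$. $K^A$ is prefix-free Kolmogorov complexity relative to the oracle $A$; $\log=\log_2$. Additive homogeneity: let $\theta_{\mathcal{P}}(\sigma)=\#\{n:1\le n\le|\sigma|\ \&\ (\sigma\upharpoonright n)^{\curvearrowright}\in T_{\mathcal{P}}\}$.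 $\mathcal{P}$ is additively homogeneous if there is $c\in\omega$ such that $|\theta_{\mathcal{P}}(\sigma)-\theta_{\mathcal{P}}(\tau)|\le c$ for all $n$ and all $\sigma,\tau\in T_{\mathcal{P}}\upharpoonright n$. Martin-Löf randomness: for an oracle $A$ and a probability measure $\mu$ on $2^\omega$, $\mathsf{MLR}^A_\mu$ is the set of $X$ such that $X\notin\bigcap_n\mathcal{U}_n$ for every uniformly $A$-c.e. sequence of open sets $(\mathcal{U}_n)$ with $\mu(\mathcal{U}_n)\le2^{ -n}$ for all $n$; $\mathsf{MLR}^A=\mathsf{MLR}^A_\lambda$. Randomly produced paths: for $R\in2^\omega$, $\Psi_{\mathcal{P}}(R)\in\mathcal{P}$ is the sequence $X$ built recursively as follows. Given $\sigma=X\upharpoonright m\in T_{\mathcal{P}}$, let $n$ be the number of bits of $R$ used so far, i.e. the number of $j<m$ such that both one-bit extensions of $X\upharpoonright j$ lie in $T_{\mathcal{P}}$. If only one $i\in\{0,1\}$ satisfies $\sigma i\in T_{\mathcal{P}}$, put $X(m)=i$; if both $\sigma0,\sigma1\in T_{\mathcal{P}}$, put $X(m)=R(n)$. The randomly produced paths through $T_{\mathcal{P}}$ are the members of $\{\Psi_{\mathcal{P}}(R):R\in\mathsf{MLR}^{T_{\mathcal{P}}}\}$. Incompressibility: $X\in\mathcal{P}$ is $T_{\mathcal{P}}$-incompressible if there is $c$ such that $K^{T_{\mathcal{P}}}(X\upharpoonright n)\ge\log\#(T_{\mathcal{P}}\upharpoonright n)-c$ for all $n$. Global randomness: the limiting relative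 measure is $\lambda_{\mathcal{P}}(\sigma)=\lim_{n\to\infty}\dfrac{\lambda([\![\sigma]\!]\cap[\![T_{\mathcal{P}}\upharpoonright n]\!])}{\lambda([\![T_{\mathcal{P}}\upharpoonright n]\!])}$, when the limit exists (it is $0$ for $\sigma\notin T_{\mathcal{P}}$). When it is defined for all $\sigma$, it determines a probability measure on $2^\omega$, and $X$ is globally random in $\mathcal{P}$ if $X\in\mathsf{MLR}^{T_{\mathcal{P}}}_{\lambda_{\mathcal{P}}}$. -}

module Defs where

open import Axiom.ExcludedMiddle using (ExcludedMiddle)
open import Data.Bool using (Bool; true; false; not; if_then_else_)
open import Data.Fin using (Fin)
open import Data.List using (List; []; _∷_; _++_; _∷ʳ_; map; foldr; filter; length; take; upTo; applyUpTo)
open import Data.List.Relation.Binary.Prefix.Heterogeneous using (Prefix)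
open import Data.Nat as ℕ using (ℕ; zero; suc; _⊔_; ∣_-_∣)
import Data.Nat.Properties as ℕₚ
open import Data.Product using (∃; ∃-syntax; _×_; _,_; proj₁; proj₂)
open import Data.Rational as ℚ using (ℚ; 0ℚ; 1ℚ; ½)
import Data.Rational.Properties as ℚₚ
open import Data.Vec as Vec using (Vec)
open import Data.Vec.Relation.Binary.Pointwise.Inductive using (Pointwise)
open import Function using (_⇔_)
open import Level using (0ℓ)
open import Relation.Binary.PropositionalEquality
  using (_≡_; _≗_; refl; sym; trans; cong; subst)
open import Relation.Nullary using (¬_; yes; no; does)
open import Relation.Unary using (Pred; Decidable; _∈_; _∩_; _⊆_; Satisfiable)

------------------------------------------------------------------------
-- Strings and sequences

String : Set
String = List Bool

Cantor : Set
Cantor = ℕ → Bool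

infix 8 _↾_
_↾_ : Cantor → ℕ → String
X ↾ n = applyUpTo X n

infix 4 _≼_ _≺_
_≼_ : String → String → Set
_≼_ = Prefix _≡_

_≺_ : String → Cantor → Set
σ ≺ X = X ↾ length σ ≡ σ

⟦_⟧ : String → Pred Cantor 0ℓ
⟦ σ ⟧ X = σ ≺ X

⟦_⟧ˢ : Pred String 0ℓ → Pred Cantor 0ℓ
⟦ S ⟧ˢ X = ∃[ σ ] σ ∈ S × σ ≺ X

-- The empty string has no last bit; the clause for it is never used below.
flipLast : String → String
flipLast []          = []
flipLast (b ∷ [])    = not b ∷ []
flipLast (b ∷ c ∷ σ) = b ∷ flipLast (c ∷ σ)

strings : ℕ → List String
strings zero    = [] ∷ []
strings (suc n) = map (false ∷_) (strings n) ++ map (true ∷_) (strings n)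

------------------------------------------------------------------------
-- Computability relative to an oracle: Kleene's partial recursive functions

-- The length-lexicographic bijection between strings and numbers.
⌜_⌝ : String → ℕ
⌜ [] ⌝        = 0
⌜ false ∷ σ ⌝ = 1 ℕ.+ 2 ℕ.* ⌜ σ ⌝
⌜ true ∷ σ ⌝  = 2 ℕ.+ 2 ℕ.* ⌜ σ ⌝

bit : Bool → ℕ
bit b = if b then 1 else 0

Oracle : Set
Oracle = String → Bool

∅ : Oracle
∅ _ = false

data Rec : ℕ → Set where
  zeroᶠ : ∀ {n} → Rec n
  sucᶠ  : Rec 1
  projᶠ : ∀ {n} → Fin n → Rec n
  query : Rec 1
  comp  : ∀ {k n} → Rec k → Vec (Rec n) k → Rec n
  prec  : ∀ {n} → Rec n → Rec (2 ℕ.+ n) → Rec (1 ℕ.+ n)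
  μᶠ    : ∀ {n} → Rec (1 ℕ.+ n) → Rec n

-- A ⊢ f [ xs ]⇓ y : with oracle A, f converges on input xs with value y.
infix 4 _⊢_[_]⇓_
data _⊢_[_]⇓_ (A : Oracle) : ∀ {n} → Rec n → Vec ℕ n → ℕ → Set where
  zero⇓ : ∀ {n} {xs : Vec ℕ n} → A ⊢ zeroᶠ [ xs ]⇓ 0
  suc⇓  : ∀ {x} → A ⊢ sucᶠ [ x Vec.∷ Vec.[] ]⇓ suc x
  proj⇓ : ∀ {n} {xs : Vec ℕ n} i → A ⊢ projᶠ i [ xs ]⇓ Vec.lookup xs i
  query⇓ : ∀ {x} σ → x ≡ ⌜ σ ⌝ → A ⊢ query [ x Vec.∷ Vec.[] ]⇓ bit (A σ)
  comp⇓ : ∀ {k n} {f : Rec k} {gs : Vec (Rec n) k} {xs : Vec ℕ n} {ys : Vec ℕ k} {z} →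
          Pointwise (λ g y → A ⊢ g [ xs ]⇓ y) gs ys →
          A ⊢ f [ ys ]⇓ z → A ⊢ comp f gs [ xs ]⇓ z
  prec-zero⇓ : ∀ {n} {f : Rec n} {g} {xs : Vec ℕ n} {z} →
          A ⊢ f [ xs ]⇓ z → A ⊢ prec f g [ 0 Vec.∷ xs ]⇓ z
  prec-suc⇓ : ∀ {n} {f : Rec n} {g} {m} {xs : Vec ℕ n} {y z} →
          A ⊢ prec f g [ m Vec.∷ xs ]⇓ y →
          A ⊢ g [ m Vec.∷ y Vec.∷ xs ]⇓ z →
          A ⊢ prec f g [ suc m Vec.∷ xs ]⇓ z
  μ⇓    : ∀ {n} {f : Rec (1 ℕ.+ n)} {xs : Vec ℕ n} {m} →
          A ⊢ f [ m Vec.∷ xs ]⇓ 0 →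
          (∀ i → i ℕ.< m → ∃[ y ] A ⊢ f [ i Vec.∷ xs ]⇓ suc y) →
          A ⊢ μᶠ f [ xs ]⇓ m

ComputableSet : (String → Bool) → Set
ComputableSet T = ∃[ e ] ∀ σ → ∅ ⊢ e [ ⌜ σ ⌝ Vec.∷ Vec.[] ]⇓ bit (T σ)

-- The n-th set of the uniformly A-c.e. sequence with index e.
W : Oracle → Rec 2 → ℕ → Pred String 0ℓ
W A e n σ = ∃[ y ] A ⊢ e [ n Vec.∷ ⌜ σ ⌝ Vec.∷ Vec.[] ]⇓ y

IsTree : (String → Bool) → Set
IsTree T = ∀ {σ τ} → σ ≼ τ → T τ ≡ true → T σ ≡ true

Π⁰₁ : Pred Cantor 0ℓ → Set
Π⁰₁ P = ∃[ T ] IsTree T × ComputableSet T × (∀ X → X ∈ P ⇔ (∀ n → T (X ↾ n) ≡ true))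

------------------------------------------------------------------------
-- Prefix-free Kolmogorov complexity

infix 4 _⊢_⟨_⟩≃_
_⊢_⟨_⟩≃_ : Oracle → Rec 1 → String → String → Set
A ⊢ M ⟨ τ ⟩≃ σ = A ⊢ M [ ⌜ τ ⌝ Vec.∷ Vec.[] ]⇓ ⌜ σ ⌝

PrefixFree : Oracle → Rec 1 → Set
PrefixFree A M = ∀ {τ τ′ y y′} →
  A ⊢ M [ ⌜ τ ⌝ Vec.∷ Vec.[] ]⇓ y → A ⊢ M [ ⌜ τ′ ⌝ Vec.∷ Vec.[] ]⇓ y′ →
  τ ≼ τ′ → τ ≡ τ′

-- U is a reference machine for K^A: it is prefix-free with oracle A, and
-- optimal up to an additive constant among such machines.
OptimalPrefixFree : Oracle → Rec 1 → Set
OptimalPrefixFree A U = PrefixFree A U ×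
  (∀ M → PrefixFree A M → ∃[ c ] ∀ τ σ → A ⊢ M ⟨ τ ⟩≃ σ →
     ∃[ τ′ ] A ⊢ U ⟨ τ′ ⟩≃ σ × length τ′ ℕ.≤ length τ ℕ.+ c)

-- K A U σ k : the complexity K^A(σ), as measured by U, equals k.
K : Oracle → Rec 1 → String → ℕ → Set
K A U σ k = (∃[ τ ] A ⊢ U ⟨ τ ⟩≃ σ × length τ ≡ k) ×
            (∀ τ → A ⊢ U ⟨ τ ⟩≃ σ → k ℕ.≤ length τ)

------------------------------------------------------------------------
-- Real numbers, as Cauchy sequences of rationals

Cauchy : (ℕ → ℚ) → Set
Cauchy q = ∀ ε → 0ℚ ℚ.< ε → ∃[ N ] ∀ m n → N ℕ.≤ m → N ℕ.≤ n → ℚ.∣ q m ℚ.- q n ∣ ℚ.≤ ε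

record ℝ : Set where
  constructor real
  field
    approx : ℕ → ℚ
    cauchy : Cauchy approx
open ℝ

infix 4 _≤ℝ_
_≤ℝ_ : ℝ → ℝ → Set
x ≤ℝ y = ∀ ε → 0ℚ ℚ.< ε → ∃[ N ] ∀ n → N ℕ.≤ n → approx x n ℚ.≤ approx y n ℚ.+ ε

fromℚ : ℚ → ℝ
fromℚ p = real (λ _ → p) λ ε 0<ε → 0 , λ _ _ _ _ →
  subst (ℚ._≤ ε) (sym (cong ℚ.∣_∣ (ℚₚ.+-inverseʳ p))) (ℚₚ.<⇒≤ 0<ε)

private
  halves : ∀ ε → ½ ℚ.* ε ℚ.+ ½ ℚ.* ε ≡ ε
  halves ε = trans (sym (ℚₚ.*-distribʳ-+ ε ½ ½)) (ℚₚ.*-identityˡ ε)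

  half-pos : ∀ {ε} → 0ℚ ℚ.< ε → 0ℚ ℚ.< ½ ℚ.* ε
  half-pos {ε} 0<ε = subst (ℚ._< ½ ℚ.* ε) (ℚₚ.*-zeroʳ ½) (ℚₚ.*-monoʳ-<-pos ½ 0<ε)

  interchange : ∀ a b c d → (a ℚ.+ b) ℚ.- (c ℚ.+ d) ≡ (a ℚ.- c) ℚ.+ (b ℚ.- d)
  interchange a b c d = solve 4 (λ a b c d → (a :+ b) :- (c :+ d) := (a :- c) :+ (b :- d))
                              refl a b c d
    where open import Data.Rational.Solver using (module +-*-Solver)
          open +-*-Solver

infixl 6 _+ℝ_
_+ℝ_ : ℝ → ℝ → ℝ
real x cx +ℝ real y cy = real (λ n → x n ℚ.+ y n) λ ε 0<ε →
  let (M , p) = cx (½ ℚ.* ε) (half-pos 0<ε)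
      (N , q) = cy (½ ℚ.* ε) (half-pos 0<ε)
  in M ⊔ N , λ m n m≥ n≥ → begin
    ℚ.∣ (x m ℚ.+ y m) ℚ.- (x n ℚ.+ y n) ∣
      ≡⟨ cong ℚ.∣_∣ (interchange (x m) (y m) (x n) (y n)) ⟩
    ℚ.∣ (x m ℚ.- x n) ℚ.+ (y m ℚ.- y n) ∣
      ≤⟨ ℚₚ.∣p+q∣≤∣p∣+∣q∣ (x m ℚ.- x n) (y m ℚ.- y n) ⟩
    ℚ.∣ x m ℚ.- x n ∣ ℚ.+ ℚ.∣ y m ℚ.- y n ∣
      ≤⟨ ℚₚ.+-mono-≤ (p m n (ℕₚ.m⊔n≤o⇒m≤o M N m≥) (ℕₚ.m⊔n≤o⇒m≤o M N n≥))
                     (q m n (ℕₚ.m⊔n≤o⇒n≤o M N m≥) (ℕₚ.m⊔n≤o⇒n≤o M N n≥)) ⟩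
    ½ ℚ.* ε ℚ.+ ½ ℚ.* ε
      ≡⟨ halves ε ⟩
    ε ∎
  where open ℚₚ.≤-Reasoning

Lim : (ℕ → ℚ) → ℝ → Set
Lim q x = ∀ ε → 0ℚ ℚ.< ε → ∃[ N ] ∀ n → N ℕ.≤ n →
  (fromℚ (q n ℚ.- ε) ≤ℝ x) × (x ≤ℝ fromℚ (q n ℚ.+ ε))

Convergent : (ℕ → ℚ) → Set
Convergent q = ∃ (Lim q)

½^ : ℕ → ℚ
½^ zero    = 1ℚ
½^ (suc n) = ½ ℚ.* ½^ n

-- Division with the convention p / 0 = 0.
infixl 7 _÷₀_
_÷₀_ : ℚ → ℚ → ℚ
p ÷₀ q with q ℚₚ.≟ 0ℚ
... | yes _  = 0ℚ
... | no q≢0 = ℚ._÷_ p q {{ℚ.≢-nonZero q≢0}}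

------------------------------------------------------------------------
-- The metatheory of the notions below is classical: sets of strings such as
-- the tree of extendible nodes of a Π⁰₁ class are in general undecidable, so
-- counting them, or using them as oracles, appeals to excluded middle.

module Classical (em : ExcludedMiddle 0ℓ) where

  dec : ∀ {A : Set} (S : Pred A 0ℓ) → Decidable S
  dec S x = em {S x}

  χ : Pred String 0ℓ → Oracle
  χ S σ = does (dec S σ)

  ----------------------------------------------------------------------
  -- Measures on Cantor space

  cylindersIn : ℕ → Pred Cantor 0ℓ → List String
  cylindersIn m C = filter (dec (λ τ → ⟦ τ ⟧ ⊆ C)) (strings m)

  -- A measure is given by its values on cylinders.  For open U, μ(U) is the
  -- supremum over m of the total measure of the cylinders of level m inside U.
  MeasureAtMost : (String → ℝ) → Pred Cantor 0ℓ → ℝ → Set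
  MeasureAtMost μ U r =
    ∀ m → foldr (λ τ s → μ τ +ℝ s) (fromℚ 0ℚ) (cylindersIn m U) ≤ℝ r

  lebesgue : String → ℝ
  lebesgue σ = fromℚ (½^ (length σ))

  -- The Lebesgue measure of C, for C a union of cylinders of level m.
  clopenLebesgue : ℕ → Pred Cantor 0ℓ → ℚ
  clopenLebesgue m C = foldr (λ τ s → ½^ (length τ) ℚ.+ s) 0ℚ (cylindersIn m C)

  MLTest : Oracle → (String → ℝ) → Rec 2 → Set
  MLTest A μ e = ∀ n → MeasureAtMost μ ⟦ W A e n ⟧ˢ (fromℚ (½^ n))

  MLR : Oracle → (String → ℝ) → Pred Cantor 0ℓ
  MLR A μ X = ∀ e → MLTest A μ e → ¬ (∀ n → X ∈ ⟦ W A e n ⟧ˢ)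

  ----------------------------------------------------------------------
  -- Closed sets and their trees of extendible nodes

  module _ (P : Pred Cantor 0ℓ) where

    T : Pred String 0ℓ
    T σ = Satisfiable (P ∩ ⟦ σ ⟧)

    Tlevel : ℕ → Pred String 0ℓ
    Tlevel n σ = σ ∈ T × length σ ≡ n

    #T : ℕ → ℕ
    #T n = length (filter (dec (Tlevel n)) (strings n))

    θ : String → ℕ
    θ σ = length (filter (dec (λ n → flipLast (take n σ) ∈ T))
                         (applyUpTo suc (length σ)))

    AdditivelyHomogeneous : Set
    AdditivelyHomogeneous =
      ∃[ c ] ∀ n σ τ → σ ∈ Tlevel n → τ ∈ Tlevel n → ∣ θ σ - θ τ ∣ ℕ.≤ c

    Branching : Pred String 0ℓ
    Branching σ = (σ ∷ʳ false) ∈ T × (σ ∷ʳ true) ∈ T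

    bitsUsed : String → ℕ
    bitsUsed σ = length (filter (dec (λ j → take j σ ∈ Branching)) (upTo (length σ)))

    -- For σ ∈ T, the node σ has an extension in T, so a non-branching σ is
    -- continued by 1 exactly when σ1 ∈ T.
    nextBit : Cantor → String → Bool
    nextBit R σ = if χ Branching σ then R (bitsUsed σ) else χ T (σ ∷ʳ true)

    Ψ↾ : Cantor → ℕ → String
    Ψ↾ R zero    = []
    Ψ↾ R (suc m) = Ψ↾ R m ∷ʳ nextBit R (Ψ↾ R m)

    Ψ : Cantor → Cantor
    Ψ R m = nextBit R (Ψ↾ R m)

    RandomlyProduced : Pred Cantor 0ℓ
    RandomlyProduced X = ∃[ R ] R ∈ MLR (χ T) lebesgue × X ≗ Ψ R

    -- K(X↾n) ≥ log #(T↾n) - c, in exponential form.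
    Incompressible : Rec 1 → Pred Cantor 0ℓ
    Incompressible U X =
      ∃[ c ] ∀ n k → K (χ T) U (X ↾ n) k → #T n ℕ.≤ 2 ℕ.^ (k ℕ.+ c)

    -- The sets measured here are unions of cylinders of level n ⊔ |σ| and n.
    -- The denominator is nonzero when P is nonempty.
    relativeMeasure : String → ℕ → ℚ
    relativeMeasure σ n = clopenLebesgue (n ⊔ length σ) (⟦ σ ⟧ ∩ ⟦ Tlevel n ⟧ˢ)
                       ÷₀ clopenLebesgue n ⟦ Tlevel n ⟧ˢ

    LimitingRelativeMeasureDefined : Set
    LimitingRelativeMeasureDefined = ∀ σ → σ ∈ T → Convergent (relativeMeasure σ)

    limitingRelativeMeasure : LimitingRelativeMeasureDefined → String → ℝ
    limitingRelativeMeasure defined σ with dec T σ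
    ... | yes σ∈T = proj₁ (defined σ σ∈T)
    ... | no  _   = fromℚ 0ℚ

    GloballyRandom : LimitingRelativeMeasureDefined → Pred Cantor 0ℓ
    GloballyRandom defined X = X ∈ MLR (χ T) (limitingRelativeMeasure defined)

{-# OPTIONS --safe #-}

-- Let A be the tree T of P as an oracle.  Write bits(σ) for the bits of σ at the
-- branching nodes below σ, so that Ψ(R) is the path through T with bits R, and
-- put t(σ) = |bits(σ)|; this is θ(σ) for σ ∈ T.  The measure ν(σ) = 2^-t(σ) on T
-- is the image of the uniform measure under Ψ, and homogeneity makes each of
-- t(σ) and log #(T ↾ |σ|), as well as each of ν and λ_P, agree up to a constant
-- (additive and multiplicative, respectively).
--
-- (a) ⇒ (b): R is incompressible by the Levin–Schnorr theorem, and a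
-- description of X ↾ n yields one of bits(X ↾ n), an initial segment of R.
-- (b) ⇒ (c): the other half of the Levin–Schnorr theorem, for ν: a test of small
-- measure gives a light set of requests, hence short descriptions.
-- (c) ⇒ (a): if X branches infinitely often, its bits determine R, and a test for
-- R pulls back along σ ↦ bits(σ) to a test for X.  Otherwise any random R
-- extending the finitely many bits of X will do, and incompressible, hence
-- random, extensions exist by Kraft's inequality.

module Submission where

open import Defs
open import Axiom.ExcludedMiddle using (ExcludedMiddle)
open import Data.Bool using (Bool; true; false; not; if_then_else_; _∧_)
open import Data.Fin using (Fin)
open import Data.List using (List; []; _∷_; _++_; _∷ʳ_; length; take; drop; applyUpTo; upTo; filter; foldr; foldl; map)
open import Data.List.Membership.Propositional using () renaming (_∈_ to _∈ˡ_)
open import Data.List.Membership.Propositional.Properties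
  using (∈-++⁻; ∈-++⁺ˡ; ∈-++⁺ʳ; ∈-map⁻; ∈-map⁺; ∈-upTo⁻)
open import Data.List.Properties
  using (length-applyUpTo; applyUpTo-∷ʳ; ∷-injectiveˡ; ∷-injectiveʳ; length-++; foldl-++; ++-identityʳ; filter-++)
open import Data.List.Relation.Binary.Prefix.Heterogeneous as Prefix using (Prefix)
open import Data.List.Relation.Unary.All as All using (All)
open import Data.List.Relation.Unary.AllPairs using ([]; _∷_)
open import Data.List.Relation.Unary.Any using (here; there)
open import Data.List.Relation.Unary.Unique.Propositional using (Unique)
import Data.List.Relation.Unary.Unique.Propositional.Properties as Uniqueₚ
open import Data.Nat
open import Data.Nat.DivMod using (_/_; m/n*n≤m; m≡m%n+[m/n]*n; m%n<n)
open import Data.Nat.Properties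
open import Data.Nat.Solver using () renaming (module +-*-Solver to ℕ-Solver)
open import Data.Product using (∃-syntax; _×_; _,_; proj₁; proj₂)
open import Data.Rational as ℚ using (ℚ; 0ℚ; 1ℚ; ½)
import Data.Rational.Properties as ℚₚ
open import Data.Rational.Solver using (module +-*-Solver)
open import Data.Sum using (_⊎_; inj₁; inj₂)
open import Data.Vec as Vec using (Vec; []; _∷_; head; tail; lookup)
import Data.Vec.Properties as Vecₚ
open import Data.Vec.Relation.Binary.Pointwise.Inductive as Pointwise using (Pointwise; []; _∷_)
open import Function using (_⇔_; mk⇔; Equivalence; _∘_; id)
open import Level using (0ℓ)
open import Relation.Binary.Definitions using (tri<; tri≈; tri>)
open import Relation.Binary.PropositionalEquality
open import Relation.Nullary
open import Relation.Nullary.Decidable using (decidable-stable)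
open import Relation.Unary using (Pred; _∈_; _∉_; _∩_; Satisfiable)

-- Strings and their codes

-- The measure λ_P is a limit with no known rate of convergence, so its values cannot serve a
-- machine as weights. The values of ν are dyadic and computable from A, and 2^-2c ν ≤ λ_P ≤ 2^2c ν
-- when c bounds the differences of θ: one factor 2^c is lost in comparing ν(σ) with the number of
-- extensions of σ on a level, another for the size of that whole level. The combinatorics therefore
-- uses ν and exact rational sums; real numbers enter only through rational bounds on single
-- cylinders.
--
-- A test is merely enumerable, which would force a Kraft-Chaitin machine to allocate intervals as
-- requests appear. Here every enumerated set is first replaced by a decidable one with disjoint
-- cylinders. Requests can then be ordered by their codes, and the interval of each is found by
-- integer arithmetic from the weight of the earlier ones.
--
-- If the n-th set of requests weighs at most 2^-2n, all its descriptions begin with 2n zeros. These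
-- are dropped, and the marker 1ⁿ0 put in their place costs n + 1, so that n bits are gained up to a
-- constant. This gain contradicts incompressibility.

suc-string : String → String
suc-string []          = false ∷ []
suc-string (false ∷ σ) = true ∷ σ
suc-string (true ∷ σ)  = false ∷ suc-string σ

-- The codes are bijective base-two numerals, least significant digit first, with digits 1 and 2 for
-- `false` and `true`. Inverting them amounts to iterating the successor with carry.
decode : ℕ → String
decode zero    = []
decode (suc x) = suc-string (decode x)

⌜suc-string⌝ : ∀ σ → ⌜ suc-string σ ⌝ ≡ suc ⌜ σ ⌝
⌜suc-string⌝ []          = refl
⌜suc-string⌝ (false ∷ σ) = refl
⌜suc-string⌝ (true ∷ σ)  =
  trans (cong (λ x → suc (2 * x)) (⌜suc-string⌝ σ)) (cong suc (*-suc 2 ⌜ σ ⌝))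

⌜decode⌝ : ∀ x → ⌜ decode x ⌝ ≡ x
⌜decode⌝ zero    = refl
⌜decode⌝ (suc x) = trans (⌜suc-string⌝ (decode x)) (cong suc (⌜decode⌝ x))

⌜⌝-injective : ∀ σ τ → ⌜ σ ⌝ ≡ ⌜ τ ⌝ → σ ≡ τ
⌜⌝-injective []          []          eq = refl
⌜⌝-injective (false ∷ σ) (false ∷ τ) eq =
  cong (false ∷_) (⌜⌝-injective σ τ (*-cancelˡ-≡ _ _ 2 (suc-injective eq)))
⌜⌝-injective (true ∷ σ)  (true ∷ τ)  eq =
  cong (true ∷_) (⌜⌝-injective σ τ (*-cancelˡ-≡ _ _ 2 (suc-injective (suc-injective eq))))
⌜⌝-injective []          (false ∷ τ) ()
⌜⌝-injective []          (true ∷ τ)  ()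
⌜⌝-injective (false ∷ σ) []          ()
⌜⌝-injective (true ∷ σ)  []          ()
⌜⌝-injective (false ∷ σ) (true ∷ τ)  eq = contradiction (suc-injective eq) (even≢odd ⌜ σ ⌝ ⌜ τ ⌝)
⌜⌝-injective (true ∷ σ)  (false ∷ τ) eq =
  contradiction (sym (suc-injective eq)) (even≢odd ⌜ τ ⌝ ⌜ σ ⌝)

decode⌜⌝ : ∀ σ → decode ⌜ σ ⌝ ≡ σ
decode⌜⌝ σ = ⌜⌝-injective _ σ (⌜decode⌝ ⌜ σ ⌝)

length≤⌜⌝ : ∀ σ → length σ ≤ ⌜ σ ⌝
length≤⌜⌝ []          = z≤n
length≤⌜⌝ (false ∷ σ) = s≤s (≤-trans (length≤⌜⌝ σ) (m≤m+n _ _))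
length≤⌜⌝ (true ∷ σ)  = s≤s (m≤n⇒m≤1+n (≤-trans (length≤⌜⌝ σ) (m≤m+n _ _)))

-- Total computable functions

ifz : ∀ {a} {X : Set a} → ℕ → X → X → X
ifz zero    a b = a
ifz (suc _) a b = b

rec : ∀ {a} {X : Set a} → X → (ℕ → X → X) → ℕ → X
rec z s zero    = z
rec z s (suc k) = s k (rec z s k)

-- The least y with p y ≡ 0, if it is at most k.
climb : (ℕ → ℕ) → ℕ → ℕ
climb p = rec 0 (λ _ y → ifz (p y) y (suc y))

climb-reaches : ∀ p m → (∀ i → i < m → p i ≢ 0) → p m ≡ 0 → ∀ k → m ≤ k → climb p k ≡ m
climb-reaches p m below at k m≤k =
  trans (cong (climb p) (sym (m∸n+n≡m m≤k))) (stays (k ∸ m))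
  where
  step : ∀ y → p y ≢ 0 → ifz (p y) y (suc y) ≡ suc y
  step y nz with p y
  ... | zero  = contradiction refl nz
  ... | suc _ = refl
  rises : ∀ k → k ≤ m → climb p k ≡ k
  rises zero    _   = refl
  rises (suc k) k<m = trans (cong (λ y → ifz (p y) y (suc y)) (rises k (<⇒≤ k<m)))
                            (step k (below k k<m))
  stays : ∀ j → climb p (j + m) ≡ m
  stays zero    = rises m ≤-refl
  stays (suc j) = trans (cong (λ y → ifz (p y) y (suc y)) (stays j))
                        (cong (λ x → ifz x m (suc m)) at)

-- Unlike `climb-reaches`, this presupposes no zero: soundness of a search uses the climb before it
-- is known to have found anything.
climb-below : ∀ p k i → i < climb p k → p i ≢ 0
climb-below p (suc k) i i< pi≡0 with p (climb p k) in eq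
... | zero  = climb-below p k i i< pi≡0
... | suc _ with m<1+n⇒m<n∨m≡n i<
...   | inj₁ i<′  = climb-below p k i i<′ pi≡0
...   | inj₂ refl = 0≢1+n (trans (sym pi≡0) eq)

-- Programs for total functions, and an evaluator for all programs

module Computability (A : Oracle) where

  -- Only total functions are treated, so that closure properties are plain combinators. Partiality
  -- enters later through an outermost `μᶠ` or through composition with a given program.
  record Computable {n} (f : Vec ℕ n → ℕ) : Set where
    constructor computable
    field
      program  : Rec n
      computes : ∀ xs → A ⊢ program [ xs ]⇓ f xs
  open Computable public

  record ComputableVec {n k} (f : Vec ℕ n → Vec ℕ k) : Set where
    constructor computableVec
    field
      programs  : Vec (Rec n) k
      computesᵛ : ∀ xs → Pointwise (λ p y → A ⊢ p [ xs ]⇓ y) programs (f xs)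
  open ComputableVec public

  private variable
    n k : ℕ
    f g h : Vec ℕ n → ℕ
    u : Vec ℕ n → Vec ℕ k

  extᶜ : Computable f → (∀ xs → f xs ≡ g xs) → Computable g
  extᶜ (computable p c) eq = computable p λ xs → subst (A ⊢ p [ xs ]⇓_) (eq xs) (c xs)

  []ᵛ : ComputableVec {n} (λ _ → [])
  []ᵛ = computableVec [] (λ _ → [])

  infixr 5 _∷ᵛ_
  _∷ᵛ_ : Computable f → ComputableVec u → ComputableVec (λ xs → f xs ∷ u xs)
  computable p c ∷ᵛ computableVec ps cs = computableVec (p ∷ ps) (λ xs → c xs ∷ cs xs)

  tailᵛ : {u : Vec ℕ n → Vec ℕ (suc k)} → ComputableVec u → ComputableVec (λ xs → tail (u xs))
  tailᵛ {u = u} (computableVec (p ∷ ps) cs) = computableVec ps λ xs → go (u xs) (cs xs)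
    where
    go : ∀ {xs} ys → Pointwise (λ p y → A ⊢ p [ xs ]⇓ y) (p ∷ ps) ys →
         Pointwise (λ p y → A ⊢ p [ xs ]⇓ y) ps (tail ys)
    go (_ ∷ _) (_ ∷ cs) = cs

  idᵛ : ComputableVec {n} id
  idᵛ {n} = computableVec (Vec.tabulate projᶠ) λ xs →
    subst (Pointwise _ _) (Vecₚ.tabulate∘lookup xs) (Pointwise.tabulate⁺ proj⇓)

  subᶜ : {f : Vec ℕ k → ℕ} → Computable f → ComputableVec u → Computable (λ xs → f (u xs))
  subᶜ (computable p c) (computableVec ps cs) = computable (comp p ps) λ xs → comp⇓ (cs xs) (c _)

  varᶜ : (i : Fin n) → Computable (λ xs → lookup xs i)
  varᶜ i = computable (projᶠ i) λ _ → proj⇓ i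

  headᶜ : {u : Vec ℕ n → Vec ℕ (suc k)} → ComputableVec u → Computable (λ xs → head (u xs))
  headᶜ {u = u} (computableVec (p ∷ ps) cs) = computable p λ xs → go (u xs) (cs xs)
    where
    go : ∀ {xs} ys → Pointwise (λ p y → A ⊢ p [ xs ]⇓ y) (p ∷ ps) ys → A ⊢ p [ xs ]⇓ head ys
    go (_ ∷ _) (c ∷ _) = c

  sucᶜ : Computable f → Computable (λ xs → suc (f xs))
  sucᶜ (computable p c) = computable (comp sucᶠ (p ∷ [])) λ xs → comp⇓ (c xs ∷ []) suc⇓

  constᶜ : ∀ m → Computable {n} (λ _ → m)
  constᶜ zero    = computable zeroᶠ λ _ → zero⇓
  constᶜ (suc m) = sucᶜ (constᶜ m)

  recᶜ : {s : Vec ℕ (2 + n) → ℕ} → Computable f → Computable s → Computable h →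
         Computable (λ xs → rec (f xs) (λ m y → s (m ∷ y ∷ xs)) (h xs))
  recᶜ {f = f} {s = s} (computable p c) (computable q d) (computable r e) =
    computable (comp (prec p q) (r ∷ programs idᵛ)) λ xs →
      comp⇓ (e xs ∷ computesᵛ idᵛ xs) (loop xs _)
    where
    loop : ∀ xs m → A ⊢ prec p q [ m ∷ xs ]⇓ rec (f xs) (λ m y → s (m ∷ y ∷ xs)) m
    loop xs zero    = prec-zero⇓ (c xs)
    loop xs (suc m) = prec-suc⇓ (loop xs m) (d _)

  weakenᶜ : Computable f → Computable (λ xs → f (tail xs))
  weakenᶜ c = subᶜ c (tailᵛ idᵛ)

  weaken²ᶜ : Computable f → Computable (λ xs → f (tail (tail xs)))
  weaken²ᶜ c = weakenᶜ (weakenᶜ c)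

  v₀ : Computable {suc n} (λ xs → lookup xs Fin.zero)
  v₀ = varᶜ Fin.zero

  v₁ : Computable {2 + n} (λ xs → lookup xs (Fin.suc Fin.zero))
  v₁ = varᶜ (Fin.suc Fin.zero)

  ifzᶜ : Computable h → Computable f → Computable g →
         Computable (λ xs → ifz (h xs) (f xs) (g xs))
  ifzᶜ {h = h} {f = f} {g = g} ch cf cg =
    extᶜ (recᶜ cf (weaken²ᶜ cg) ch) λ xs → go (h xs) (f xs) (g xs)
    where
    go : ∀ m a b → rec a (λ _ _ → b) m ≡ ifz m a b
    go zero    a b = refl
    go (suc m) a b = refl

  predᶜ : Computable f → Computable (λ xs → pred (f xs))
  predᶜ {f = f} c = extᶜ (recᶜ (constᶜ 0) v₀ c) λ xs → go (f xs)
    where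
    go : ∀ m → rec 0 (λ m _ → m) m ≡ pred m
    go zero    = refl
    go (suc m) = refl

  infixl 6 _+ᶜ_ _∸ᶜ_
  infixl 7 _*ᶜ_
  _+ᶜ_ : Computable f → Computable g → Computable (λ xs → f xs + g xs)
  _+ᶜ_ {f = f} {g = g} cf cg =
    extᶜ (recᶜ cg (sucᶜ v₁) cf) λ xs → go (f xs) (g xs)
    where
    go : ∀ m a → rec a (λ _ y → suc y) m ≡ m + a
    go zero    a = refl
    go (suc m) a = cong suc (go m a)

  _∸ᶜ_ : Computable f → Computable g → Computable (λ xs → f xs ∸ g xs)
  _∸ᶜ_ {f = f} {g = g} cf cg =
    extᶜ (recᶜ cf (predᶜ v₁) cg) λ xs → go (g xs) (f xs)
    where
    go : ∀ m a → rec a (λ _ y → pred y) m ≡ a ∸ m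
    go zero    a = refl
    go (suc m) a = trans (cong pred (go m a)) (pred[m∸n]≡m∸[1+n] a m)

  _*ᶜ_ : Computable f → Computable g → Computable (λ xs → f xs * g xs)
  _*ᶜ_ {f = f} {g = g} cf cg =
    extᶜ (recᶜ (constᶜ 0) (weaken²ᶜ cg +ᶜ v₁) cf) λ xs → go (f xs) (g xs)
    where
    go : ∀ m a → rec 0 (λ _ y → a + y) m ≡ m * a
    go zero    a = refl
    go (suc m) a = cong (a +_) (go m a)

  2^ᶜ : Computable f → Computable (λ xs → 2 ^ f xs)
  2^ᶜ {f = f} c = extᶜ (recᶜ (constᶜ 1) (constᶜ 2 *ᶜ v₁) c) λ xs → go (f xs)
    where
    go : ∀ m → rec 1 (λ _ y → 2 * y) m ≡ 2 ^ m
    go zero    = refl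
    go (suc m) = cong (2 *_) (go m)

  climbᶜ : {p : Vec ℕ (suc n) → ℕ} → Computable p → Computable h →
           Computable (λ xs → climb (λ y → p (y ∷ xs)) (h xs))
  climbᶜ c = recᶜ (constᶜ 0) (ifzᶜ (subᶜ c (v₁ ∷ᵛ tailᵛ (tailᵛ idᵛ))) v₁ (sucᶜ v₁))

  queryᶜ : Computable f → Computable (λ xs → bit (A (decode (f xs))))
  queryᶜ {f = f} (computable p c) = computable (comp query (p ∷ [])) λ xs →
    comp⇓ (c xs ∷ []) (query⇓ (decode (f xs)) (sym (⌜decode⌝ (f xs))))

  -- Step-bounded evaluation; the value 0 stands for "no result yet", suc y for the result y.

  allPositive : Vec ℕ k → ℕ
  allPositive []       = 1
  allPositive (y ∷ ys) = ifz y 0 (allPositive ys)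

  ev  : Rec n → ℕ → Vec ℕ n → ℕ
  evs : Vec (Rec n) k → ℕ → Vec ℕ n → Vec ℕ k
  ev zeroᶠ       s xs = 1
  ev sucᶠ        s xs = suc (suc (head xs))
  ev (projᶠ i)   s xs = suc (lookup xs i)
  ev query       s xs = suc (bit (A (decode (head xs))))
  ev (comp f gs) s xs = ifz (allPositive (evs gs s xs)) 0 (ev f s (Vec.map pred (evs gs s xs)))
  ev (prec f g)  s xs = rec (ev f s (tail xs))
    (λ m y → ifz y 0 (ev g s (m ∷ pred y ∷ tail xs))) (head xs)
  -- `pred` sends both "no result yet" and the result 0 to 0, so the climb halts at the first
  -- argument not known to give a positive result. The two tests that follow let only a genuine
  -- result 0 through. This search is the only place where the bound `s` restricts anything.
  ev (μᶠ f)      s xs = let m = climb (λ y → pred (ev f s (y ∷ xs))) s in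
    ifz (ev f s (m ∷ xs)) 0 (ifz (pred (ev f s (m ∷ xs))) (suc m) 0)
  evs []       s xs = []
  evs (g ∷ gs) s xs = ev g s xs ∷ evs gs s xs

  evᶜ  : (r : Rec n) → Computable {suc n} (λ xs → ev r (head xs) (tail xs))
  evsᶜ : (rs : Vec (Rec n) k) → Computable {suc n} (λ xs → allPositive (evs rs (head xs) (tail xs)))
  evsᵛ : (rs : Vec (Rec n) k) → ComputableVec {suc n} (λ xs → Vec.map pred (evs rs (head xs) (tail xs)))
  evᶜ zeroᶠ       = constᶜ 1
  evᶜ sucᶠ        = sucᶜ (sucᶜ (headᶜ (tailᵛ idᵛ)))
  evᶜ (projᶠ i)   = sucᶜ (subᶜ (varᶜ i) (tailᵛ idᵛ))
  evᶜ query       = sucᶜ (queryᶜ (headᶜ (tailᵛ idᵛ)))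
  evᶜ (comp f gs) = ifzᶜ (evsᶜ gs) (constᶜ 0) (subᶜ (evᶜ f) (headᶜ idᵛ ∷ᵛ evsᵛ gs))
  evᶜ (prec f g)  =
    recᶜ (subᶜ (evᶜ f) (headᶜ idᵛ ∷ᵛ tailᵛ (tailᵛ idᵛ)))
         (ifzᶜ v₁ (constᶜ 0)
           (subᶜ (evᶜ g) (headᶜ (tailᵛ (tailᵛ idᵛ)) ∷ᵛ v₀ ∷ᵛ predᶜ v₁ ∷ᵛ tailᵛ (tailᵛ (tailᵛ (tailᵛ idᵛ))))))
         (headᶜ (tailᵛ idᵛ))
  evᶜ (μᶠ f)      =
    ifzᶜ run (constᶜ 0) (ifzᶜ (predᶜ run) (sucᶜ least) (constᶜ 0))
    where
    least = climbᶜ (predᶜ (subᶜ (evᶜ f) (headᶜ (tailᵛ idᵛ) ∷ᵛ v₀ ∷ᵛ tailᵛ (tailᵛ idᵛ)))) (headᶜ idᵛ)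
    run = subᶜ (evᶜ f) (headᶜ idᵛ ∷ᵛ least ∷ᵛ tailᵛ idᵛ)
  evsᶜ []       = constᶜ 1
  evsᶜ (r ∷ rs) = ifzᶜ (evᶜ r) (constᶜ 0) (evsᶜ rs)
  evsᵛ []       = []ᵛ
  evsᵛ (r ∷ rs) = predᶜ (evᶜ r) ∷ᵛ evsᵛ rs

  ev-sound  : (r : Rec n) → ∀ s xs {y} → ev r s xs ≡ suc y → A ⊢ r [ xs ]⇓ y
  evs-sound : (rs : Vec (Rec n) k) → ∀ s xs → allPositive (evs rs s xs) ≢ 0 →
    Pointwise (λ r y → A ⊢ r [ xs ]⇓ y) rs (Vec.map pred (evs rs s xs))
  ev-sound zeroᶠ     s xs       refl = zero⇓
  ev-sound sucᶠ      s (x ∷ []) refl = suc⇓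
  ev-sound (projᶠ i) s xs       refl = proj⇓ i
  ev-sound query     s (x ∷ []) refl = query⇓ (decode x) (sym (⌜decode⌝ x))
  ev-sound (comp f gs) s xs eq with allPositive (evs gs s xs) in pos
  ... | suc _ = comp⇓ (evs-sound gs s xs λ z → 0≢1+n (trans (sym z) pos)) (ev-sound f s _ eq)
  ev-sound (prec f g) s (m ∷ xs) eq = loop m eq
    where
    loop : ∀ m {y} → ev (prec f g) s (m ∷ xs) ≡ suc y → A ⊢ prec f g [ m ∷ xs ]⇓ y
    loop zero    eq = prec-zero⇓ (ev-sound f s xs eq)
    loop (suc m) eq with ev (prec f g) s (m ∷ xs) in eq′
    ... | suc z = prec-suc⇓ (loop m eq′) (ev-sound g s _ eq)
  ev-sound (μᶠ f) s xs {y} eq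
    with climb (λ y → pred (ev f s (y ∷ xs))) s | climb-below (λ y → pred (ev f s (y ∷ xs))) s
  ... | m | below with ev f s (m ∷ xs) in eq′
  ...   | suc zero with refl ← eq = μ⇓ (ev-sound f s _ eq′) earlier
    where
    earlier : ∀ i → i < m → ∃[ y ] A ⊢ f [ i ∷ xs ]⇓ suc y
    earlier i i<m with ev f s (i ∷ xs) in eqᵢ | below i i<m
    ... | zero        | nz = contradiction refl nz
    ... | suc zero    | nz = contradiction refl nz
    ... | suc (suc z) | _  = z , ev-sound f s _ eqᵢ
  evs-sound []       s xs _   = []
  evs-sound (r ∷ rs) s xs pos with ev r s xs in eq
  ... | zero  = contradiction refl pos
  ... | suc z = ev-sound r s xs eq ∷ evs-sound rs s xs pos

  -- Asking for all large bounds, not just one, lets finitely many subcomputations share a bound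
  -- without a proof that `ev` is monotone in `s`.
  Eventually : (ℕ → Set) → Set
  Eventually Q = ∃[ s₀ ] ∀ s → s₀ ≤ s → Q s

  eventually-∩ : ∀ {Q R S : ℕ → Set} → (∀ s → Q s → R s → S s) →
    Eventually Q → Eventually R → Eventually S
  eventually-∩ f (a , p) (b , q) =
    a ⊔ b , λ s le → f s (p s (m⊔n≤o⇒m≤o a b le)) (q s (m⊔n≤o⇒n≤o a b le))

  eventually-< : ∀ {Q : ℕ → ℕ → Set} m → (∀ i → i < m → Eventually (Q i)) →
    Eventually (λ s → ∀ i → i < m → Q i s)
  eventually-< zero    ev = 0 , λ _ _ _ ()
  eventually-< {Q} (suc m) ev = eventually-∩ split (ev m ≤-refl)
    (eventually-< m λ i i<m → ev i (m≤n⇒m≤1+n i<m))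
    where
    split : ∀ s → Q m s → (∀ i → i < m → Q i s) → ∀ i → i < suc m → Q i s
    split s q qs i i< with m<1+n⇒m<n∨m≡n i<
    ... | inj₁ i<m  = qs i i<m
    ... | inj₂ refl = q

  ev-complete  : ∀ {r : Rec n} {xs y} → A ⊢ r [ xs ]⇓ y → Eventually (λ s → ev r s xs ≡ suc y)
  evs-complete : ∀ {rs : Vec (Rec n) k} {xs ys} → Pointwise (λ r y → A ⊢ r [ xs ]⇓ y) rs ys →
    Eventually (λ s → evs rs s xs ≡ Vec.map suc ys)
  ev-complete zero⇓     = 0 , λ _ _ → refl
  ev-complete suc⇓      = 0 , λ _ _ → refl
  ev-complete (proj⇓ i) = 0 , λ _ _ → refl
  ev-complete (query⇓ σ refl) = 0 , λ _ _ → cong (λ τ → suc (bit (A τ))) (decode⌜⌝ σ)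
  ev-complete (comp⇓ {f = f} {gs} {xs} {ys} {z} ds d) =
    eventually-∩ combine (evs-complete ds) (ev-complete d)
    where
    positive : ∀ {k} (ys : Vec ℕ k) → allPositive (Vec.map suc ys) ≡ 1
    positive []       = refl
    positive (y ∷ ys) = positive ys
    preds : ∀ {k} (ys : Vec ℕ k) → Vec.map pred (Vec.map suc ys) ≡ ys
    preds []       = refl
    preds (y ∷ ys) = cong (y ∷_) (preds ys)
    combine : ∀ s → evs gs s xs ≡ Vec.map suc ys → ev f s ys ≡ suc z → ev (comp f gs) s xs ≡ suc z
    combine s eqs eq rewrite eqs | positive ys | preds ys = eq
  ev-complete (prec-zero⇓ d) = ev-complete d
  ev-complete (prec-suc⇓ {f = f} {g} {m} {xs} {y} {z} d d′) =
    eventually-∩ combine (ev-complete d) (ev-complete d′)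
    where
    combine : ∀ s → ev (prec f g) s (m ∷ xs) ≡ suc y → ev g s (m ∷ y ∷ xs) ≡ suc z →
              ev (prec f g) s (suc m ∷ xs) ≡ suc z
    combine s eq eq′ rewrite eq = eq′
  ev-complete (μ⇓ {f = f} {xs} {m} d ds) =
    eventually-∩ combine (eventually-∩ {R = m ≤_} (λ _ → _,_) (ev-complete d) (m , λ _ le → le))
      (eventually-< m λ i i<m → later (ds i i<m))
    where
    later : ∀ {i} → (∃[ y ] A ⊢ f [ i ∷ xs ]⇓ suc y) →
            Eventually (λ s → pred (ev f s (i ∷ xs)) ≢ 0)
    later (y , e) = let (s₀ , c) = ev-complete e in
      s₀ , λ s le eq → 1+n≢0 (trans (sym (cong pred (c s le))) eq)
    combine : ∀ s → ev f s (m ∷ xs) ≡ 1 × m ≤ s →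
              (∀ i → i < m → pred (ev f s (i ∷ xs)) ≢ 0) → ev (μᶠ f) s xs ≡ suc m
    combine s (eq , m≤s) below
      rewrite climb-reaches (λ y → pred (ev f s (y ∷ xs))) m below (cong pred eq) s m≤s | eq = refl
  evs-complete []       = 0 , λ _ _ → refl
  evs-complete (d ∷ ds) =
    eventually-∩ (λ _ → cong₂ _∷_) (ev-complete d) (evs-complete ds)

  -- Both values are what the function `ev` returns at one common large bound.
  deterministic : ∀ {r : Rec n} {xs y z} → A ⊢ r [ xs ]⇓ y → A ⊢ r [ xs ]⇓ z → y ≡ z
  deterministic d e with ev-complete d | ev-complete e
  ... | a , p | b , q = suc-injective (trans (sym (p (a ⊔ b) (m≤m⊔n a b))) (q (a ⊔ b) (m≤n⊔m a b)))

  deterministicᵛ : ∀ {rs : Vec (Rec n) k} {xs} {ys zs : Vec ℕ k} → Pointwise (λ r y → A ⊢ r [ xs ]⇓ y) rs ys →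
    Pointwise (λ r y → A ⊢ r [ xs ]⇓ y) rs zs → ys ≡ zs
  deterministicᵛ []       []       = refl
  deterministicᵛ (d ∷ ds) (e ∷ es) = cong₂ _∷_ (deterministic d e) (deterministicᵛ ds es)

  comp-total⁻ : ∀ {r : Rec k} (c : ComputableVec u) {xs y} →
    A ⊢ comp r (programs c) [ xs ]⇓ y → A ⊢ r [ u xs ]⇓ y
  comp-total⁻ {u = u} {r = r} c {xs} {y} (comp⇓ ds d) =
    subst (A ⊢ r [_]⇓ y) (deterministicᵛ ds (computesᵛ c xs)) d

  comp-total⁺ : ∀ {r : Rec k} (c : ComputableVec u) {xs y} →
    A ⊢ r [ u xs ]⇓ y → A ⊢ comp r (programs c) [ xs ]⇓ y
  comp-total⁺ c d = comp⇓ (computesᵛ c _) d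

  μ-zero : {f : Vec ℕ (suc n) → ℕ} (c : Computable f) {xs : Vec ℕ n} {m : ℕ} →
    A ⊢ μᶠ (program c) [ xs ]⇓ m → f (m ∷ xs) ≡ 0
  μ-zero c (μ⇓ d _) = deterministic (computes c _) d

  -- The least zero is deliberately left unnamed. The callers need only convergence, or identify the
  -- value by a uniqueness argument of their own.
  μ-converges : {f : Vec ℕ (suc n) → ℕ} (c : Computable f) {xs : Vec ℕ n} {m : ℕ} →
    f (m ∷ xs) ≡ 0 → ∃[ m′ ] A ⊢ μᶠ (program c) [ xs ]⇓ m′
  μ-converges {f = f} c {xs} {m} eq = search m 0 (+-identityʳ m) (λ _ ())
    where
    search : ∀ d j → d + j ≡ m → (∀ i → i < j → f (i ∷ xs) ≢ 0) →
             ∃[ m′ ] A ⊢ μᶠ (program c) [ xs ]⇓ m′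
    search d j d+j≡m below with f (j ∷ xs) in eqⱼ
    ... | zero = j , μ⇓ (subst (A ⊢ program c [ _ ]⇓_) eqⱼ (computes c _)) earlier
      where
      earlier : ∀ i → i < j → ∃[ y ] A ⊢ program c [ i ∷ xs ]⇓ suc y
      earlier i i<j with f (i ∷ xs) in eqᵢ | below i i<j
      ... | zero  | nz = contradiction refl nz
      ... | suc y | _  = y , subst (A ⊢ program c [ _ ]⇓_) eqᵢ (computes c _)
    search zero    j d+j≡m below | suc _ =
      contradiction (trans (sym eqⱼ) (trans (cong (λ i → f (i ∷ xs)) d+j≡m) eq)) 1+n≢0
    search (suc d) j d+j≡m below | suc _ = search d (suc j) (trans (+-suc d j) d+j≡m) below′
      where
      below′ : ∀ i → i < suc j → f (i ∷ xs) ≢ 0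
      below′ i i< with m<1+n⇒m<n∨m≡n i<
      ... | inj₁ i<j  = below i i<j
      ... | inj₂ refl = λ z → 0≢1+n (trans (sym z) eqⱼ)

-- Strings as initial segments

-- The leading digit of the bijective base-two code; the value 0 on the empty string makes the end
-- of a string detectable by arithmetic.
digit : String → ℕ
digit []          = 0
digit (false ∷ _) = 1
digit (true ∷ _)  = 2

-- The default `false` turns a string σ into the sequence σ000..., which serves throughout as the
-- canonical point of its cylinder.
nth : String → ℕ → Bool
nth []      _       = false
nth (b ∷ _) zero    = b
nth (_ ∷ σ) (suc k) = nth σ k

drop-suc : ∀ k (σ : String) → drop 1 (drop k σ) ≡ drop (suc k) σ
drop-suc zero    σ       = refl
drop-suc (suc k) []      = refl
drop-suc (suc k) (b ∷ σ) = drop-suc k σ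

length-∷ʳ : ∀ (σ : String) b → length (σ ∷ʳ b) ≡ suc (length σ)
length-∷ʳ []      b = refl
length-∷ʳ (_ ∷ σ) b = cong suc (length-∷ʳ σ b)

take-∷ʳ : ∀ k (σ : String) b → k ≤ length σ → take k (σ ∷ʳ b) ≡ take k σ
take-∷ʳ zero    σ       b _         = refl
take-∷ʳ (suc k) (c ∷ σ) b (s≤s k≤) = cong (c ∷_) (take-∷ʳ k σ b k≤)

take-length : ∀ (σ : String) → take (length σ) σ ≡ σ
take-length []      = refl
take-length (b ∷ σ) = cong (b ∷_) (take-length σ)

nth-∷ʳ : ∀ k (σ : String) b → k < length σ → nth (σ ∷ʳ b) k ≡ nth σ k
nth-∷ʳ zero    (_ ∷ σ) b _        = refl
nth-∷ʳ (suc k) (_ ∷ σ) b (s≤s k<) = nth-∷ʳ k σ b k<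

nth-∷ʳ-last : ∀ (σ : String) b → nth (σ ∷ʳ b) (length σ) ≡ b
nth-∷ʳ-last []      b = refl
nth-∷ʳ-last (_ ∷ σ) b = nth-∷ʳ-last σ b

length-↾ : ∀ X m → length (X ↾ m) ≡ m
length-↾ = length-applyUpTo

↾-suc : ∀ X m → X ↾ suc m ≡ X ↾ m ∷ʳ X m
↾-suc X m = sym (applyUpTo-∷ʳ X m)

take-↾ : ∀ X {j m} → j ≤ m → take j (X ↾ m) ≡ X ↾ j
take-↾ X z≤n       = refl
take-↾ X (s≤s j≤m) = cong (X 0 ∷_) (take-↾ (X ∘ suc) j≤m)

nth-↾ : ∀ X {j m} → j < m → nth (X ↾ m) j ≡ X j
nth-↾ X {zero}  (s≤s _)  = refl
nth-↾ X {suc j} (s≤s lt) = nth-↾ (X ∘ suc) lt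

↾-≺ : ∀ X m → X ↾ m ≺ X
↾-≺ X m = cong (X ↾_) (length-↾ X m)

↾-cong : ∀ {X Y : Cantor} → (∀ i → X i ≡ Y i) → ∀ m → X ↾ m ≡ Y ↾ m
↾-cong eq zero    = refl
↾-cong eq (suc m) = cong₂ _∷_ (eq 0) (↾-cong (eq ∘ suc) m)

≺-nth : ∀ (σ : String) → σ ≺ nth σ
≺-nth []      = refl
≺-nth (b ∷ σ) = cong (b ∷_) (≺-nth σ)

≺-comparable : ∀ {σ τ X} → σ ≺ X → τ ≺ X → length σ ≡ length τ → σ ≡ τ
≺-comparable {X = X} p q eq = trans (sym p) (trans (cong (X ↾_) eq) q)

≼⇒++ : ∀ {σ τ : String} → σ ≼ τ → ∃[ ρ ] τ ≡ σ ++ ρ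
≼⇒++ Prefix.[]            = _ , refl
≼⇒++ (refl Prefix.∷ p) = let (ρ , eq) = ≼⇒++ p in ρ , cong (_ ∷_) eq

≺-++ : ∀ σ {ρ X} → σ ++ ρ ≺ X → σ ≺ X
≺-++ []      _ = refl
≺-++ (b ∷ σ) {ρ} {X} eq = cong₂ _∷_ (∷-injectiveˡ eq) (≺-++ σ (∷-injectiveʳ eq))

-- 1ᵏ0τ codes the pair (k , τ).
lead : String → ℕ
lead (true ∷ σ) = suc (lead σ)
lead _          = 0

rest : String → String
rest []          = []
rest (true ∷ σ)  = rest σ
rest (false ∷ σ) = σ

selfDelimit : ℕ → String → String
selfDelimit zero    τ = false ∷ τ
selfDelimit (suc k) τ = true ∷ selfDelimit k τ

lead-selfDelimit : ∀ k τ → lead (selfDelimit k τ) ≡ k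
lead-selfDelimit zero    τ = refl
lead-selfDelimit (suc k) τ = cong suc (lead-selfDelimit k τ)

rest-selfDelimit : ∀ k τ → rest (selfDelimit k τ) ≡ τ
rest-selfDelimit zero    τ = refl
rest-selfDelimit (suc k) τ = rest-selfDelimit k τ

length-selfDelimit : ∀ k τ → length (selfDelimit k τ) ≡ suc (k + length τ)
length-selfDelimit zero    τ = refl
length-selfDelimit (suc k) τ = cong suc (length-selfDelimit k τ)

rest-drop : ∀ σ → rest σ ≡ drop (suc (lead σ)) σ
rest-drop []          = refl
rest-drop (true ∷ σ)  = rest-drop σ
rest-drop (false ∷ σ) = refl

-- Most significant bit first, contrary to the codes: the dyadic interval of τ starts at `value τ` ·
-- 2^-|τ|, and extending τ shrinks it to a subinterval.
value : String → ℕ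
value = foldl (λ v b → 2 * v + bit b) 0

branches : Oracle → String → Bool
branches A σ = A (σ ∷ʳ false) ∧ A (σ ∷ʳ true)

extendIf : Bool → String → Bool → String
extendIf c ρ b = if c then ρ ∷ʳ b else ρ

-- Recursion on the position, through `take` and `nth`, has the shape that `recˢ` turns into a
-- program; the recursion along one-bit extensions is recovered in `bits-∷ʳ`.
bitsTo : Oracle → String → ℕ → String
bitsTo A σ = rec [] (λ k ρ → extendIf (branches A (take k σ)) ρ (nth σ k))

bits : Oracle → String → String
bits A σ = bitsTo A σ (length σ)

bits-∷ʳ : ∀ A σ b → bits A (σ ∷ʳ b) ≡ extendIf (branches A σ) (bits A σ) b
bits-∷ʳ A σ b rewrite length-∷ʳ σ b =
  trans (cong₂ (λ ρ c → extendIf (branches A (take (length σ) (σ ∷ʳ b))) ρ c)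
               (agree (length σ) ≤-refl) (nth-∷ʳ-last σ b))
        (cong (λ τ → extendIf (branches A τ) (bits A σ) b)
              (trans (take-∷ʳ (length σ) σ b ≤-refl) (take-length σ)))
  where
  agree : ∀ k → k ≤ length σ → bitsTo A (σ ∷ʳ b) k ≡ bitsTo A σ k
  agree zero    _ = refl
  agree (suc k) k<
    rewrite agree k (<⇒≤ k<) | take-∷ʳ k σ b (<⇒≤ k<) | nth-∷ʳ k σ b k< = refl

length-bits≤ : ∀ A σ → length (bits A σ) ≤ length σ
length-bits≤ A σ = go (length σ)
  where
  go : ∀ k → length (bitsTo A σ k) ≤ k
  go zero = z≤n
  go (suc k) with branches A (take k σ)
  ... | true  = ≤-trans (≤-reflexive (length-∷ʳ (bitsTo A σ k) _)) (s≤s (go k))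
  ... | false = m≤n⇒m≤1+n (go k)

-- Serves as a bounded existential quantifier: being nonzero means that some term is.
total : (ℕ → ℕ) → ℕ → ℕ
total p = rec 0 (λ j y → p j + y)

total≢0⁺ : ∀ p k {j} → j < k → p j ≢ 0 → total p k ≢ 0
total≢0⁺ p (suc k) j< nz eq with m<1+n⇒m<n∨m≡n j<
... | inj₁ j<k  = total≢0⁺ p k j<k nz (m+n≡0⇒n≡0 (p k) eq)
... | inj₂ refl = nz (m+n≡0⇒m≡0 (p k) eq)

total≢0⁻ : ∀ p k → total p k ≢ 0 → ∃[ j ] j < k × p j ≢ 0
total≢0⁻ p zero    nz = contradiction refl nz
total≢0⁻ p (suc k) nz with p k in eq
... | suc _ = k , ≤-refl , λ z → 0≢1+n (trans (sym z) eq)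
... | zero  = let (j , j<k , nz′) = total≢0⁻ p k nz in j , m≤n⇒m≤1+n j<k , nz′

-- Programs for operations on strings

module StringComputability (A : Oracle) where
  open Computability A public

  private variable
    n k : ℕ
    f g h : Vec ℕ n → ℕ
    S S′ : Vec ℕ n → String
    B B′ : Vec ℕ n → Bool

  record Computableˢ {n} (S : Vec ℕ n → String) : Set where
    constructor string
    field code : Computable (λ xs → ⌜ S xs ⌝)
  open Computableˢ public

  record Computableᵇ {n} (B : Vec ℕ n → Bool) : Set where
    constructor boolean
    field indicator : Computable (λ xs → bit (B xs))
  open Computableᵇ public

  decodeᶜ : Computable f → Computableˢ (λ xs → decode (f xs))
  decodeᶜ {f = f} c = string (extᶜ c λ xs → sym (⌜decode⌝ (f xs)))

  extˢ : Computableˢ S → (∀ xs → S xs ≡ S′ xs) → Computableˢ S′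
  extˢ (string c) eq = string (extᶜ c λ xs → cong ⌜_⌝ (eq xs))

  weakenˢ : Computableˢ S → Computableˢ (λ xs → S (tail xs))
  weakenˢ (string c) = string (weakenᶜ c)

  weaken²ˢ : Computableˢ S → Computableˢ (λ xs → S (tail (tail xs)))
  weaken²ˢ c = weakenˢ (weakenˢ c)

  onCodes : ∀ {F : String → ℕ} → Computable {1} (λ xs → F (decode (head xs))) →
            Computableˢ S → Computable (λ xs → F (S xs))
  onCodes {S = S} {F = F} c (string s) = extᶜ (subᶜ c (s ∷ᵛ []ᵛ)) λ xs → cong F (decode⌜⌝ (S xs))

  recˢ : (St : ℕ → String → Vec ℕ n → String) → Computableˢ S →
    Computableˢ {2 + n} (λ xs → St (head xs) (decode (head (tail xs))) (tail (tail xs))) →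
    Computable h → Computableˢ (λ xs → rec (S xs) (λ m ρ → St m ρ xs) (h xs))
  recˢ {S = S} {h = h} St (string c) (string s) ch = string (extᶜ (recᶜ c s ch) λ xs → go xs (h xs))
    where
    go : ∀ xs m → rec ⌜ S xs ⌝ (λ m y → ⌜ St m (decode y) xs ⌝) m ≡
                  ⌜ rec (S xs) (λ m ρ → St m ρ xs) m ⌝
    go xs zero    = refl
    go xs (suc m) = trans (cong (λ y → ⌜ St m (decode y) xs ⌝) (go xs m))
                          (cong (λ ρ → ⌜ St m ρ xs ⌝) (decode⌜⌝ _))

  boolᶜ : Computableᵇ B → Computable f → Computable g →
          Computable (λ xs → if B xs then f xs else g xs)
  boolᶜ {B = B} {f = f} {g = g} (boolean cb) cf cg =
    extᶜ (ifzᶜ cb cg cf) λ xs → go (B xs) (f xs) (g xs)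
    where
    go : ∀ b m n → ifz (bit b) n m ≡ (if b then m else n)
    go true  m n = refl
    go false m n = refl

  ifˢ : Computableᵇ B → Computableˢ S → Computableˢ S′ →
        Computableˢ (λ xs → if B xs then S xs else S′ xs)
  ifˢ {B = B} c (string s) (string s′) = string (extᶜ (boolᶜ c s s′) λ xs → push (B xs))
    where
    push : ∀ b {σ τ} → (if b then ⌜ σ ⌝ else ⌜ τ ⌝) ≡ ⌜ (if b then σ else τ) ⌝
    push true  = refl
    push false = refl

  infixr 6 _∧ᶜ_
  _∧ᶜ_ : Computableᵇ B → Computableᵇ B′ → Computableᵇ (λ xs → B xs ∧ B′ xs)
  _∧ᶜ_ {B = B} {B′ = B′} c (boolean c′) =
    boolean (extᶜ (boolᶜ c c′ (constᶜ 0)) λ xs → go (B xs) (B′ xs))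
    where
    go : ∀ a b → (if a then bit b else 0) ≡ bit (a ∧ b)
    go true  b = refl
    go false b = refl

  falseᶜ : Computableᵇ {n} (λ _ → false)
  falseᶜ = boolean (constᶜ 0)

  trueᶜ : Computableᵇ {n} (λ _ → true)
  trueᶜ = boolean (constᶜ 1)

  oracleᶜ : Computableˢ S → Computableᵇ (λ xs → A (S xs))
  oracleᶜ c = boolean (onCodes {F = λ σ → bit (A σ)} (queryᶜ (headᶜ idᵛ)) c)

  halfᶜ : Computable f → Computable (λ xs → ⌊ f xs /2⌋)
  halfᶜ {f = f} c = extᶜ (recᶜ (constᶜ 0) (v₁ +ᶜ parᶜ) c) λ xs → go (f xs)
    where
    par : ℕ → ℕ
    par = rec 0 (λ _ y → 1 ∸ y)
    parᶜ : Computable {2 + n} (λ xs → par (lookup xs Fin.zero))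
    parᶜ = recᶜ (constᶜ 0) (constᶜ 1 ∸ᶜ v₁) v₀
    par-2+ : ∀ m → par (suc (suc m)) ≡ par m
    par-2+ zero    = refl
    par-2+ (suc m) = cong (1 ∸_) (par-2+ m)
    sums : ∀ m → par m + par (suc m) ≡ 1
    sums zero    = refl
    sums (suc m) = trans (cong (par (suc m) +_) (par-2+ m))
                         (trans (+-comm (par (suc m)) (par m)) (sums m))
    -- The integer part of m/2 is the number of odd numbers below m.
    half : ℕ → ℕ
    half = rec 0 (λ j y → y + par j)
    go : ∀ m → half m ≡ ⌊ m /2⌋
    go zero          = refl
    go (suc zero)    = refl
    go (suc (suc m)) = trans (+-assoc (half m) (par m) (par (suc m)))
      (trans (cong₂ _+_ (go m) (sums m)) (+-comm _ 1))

  ⌊2*/2⌋ : ∀ m → ⌊ 2 * m /2⌋ ≡ m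
  ⌊2*/2⌋ m = trans (cong (λ y → ⌊ m + y /2⌋) (+-identityʳ m)) (sym (n≡⌊n+n/2⌋ m))

  ⌊1+2*/2⌋ : ∀ m → ⌊ suc (2 * m) /2⌋ ≡ m
  ⌊1+2*/2⌋ m = trans (cong (λ y → ⌊ suc (m + y) /2⌋) (+-identityʳ m)) (sym (n≡⌈n+n/2⌉ m))

  ⌜drop1⌝ : ∀ σ → ⌊ pred ⌜ σ ⌝ /2⌋ ≡ ⌜ drop 1 σ ⌝
  ⌜drop1⌝ []          = refl
  ⌜drop1⌝ (false ∷ σ) = ⌊2*/2⌋ ⌜ σ ⌝
  ⌜drop1⌝ (true ∷ σ)  = ⌊1+2*/2⌋ ⌜ σ ⌝

  drop1ᶜ : Computableˢ S → Computableˢ (λ xs → drop 1 (S xs))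
  drop1ᶜ {S = S} (string c) = string (extᶜ (halfᶜ (predᶜ c)) λ xs → ⌜drop1⌝ (S xs))

  digitᶜ : Computableˢ S → Computable (λ xs → digit (S xs))
  digitᶜ {S = S} c = extᶜ (code c ∸ᶜ constᶜ 2 *ᶜ code (drop1ᶜ c)) λ xs → go (S xs)
    where
    go : ∀ σ → ⌜ σ ⌝ ∸ 2 * ⌜ drop 1 σ ⌝ ≡ digit σ
    go []          = refl
    go (false ∷ σ) = m+n∸n≡m 1 (2 * ⌜ σ ⌝)
    go (true ∷ σ)  = m+n∸n≡m 2 (2 * ⌜ σ ⌝)

  dropᶜ : Computable h → Computableˢ S → Computableˢ (λ xs → drop (h xs) (S xs))
  dropᶜ {h = h} {S = S} ch c =
    extˢ (recˢ (λ _ ρ _ → drop 1 ρ) c (drop1ᶜ (decodeᶜ (headᶜ (tailᵛ idᵛ)))) ch)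
         λ xs → go (S xs) (h xs)
    where
    go : ∀ σ m → rec σ (λ _ → drop 1) m ≡ drop m σ
    go σ zero    = refl
    go σ (suc m) = trans (cong (drop 1) (go σ m)) (drop-suc m σ)

  -- The length is the first position from which the remaining string has digit 0, and the code of
  -- the string bounds the search for it.
  lengthᶜ : Computableˢ S → Computable (λ xs → length (S xs))
  lengthᶜ {S = S} c =
    extᶜ (climbᶜ (digitᶜ (dropᶜ (headᶜ idᵛ) (weakenˢ c))) (code c))
         λ xs → climb-reaches _ _ (below (S xs)) (at (S xs)) ⌜ S xs ⌝ (length≤⌜⌝ (S xs))
    where
    below : ∀ σ i → i < length σ → digit (drop i σ) ≢ 0
    below (false ∷ σ) zero    _        ()
    below (true ∷ σ)  zero    _        ()
    below (_ ∷ σ)     (suc i) (s≤s i<) = below σ i i<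
    at : ∀ σ → digit (drop (length σ) σ) ≡ 0
    at []      = refl
    at (_ ∷ σ) = at σ

  digit-∷ : ∀ b {σ τ} → digit (b ∷ σ) ≡ digit (b ∷ τ)
  digit-∷ false = refl
  digit-∷ true  = refl

  ⌜∷⌝ : ∀ b σ → ⌜ b ∷ σ ⌝ ≡ digit (b ∷ σ) + 2 * ⌜ σ ⌝
  ⌜∷⌝ false σ = refl
  ⌜∷⌝ true  σ = refl

  takeᶜ : Computable h → Computableˢ S → Computableˢ (λ xs → take (h xs) (S xs))
  takeᶜ {h = h} {S = S} ch c =
    string (extᶜ (recᶜ (constᶜ 0) (v₁ +ᶜ 2^ᶜ v₀ *ᶜ digitᶜ (dropᶜ v₀ (weaken²ˢ c))) ch)
                 λ xs → go (S xs) (h xs))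
    where
    step : ∀ σ m → ⌜ take m σ ⌝ + 2 ^ m * digit (drop m σ) ≡ ⌜ take (suc m) σ ⌝
    step []          zero    = refl
    step (false ∷ σ) zero    = refl
    step (true ∷ σ)  zero    = refl
    step []          (suc m) = *-zeroʳ (2 ^ suc m)
    step (b ∷ σ)     (suc m) = begin
      ⌜ b ∷ take m σ ⌝ + 2 * 2 ^ m * d
        ≡⟨ cong₂ _+_ (⌜∷⌝ b (take m σ)) (*-assoc 2 (2 ^ m) d) ⟩
      digit (b ∷ take m σ) + 2 * ⌜ take m σ ⌝ + 2 * (2 ^ m * d)
        ≡⟨ +-assoc (digit (b ∷ take m σ)) _ _ ⟩
      digit (b ∷ take m σ) + (2 * ⌜ take m σ ⌝ + 2 * (2 ^ m * d))
        ≡⟨ cong₂ _+_ (digit-∷ b) (trans (sym (*-distribˡ-+ 2 ⌜ take m σ ⌝ (2 ^ m * d)))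
                                     (cong (2 *_) (step σ m))) ⟩
      digit (b ∷ take (suc m) σ) + 2 * ⌜ take (suc m) σ ⌝
        ≡⟨ ⌜∷⌝ b (take (suc m) σ) ⟨
      ⌜ b ∷ take (suc m) σ ⌝ ∎
      where
      open ≡-Reasoning
      d = digit (drop m σ)
    go : ∀ σ m → rec 0 (λ j y → y + 2 ^ j * digit (drop j σ)) m ≡ ⌜ take m σ ⌝
    go σ zero    = refl
    go σ (suc m) = trans (cong (_+ 2 ^ m * digit (drop m σ)) (go σ m)) (step σ m)

  snocᶜ : Computableˢ S → Computableᵇ B → Computableˢ (λ xs → S xs ∷ʳ B xs)
  snocᶜ {S = S} {B = B} c d =
    string (extᶜ (code c +ᶜ 2^ᶜ (lengthᶜ c) *ᶜ sucᶜ (indicator d)) λ xs → go (S xs) (B xs))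
    where
    single : ∀ b → 1 * suc (bit b) ≡ ⌜ b ∷ [] ⌝
    single false = refl
    single true  = refl
    go : ∀ σ b → ⌜ σ ⌝ + 2 ^ length σ * suc (bit b) ≡ ⌜ σ ∷ʳ b ⌝
    go []      b = single b
    go (c ∷ σ) b = begin
      ⌜ c ∷ σ ⌝ + 2 * 2 ^ length σ * suc (bit b)
        ≡⟨ cong₂ _+_ (⌜∷⌝ c σ) (*-assoc 2 (2 ^ length σ) (suc (bit b))) ⟩
      digit (c ∷ σ) + 2 * ⌜ σ ⌝ + 2 * (2 ^ length σ * suc (bit b))
        ≡⟨ +-assoc (digit (c ∷ σ)) _ _ ⟩
      digit (c ∷ σ) + (2 * ⌜ σ ⌝ + 2 * (2 ^ length σ * suc (bit b)))
        ≡⟨ cong₂ _+_ (digit-∷ c) (trans (sym (*-distribˡ-+ 2 ⌜ σ ⌝ _)) (cong (2 *_) (go σ b))) ⟩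
      digit (c ∷ σ ∷ʳ b) + 2 * ⌜ σ ∷ʳ b ⌝
        ≡⟨ ⌜∷⌝ c (σ ∷ʳ b) ⟨
      ⌜ c ∷ σ ∷ʳ b ⌝ ∎
      where open ≡-Reasoning

  nthᶜ : Computableˢ S → Computable h → Computableᵇ (λ xs → nth (S xs) (h xs))
  nthᶜ {S = S} {h = h} c ch = boolean (extᶜ (predᶜ (digitᶜ (dropᶜ ch c))) λ xs → go (S xs) (h xs))
    where
    go : ∀ σ m → pred (digit (drop m σ)) ≡ bit (nth σ m)
    go []          zero    = refl
    go []          (suc m) = refl
    go (false ∷ σ) zero    = refl
    go (true ∷ σ)  zero    = refl
    go (_ ∷ σ)     (suc m) = go σ m

  leadᶜ : Computableˢ S → Computable (λ xs → lead (S xs))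
  leadᶜ {S = S} c =
    extᶜ (climbᶜ (indicator (nthᶜ (weakenˢ c) v₀)) (lengthᶜ c))
         λ xs → climb-reaches _ _ (below (S xs)) (at (S xs)) _ (bound (S xs))
    where
    below : ∀ σ i → i < lead σ → bit (nth σ i) ≢ 0
    below (true ∷ σ) zero    _        ()
    below (true ∷ σ) (suc i) (s≤s i<) = below σ i i<
    at : ∀ σ → bit (nth σ (lead σ)) ≡ 0
    at []          = refl
    at (false ∷ σ) = refl
    at (true ∷ σ)  = at σ
    bound : ∀ σ → lead σ ≤ length σ
    bound []          = z≤n
    bound (false ∷ σ) = z≤n
    bound (true ∷ σ)  = s≤s (bound σ)

  restᶜ : Computableˢ S → Computableˢ (λ xs → rest (S xs))
  restᶜ {S = S} c =
    extˢ (dropᶜ (sucᶜ (leadᶜ c)) c) λ xs → sym (rest-drop (S xs))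

  valueᶜ : Computableˢ S → Computable (λ xs → value (S xs))
  valueᶜ {S = S} c =
    extᶜ (recᶜ (constᶜ 0) (constᶜ 2 *ᶜ v₁ +ᶜ indicator (nthᶜ (weaken²ˢ c) v₀)) (lengthᶜ c))
         λ xs → go 0 (S xs)
    where
    shift : ∀ a b σ m → rec a (λ k v → 2 * v + bit (nth (b ∷ σ) k)) (suc m) ≡
                        rec (2 * a + bit b) (λ k v → 2 * v + bit (nth σ k)) m
    shift a b σ zero    = refl
    shift a b σ (suc m) = cong (λ v → 2 * v + bit (nth σ m)) (shift a b σ m)
    go : ∀ a σ → rec a (λ k v → 2 * v + bit (nth σ k)) (length σ) ≡ foldl (λ v b → 2 * v + bit b) a σ
    go a []      = refl
    go a (b ∷ σ) = trans (shift a b σ (length σ)) (go (2 * a + bit b) σ)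

  branchesᶜ : Computableˢ S → Computableᵇ (λ xs → branches A (S xs))
  branchesᶜ c = oracleᶜ (snocᶜ c falseᶜ) ∧ᶜ oracleᶜ (snocᶜ c trueᶜ)

  bitsᶜ : Computableˢ S → Computableˢ (λ xs → bits A (S xs))
  bitsᶜ {S = S} c =
    recˢ (λ k ρ xs → extendIf (branches A (take k (S xs))) ρ (nth (S xs) k)) (string (constᶜ 0))
      (ifˢ (branchesᶜ (takeᶜ (headᶜ idᵛ) (weaken²ˢ c)))
           (snocᶜ (decodeᶜ (headᶜ (tailᵛ idᵛ))) (nthᶜ (weaken²ˢ c) (headᶜ idᵛ)))
           (decodeᶜ (headᶜ (tailᵛ idᵛ))))
      (lengthᶜ c)

  totalᶜ : {p : Vec ℕ (suc n) → ℕ} → Computable p → Computable h →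
           Computable (λ xs → total (λ j → p (j ∷ xs)) (h xs))
  totalᶜ c = recᶜ (constᶜ 0) (subᶜ c (v₀ ∷ᵛ tailᵛ (tailᵛ idᵛ)) +ᶜ v₁)

  -- A prefix-free computable set of strings with the same open set as W A e n:
  -- the strings σ which are shortest such that the enumeration reaches a
  -- prefix of σ within |σ| steps.

  reached : Rec 2 → ℕ → String → ℕ
  reached e n σ = total (λ j → ev e (length σ) (n ∷ ⌜ take j σ ⌝ ∷ [])) (suc (length σ))

  fresh : Rec 2 → ℕ → String → Bool
  fresh e n σ = ifz (reached e n σ) false
    (ifz (total (λ k → reached e n (take k σ)) (length σ)) true false)

  reachedᶜ : ∀ e → Computable h → Computableˢ S →
             Computable (λ xs → reached e (h xs) (S xs))
  reachedᶜ e ch c = totalᶜ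
    (subᶜ (evᶜ e) (lengthᶜ (weakenˢ c) ∷ᵛ weakenᶜ ch ∷ᵛ code (takeᶜ (headᶜ idᵛ) (weakenˢ c)) ∷ᵛ []ᵛ))
    (sucᶜ (lengthᶜ c))

  freshᶜ : ∀ e → Computable h → Computableˢ S →
           Computableᵇ (λ xs → fresh e (h xs) (S xs))
  freshᶜ {h = h} {S = S} e ch c =
    boolean (extᶜ (ifzᶜ (reachedᶜ e ch c) (constᶜ 0) (ifzᶜ earlier (constᶜ 1) (constᶜ 0)))
                  λ xs → go (reached e (h xs) (S xs)) _)
    where
    earlier = totalᶜ (reachedᶜ e (weakenᶜ ch) (takeᶜ (headᶜ idᵛ) (weakenˢ c))) (lengthᶜ c)
    go : ∀ a b → ifz a 0 (ifz b 1 0) ≡ bit (ifz a false (ifz b true false))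
    go zero    b       = refl
    go (suc a) zero    = refl
    go (suc a) (suc b) = refl

  fresh⇒reached : ∀ e n σ → fresh e n σ ≡ true →
    reached e n σ ≢ 0 × (∀ k → k < length σ → reached e n (take k σ) ≡ 0)
  fresh⇒reached e n σ eq with reached e n σ
  ... | suc _ with total (λ k → reached e n (take k σ)) (length σ) in eq′
  ...   | zero = 1+n≢0 , λ k k< → decidable-stable (_ ≟ 0) λ nz → total≢0⁺ _ _ k< nz eq′

  reached⇒fresh : ∀ e n σ → reached e n σ ≢ 0 →
    (∀ k → k < length σ → reached e n (take k σ) ≡ 0) → fresh e n σ ≡ true
  reached⇒fresh e n σ nz below with reached e n σ
  ... | zero  = contradiction refl nz
  ... | suc _ with total (λ k → reached e n (take k σ)) (length σ) in eq′
  ...   | zero  = refl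
  ...   | suc _ = let (k , k< , nz′) = total≢0⁻ _ (length σ) (λ z → 0≢1+n (trans (sym z) eq′)) in
                  contradiction (below k k<) nz′

  fresh-⊆ : ∀ e n σ → fresh e n σ ≡ true → ∀ {X} → X ∈ ⟦ σ ⟧ → X ∈ ⟦ W A e n ⟧ˢ
  fresh-⊆ e n σ eq {X} σ≺X with total≢0⁻ _ (suc (length σ)) (proj₁ (fresh⇒reached e n σ eq))
  ... | j , s≤s j≤ , nz with ev e (length σ) (n ∷ ⌜ take j σ ⌝ ∷ []) in eq′
  ...   | zero  = contradiction refl nz
  ...   | suc y = take j σ , (y , ev-sound e _ _ eq′) ,
                  subst (_≺ X) (trans (sym (take-↾ X j≤)) (cong (take j) σ≺X)) (↾-≺ X j)

  fresh-unique : ∀ e n X {m m′} → fresh e n (X ↾ m) ≡ true → fresh e n (X ↾ m′) ≡ true → m ≡ m′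
  fresh-unique e n X {m} {m′} p q with <-cmp m m′
  ... | tri≈ _ eq _ = eq
  ... | tri< lt _ _ = contradiction
    (subst (λ τ → reached e n τ ≡ 0) (take-↾ X (<⇒≤ lt))
      (proj₂ (fresh⇒reached e n (X ↾ m′) q) m (subst (m <_) (sym (length-↾ X m′)) lt)))
    (proj₁ (fresh⇒reached e n (X ↾ m) p))
  ... | tri> _ _ lt = contradiction
    (subst (λ τ → reached e n τ ≡ 0) (take-↾ X (<⇒≤ lt))
      (proj₂ (fresh⇒reached e n (X ↾ m) p) m′ (subst (m′ <_) (sym (length-↾ X m)) lt)))
    (proj₁ (fresh⇒reached e n (X ↾ m′) q))

  fresh-covers : ∀ e n X → X ∈ ⟦ W A e n ⟧ˢ → ∃[ m ] fresh e n (X ↾ m) ≡ true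
  fresh-covers e n X (σ , (y , d) , σ≺X) with ev-complete d
  ... | s₀ , at = least 0 m₀ refl (λ _ ()) nz
    where
    -- The length of a string is also the number of steps granted to the enumeration, so X ↾ m₀ has
    -- to be long enough both to contain σ and to let the program converge on it.
    m₀ = s₀ ⊔ length σ
    nz : reached e n (X ↾ m₀) ≢ 0
    nz rewrite length-↾ X m₀ = total≢0⁺ _ (suc m₀) (s≤s (m≤n⊔m s₀ (length σ)))
      λ z → 1+n≢0 (trans (sym (at m₀ (m≤m⊔n s₀ _)))
        (subst (λ τ → ev e m₀ (n ∷ ⌜ τ ⌝ ∷ []) ≡ 0)
               (trans (take-↾ X (m≤n⊔m s₀ (length σ))) σ≺X) z))
    least : ∀ j d → j + d ≡ m₀ → (∀ k → k < j → reached e n (X ↾ k) ≡ 0) →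
            reached e n (X ↾ m₀) ≢ 0 → ∃[ m ] fresh e n (X ↾ m) ≡ true
    least j d eq below nz with reached e n (X ↾ j) ≟ 0
    ... | no nz′ = j , reached⇒fresh e n (X ↾ j) nz′ λ k k< →
      let k<j = subst (k <_) (length-↾ X j) k< in
      subst (λ τ → reached e n τ ≡ 0) (sym (take-↾ X (<⇒≤ k<j))) (below k k<j)
    least j zero    eq below nz | yes z =
      contradiction (subst (λ k → reached e n (X ↾ k) ≡ 0) (trans (sym (+-identityʳ j)) eq) z) nz
    least j (suc d) eq below nz | yes z = least (suc j) d (trans (sym (+-suc j d)) eq) below′ nz
      where
      below′ : ∀ k → k < suc j → reached e n (X ↾ k) ≡ 0
      below′ k k< with m<1+n⇒m<n∨m≡n k<
      ... | inj₁ k<j  = below k k<j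
      ... | inj₂ refl = z

-- Finite sums of rationals

*-monoˡ : ∀ {r p q} → 0ℚ ℚ.≤ r → p ℚ.≤ q → r ℚ.* p ℚ.≤ r ℚ.* q
*-monoˡ {r} 0≤r = ℚₚ.*-monoˡ-≤-nonNeg r {{ℚ.nonNegative 0≤r}}

*-monoʳ : ∀ {r p q} → 0ℚ ℚ.≤ r → p ℚ.≤ q → p ℚ.* r ℚ.≤ q ℚ.* r
*-monoʳ {r} 0≤r = ℚₚ.*-monoʳ-≤-nonNeg r {{ℚ.nonNegative 0≤r}}

*-nonNeg : ∀ {p q} → 0ℚ ℚ.≤ p → 0ℚ ℚ.≤ q → 0ℚ ℚ.≤ p ℚ.* q
*-nonNeg {p} {q} 0≤p 0≤q = subst (ℚ._≤ p ℚ.* q) (ℚₚ.*-zeroʳ p) (*-monoˡ 0≤p 0≤q)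

+-nonNeg : ∀ {p q} → 0ℚ ℚ.≤ p → 0ℚ ℚ.≤ q → 0ℚ ℚ.≤ p ℚ.+ q
+-nonNeg {p} {q} 0≤p 0≤q = subst (ℚ._≤ p ℚ.+ q) (ℚₚ.+-identityˡ 0ℚ) (ℚₚ.+-mono-≤ 0≤p 0≤q)

½+½ : ∀ ε → ½ ℚ.* ε ℚ.+ ½ ℚ.* ε ≡ ε
½+½ ε = trans (sym (ℚₚ.*-distribʳ-+ ε ½ ½)) (ℚₚ.*-identityˡ ε)

½*-pos : ∀ {ε} → 0ℚ ℚ.< ε → 0ℚ ℚ.< ½ ℚ.* ε
½*-pos {ε} 0<ε = subst (ℚ._< ½ ℚ.* ε) (ℚₚ.*-zeroʳ ½) (ℚₚ.*-monoʳ-<-pos ½ 0<ε)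

½^-pos : ∀ n → 0ℚ ℚ.< ½^ n
½^-pos zero    = ℚₚ.positive⁻¹ 1ℚ
½^-pos (suc n) = ½*-pos (½^-pos n)

½^-nonNeg : ∀ n → 0ℚ ℚ.≤ ½^ n
½^-nonNeg n = ℚₚ.<⇒≤ (½^-pos n)

½^-+ : ∀ m n → ½^ (m + n) ≡ ½^ m ℚ.* ½^ n
½^-+ zero    n = sym (ℚₚ.*-identityˡ (½^ n))
½^-+ (suc m) n = trans (cong (½ ℚ.*_) (½^-+ m n)) (sym (ℚₚ.*-assoc ½ (½^ m) (½^ n)))

½^-suc-< : ∀ n → ½^ (suc n) ℚ.< ½^ n
½^-suc-< n = subst₂ ℚ._<_ (ℚₚ.+-identityʳ _) (½+½ (½^ n))
  (ℚₚ.+-monoʳ-< (½ ℚ.* ½^ n) (½*-pos (½^-pos n)))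

½^-antitone : ∀ {m n} → m ≤ n → ½^ n ℚ.≤ ½^ m
½^-antitone {m} {n} m≤n = subst (λ k → ½^ k ℚ.≤ ½^ m) (m∸n+n≡m m≤n) (go (n ∸ m))
  where
  go : ∀ k → ½^ (k + m) ℚ.≤ ½^ m
  go zero    = ℚₚ.≤-refl
  go (suc k) = ℚₚ.≤-trans (ℚₚ.<⇒≤ (½^-suc-< (k + m))) (go k)

½^-cancel-≤ : ∀ {m n} → ½^ m ℚ.≤ ½^ n → n ≤ m
½^-cancel-≤ {m} {n} le with n ≤? m
... | yes n≤m = n≤m
... | no  n≰m = contradiction (ℚₚ.≤-<-trans le (ℚₚ.≤-<-trans (½^-antitone (≰⇒> n≰m)) (½^-suc-< m)))
                              (ℚₚ.<-irrefl refl)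

ι : ℕ → ℚ
ι zero    = 0ℚ
ι (suc n) = 1ℚ ℚ.+ ι n

ι-+ : ∀ m n → ι (m + n) ≡ ι m ℚ.+ ι n
ι-+ zero    n = sym (ℚₚ.+-identityˡ (ι n))
ι-+ (suc m) n = trans (cong (1ℚ ℚ.+_) (ι-+ m n)) (sym (ℚₚ.+-assoc 1ℚ (ι m) (ι n)))

ι-* : ∀ m n → ι (m * n) ≡ ι m ℚ.* ι n
ι-* zero    n = sym (ℚₚ.*-zeroˡ (ι n))
ι-* (suc m) n = begin
  ι (n + m * n)                      ≡⟨ ι-+ n (m * n) ⟩
  ι n ℚ.+ ι (m * n)                  ≡⟨ cong₂ ℚ._+_ (sym (ℚₚ.*-identityˡ (ι n))) (ι-* m n) ⟩
  1ℚ ℚ.* ι n ℚ.+ ι m ℚ.* ι n         ≡⟨ ℚₚ.*-distribʳ-+ (ι n) 1ℚ (ι m) ⟨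
  (1ℚ ℚ.+ ι m) ℚ.* ι n               ∎
  where open ≡-Reasoning

ι-nonNeg : ∀ n → 0ℚ ℚ.≤ ι n
ι-nonNeg zero    = ℚₚ.≤-refl
ι-nonNeg (suc n) = +-nonNeg (ℚₚ.nonNegative⁻¹ 1ℚ) (ι-nonNeg n)

ι-mono-≤ : ∀ {m n} → m ≤ n → ι m ℚ.≤ ι n
ι-mono-≤ {n = n} z≤n = ι-nonNeg n
ι-mono-≤ (s≤s m≤n)   = ℚₚ.+-monoʳ-≤ 1ℚ (ι-mono-≤ m≤n)

ι<ι-suc : ∀ n → ι n ℚ.< ι (suc n)
ι<ι-suc n = subst (ℚ._< ι (suc n)) (ℚₚ.+-identityˡ (ι n)) (ℚₚ.+-monoˡ-< (ι n) (ℚₚ.positive⁻¹ 1ℚ))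

ι-cancel-≤ : ∀ {m n} → ι m ℚ.≤ ι n → m ≤ n
ι-cancel-≤ {m} {n} le with m ≤? n
... | yes m≤n = m≤n
... | no  m≰n = contradiction (ℚₚ.<-≤-trans (ι<ι-suc n) (ℚₚ.≤-trans (ι-mono-≤ (≰⇒> m≰n)) le))
                              (ℚₚ.<-irrefl refl)

ι-2^-½^ : ∀ n → ι (2 ^ n) ℚ.* ½^ n ≡ 1ℚ
ι-2^-½^ zero    = refl
ι-2^-½^ (suc n) = begin
  ι (2 * 2 ^ n) ℚ.* (½ ℚ.* ½^ n)         ≡⟨ cong (ℚ._* (½ ℚ.* ½^ n)) (ι-* 2 (2 ^ n)) ⟩
  (ι 2 ℚ.* ι (2 ^ n)) ℚ.* (½ ℚ.* ½^ n)   ≡⟨ swap (ι 2) (ι (2 ^ n)) ½ (½^ n) ⟩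
  (ι 2 ℚ.* ½) ℚ.* (ι (2 ^ n) ℚ.* ½^ n)   ≡⟨ cong ((ι 2 ℚ.* ½) ℚ.*_) (ι-2^-½^ n) ⟩
  1ℚ ∎
  where
  open ≡-Reasoning
  open +-*-Solver
  swap : ∀ a b c d → (a ℚ.* b) ℚ.* (c ℚ.* d) ≡ (a ℚ.* c) ℚ.* (b ℚ.* d)
  swap = solve 4 (λ a b c d → (a :* b) :* (c :* d) := (a :* c) :* (b :* d)) refl

when : Bool → ℚ → ℚ
when b p = if b then p else 0ℚ

when-nonNeg : ∀ b {p} → 0ℚ ℚ.≤ p → 0ℚ ℚ.≤ when b p
when-nonNeg true  0≤p = 0≤p
when-nonNeg false 0≤p = ℚₚ.≤-refl

when-mono : ∀ {a b p} → (a ≡ true → b ≡ true) → 0ℚ ℚ.≤ p → when a p ℚ.≤ when b p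
when-mono {false} {b}     imp 0≤p = when-nonNeg b 0≤p
when-mono {true}  {true}  imp 0≤p = ℚₚ.≤-refl
when-mono {true}  {false} imp 0≤p = contradiction (imp refl) λ ()

module _ {X : Set} where

  sum : List X → (X → ℚ) → ℚ
  sum []       f = 0ℚ
  sum (x ∷ xs) f = f x ℚ.+ sum xs f

  foldr≡sum : ∀ xs (f : X → ℚ) → foldr (λ x s → f x ℚ.+ s) 0ℚ xs ≡ sum xs f
  foldr≡sum []       f = refl
  foldr≡sum (x ∷ xs) f = cong (f x ℚ.+_) (foldr≡sum xs f)

  sum-mono : ∀ xs {f g : X → ℚ} → (∀ x → x ∈ˡ xs → f x ℚ.≤ g x) → sum xs f ℚ.≤ sum xs g
  sum-mono []       le = ℚₚ.≤-refl
  sum-mono (x ∷ xs) le = ℚₚ.+-mono-≤ (le x (here refl)) (sum-mono xs λ y y∈ → le y (there y∈))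

  sum-cong : ∀ xs {f g : X → ℚ} → (∀ x → f x ≡ g x) → sum xs f ≡ sum xs g
  sum-cong []       eq = refl
  sum-cong (x ∷ xs) eq = cong₂ ℚ._+_ (eq x) (sum-cong xs eq)

  sum-0 : ∀ xs → sum xs (λ _ → 0ℚ) ≡ 0ℚ
  sum-0 []       = refl
  sum-0 (x ∷ xs) = trans (ℚₚ.+-identityˡ _) (sum-0 xs)

  sum-nonNeg : ∀ xs {f : X → ℚ} → (∀ x → x ∈ˡ xs → 0ℚ ℚ.≤ f x) → 0ℚ ℚ.≤ sum xs f
  sum-nonNeg xs {f} nn = subst (ℚ._≤ sum xs f) (sum-0 xs) (sum-mono xs nn)

  sum-+ : ∀ xs (f g : X → ℚ) → sum xs (λ x → f x ℚ.+ g x) ≡ sum xs f ℚ.+ sum xs g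
  sum-+ []       f g = sym (ℚₚ.+-identityˡ 0ℚ)
  sum-+ (x ∷ xs) f g = trans (cong ((f x ℚ.+ g x) ℚ.+_) (sum-+ xs f g))
    (solve 4 (λ a b c d → (a :+ b) :+ (c :+ d) := (a :+ c) :+ (b :+ d)) refl
           (f x) (g x) (sum xs f) (sum xs g))
    where open +-*-Solver

  sum-* : ∀ c xs (f : X → ℚ) → sum xs (λ x → c ℚ.* f x) ≡ c ℚ.* sum xs f
  sum-* c []       f = sym (ℚₚ.*-zeroʳ c)
  sum-* c (x ∷ xs) f = trans (cong (c ℚ.* f x ℚ.+_) (sum-* c xs f)) (sym (ℚₚ.*-distribˡ-+ c (f x) _))

  sum-++ : ∀ xs ys (f : X → ℚ) → sum (xs ++ ys) f ≡ sum xs f ℚ.+ sum ys f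
  sum-++ []       ys f = sym (ℚₚ.+-identityˡ _)
  sum-++ (x ∷ xs) ys f = trans (cong (f x ℚ.+_) (sum-++ xs ys f)) (sym (ℚₚ.+-assoc (f x) _ _))

  sum-filter : ∀ {P : Pred X 0ℓ} (P? : ∀ x → Dec (P x)) xs (f : X → ℚ) →
    sum (filter P? xs) f ≡ sum xs (λ x → when (does (P? x)) (f x))
  sum-filter P? []       f = refl
  sum-filter P? (x ∷ xs) f with does (P? x)
  ... | true  = cong (f x ℚ.+_) (sum-filter P? xs f)
  ... | false = trans (sum-filter P? xs f) (sym (ℚₚ.+-identityˡ _))

  sum-member : ∀ {xs} {f : X → ℚ} → (∀ x → x ∈ˡ xs → 0ℚ ℚ.≤ f x) → ∀ {x} → x ∈ˡ xs → f x ℚ.≤ sum xs f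
  sum-member {xs = x ∷ xs} {f} nn (here refl) = subst (ℚ._≤ f x ℚ.+ sum xs f) (ℚₚ.+-identityʳ (f x))
    (ℚₚ.+-monoʳ-≤ (f x) (sum-nonNeg xs λ y y∈ → nn y (there y∈)))
  sum-member {xs = y ∷ xs} {f} nn {x} (there x∈) = subst (ℚ._≤ f y ℚ.+ sum xs f) (ℚₚ.+-identityˡ (f x))
    (ℚₚ.+-mono-≤ (nn y (here refl)) (sum-member (λ z z∈ → nn z (there z∈)) x∈))

  -- This is how disjointness of cylinders enters a sum: at most one of them contains a given finer
  -- string.
  sum-atMostOne : ∀ {xs} → Unique xs → (B : X → Bool) {w : X → ℚ} {p : ℚ} → 0ℚ ℚ.≤ p →
    (∀ x y → x ∈ˡ xs → y ∈ˡ xs → B x ≡ true → B y ≡ true → x ≡ y) →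
    (∀ x → x ∈ˡ xs → B x ≡ true → w x ℚ.≤ p) →
    sum xs (λ x → when (B x) (w x)) ℚ.≤ p
  sum-atMostOne {[]} _ B 0≤p _ _ = 0≤p
  sum-atMostOne {x ∷ xs} (x∉ ∷ uniq) B {w} {p} 0≤p one le with B x in Bx
  ... | false = subst (ℚ._≤ p) (sym (ℚₚ.+-identityˡ _)) (sum-atMostOne uniq B 0≤p
    (λ y z y∈ z∈ → one y z (there y∈) (there z∈)) (λ y y∈ → le y (there y∈)))
  ... | true  = ℚₚ.≤-trans (ℚₚ.+-mono-≤ (le x (here refl) Bx) others) (ℚₚ.≤-reflexive (ℚₚ.+-identityʳ p))
    where
    zeros : ∀ y → y ∈ˡ xs → when (B y) (w y) ℚ.≤ 0ℚ
    zeros y y∈ with B y in By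
    ... | false = ℚₚ.≤-refl
    ... | true  = contradiction (one x y (here refl) (there y∈) Bx By) (All.lookup x∉ y∈)
    others : sum xs (λ y → when (B y) (w y)) ℚ.≤ 0ℚ
    others = ℚₚ.≤-trans (sum-mono xs zeros) (ℚₚ.≤-reflexive (sum-0 xs))

sum-map : ∀ {X Y : Set} (g : X → Y) xs (f : Y → ℚ) → sum (map g xs) f ≡ sum xs (f ∘ g)
sum-map g []       f = refl
sum-map g (x ∷ xs) f = cong (f (g x) ℚ.+_) (sum-map g xs f)

sum-swap : ∀ {X Y : Set} (xs : List X) (ys : List Y) (w : X → Y → ℚ) →
  sum xs (λ x → sum ys (w x)) ≡ sum ys (λ y → sum xs (λ x → w x y))
sum-swap []       ys w = sym (sum-0 ys)
sum-swap (x ∷ xs) ys w = trans (cong (sum ys (w x) ℚ.+_) (sum-swap xs ys w))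
  (sym (sum-+ ys (w x) (λ y → sum xs (λ x → w x y))))

-- The comparisons of measures below are instances, with `w` an incidence relation weighted by a
-- measure. Typically `sum-cone` evaluates the rows and `sum-atMostOne` bounds the columns.
double-count : ∀ {X Y : Set} (xs : List X) (ys : List Y) (w : X → Y → ℚ) {f : X → ℚ} {g : Y → ℚ} →
  (∀ x → x ∈ˡ xs → f x ℚ.≤ sum ys (w x)) → (∀ y → y ∈ˡ ys → sum xs (λ x → w x y) ℚ.≤ g y) →
  sum xs f ℚ.≤ sum ys g
double-count xs ys w rows columns =
  ℚₚ.≤-trans (sum-mono xs rows) (ℚₚ.≤-trans (ℚₚ.≤-reflexive (sum-swap xs ys w)) (sum-mono ys columns))

-- Sums over the strings of a given length

∈-strings⁻ : ∀ m {τ} → τ ∈ˡ strings m → length τ ≡ m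
∈-strings⁻ zero    (here refl) = refl
∈-strings⁻ (suc m) τ∈ with ∈-++⁻ (map (false ∷_) (strings m)) τ∈
... | inj₁ τ∈ˡ with ρ , ρ∈ , refl ← ∈-map⁻ (false ∷_) τ∈ˡ = cong suc (∈-strings⁻ m ρ∈)
... | inj₂ τ∈ʳ with ρ , ρ∈ , refl ← ∈-map⁻ (true ∷_) τ∈ʳ  = cong suc (∈-strings⁻ m ρ∈)

∈-strings⁺ : ∀ τ → τ ∈ˡ strings (length τ)
∈-strings⁺ []          = here refl
∈-strings⁺ (false ∷ τ) = ∈-++⁺ˡ (∈-map⁺ (false ∷_) (∈-strings⁺ τ))
∈-strings⁺ (true ∷ τ)  = ∈-++⁺ʳ (map (false ∷_) (strings (length τ))) (∈-map⁺ (true ∷_) (∈-strings⁺ τ))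

strings-unique : ∀ m → Unique (strings m)
strings-unique zero    = All.[] ∷ []
strings-unique (suc m) = Uniqueₚ.++⁺ (Uniqueₚ.map⁺ ∷-injectiveʳ (strings-unique m))
  (Uniqueₚ.map⁺ ∷-injectiveʳ (strings-unique m)) disjoint
  where
  disjoint : ∀ {τ} → ¬ (τ ∈ˡ map (false ∷_) (strings m) × τ ∈ˡ map (true ∷_) (strings m))
  disjoint (p , q) with ∈-map⁻ (false ∷_) p | ∈-map⁻ (true ∷_) q
  ... | _ , _ , refl | _ , _ , ()

isPrefix : String → String → Bool
isPrefix []          τ           = true
isPrefix (false ∷ σ) (false ∷ τ) = isPrefix σ τ
isPrefix (true ∷ σ)  (true ∷ τ)  = isPrefix σ τ
isPrefix _           _           = false

isPrefix⁻ : ∀ σ τ → isPrefix σ τ ≡ true → ∀ {X} → τ ≺ X → σ ≺ X × length σ ≤ length τ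
isPrefix⁻ []          τ           eq _   = refl , z≤n
isPrefix⁻ (false ∷ σ) (false ∷ τ) eq τ≺X =
  let (p , q) = isPrefix⁻ σ τ eq (∷-injectiveʳ τ≺X) in cong₂ _∷_ (∷-injectiveˡ τ≺X) p , s≤s q
isPrefix⁻ (true ∷ σ)  (true ∷ τ)  eq τ≺X =
  let (p , q) = isPrefix⁻ σ τ eq (∷-injectiveʳ τ≺X) in cong₂ _∷_ (∷-injectiveˡ τ≺X) p , s≤s q

isPrefix⁺ : ∀ σ τ {X} → σ ≺ X → τ ≺ X → length σ ≤ length τ → isPrefix σ τ ≡ true
isPrefix⁺ []          τ           _   _   _        = refl
isPrefix⁺ (false ∷ σ) (false ∷ τ) σ≺X τ≺X (s≤s le) = isPrefix⁺ σ τ (∷-injectiveʳ σ≺X) (∷-injectiveʳ τ≺X) le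
isPrefix⁺ (true ∷ σ)  (true ∷ τ)  σ≺X τ≺X (s≤s le) = isPrefix⁺ σ τ (∷-injectiveʳ σ≺X) (∷-injectiveʳ τ≺X) le
isPrefix⁺ (false ∷ σ) (true ∷ τ)  σ≺X τ≺X _ =
  contradiction (trans (sym (∷-injectiveˡ σ≺X)) (∷-injectiveˡ τ≺X)) λ ()
isPrefix⁺ (true ∷ σ)  (false ∷ τ) σ≺X τ≺X _ =
  contradiction (trans (sym (∷-injectiveˡ τ≺X)) (∷-injectiveˡ σ≺X)) λ ()

isPrefix⇒≼ : ∀ σ τ → isPrefix σ τ ≡ true → σ ≼ τ
isPrefix⇒≼ []          τ           _  = Prefix.[]
isPrefix⇒≼ (false ∷ σ) (false ∷ τ) eq = refl Prefix.∷ isPrefix⇒≼ σ τ eq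
isPrefix⇒≼ (true ∷ σ)  (true ∷ τ)  eq = refl Prefix.∷ isPrefix⇒≼ σ τ eq

Additive : (String → ℚ) → Set
Additive ν = ∀ σ → ν σ ≡ ν (σ ∷ʳ false) ℚ.+ ν (σ ∷ʳ true)

sum-strings-suc : ∀ m (f : String → ℚ) → sum (strings (suc m)) f ≡
  sum (strings m) (f ∘ (false ∷_)) ℚ.+ sum (strings m) (f ∘ (true ∷_))
sum-strings-suc m f = trans (sum-++ (map (false ∷_) (strings m)) _ f)
  (cong₂ ℚ._+_ (sum-map (false ∷_) (strings m) f) (sum-map (true ∷_) (strings m) f))

sum-level : ∀ {ν} → Additive ν → ∀ m → sum (strings m) ν ≡ ν []
sum-level {ν} add zero    = ℚₚ.+-identityʳ (ν [])
sum-level {ν} add (suc m) = trans (sum-strings-suc m ν)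
  (trans (cong₂ ℚ._+_ (sum-level (add ∘ (false ∷_)) m) (sum-level (add ∘ (true ∷_)) m)) (sym (add [])))

-- Stripping the first bit of σ replaces ν by its restriction to one half of the space, which is
-- again additive; the other half contributes 0.
sum-cone : ∀ {ν} → Additive ν → ∀ m σ → length σ ≤ m →
  sum (strings m) (λ τ → when (isPrefix σ τ) (ν τ)) ≡ ν σ
sum-cone add m [] _ = sum-level add m
sum-cone {ν} add (suc m) (false ∷ σ) (s≤s le) = trans (sum-strings-suc m _)
  (trans (cong₂ ℚ._+_ (sum-cone (add ∘ (false ∷_)) m σ le) (sum-0 (strings m))) (ℚₚ.+-identityʳ _))
sum-cone {ν} add (suc m) (true ∷ σ) (s≤s le) = trans (sum-strings-suc m _)
  (trans (cong₂ ℚ._+_ (sum-0 (strings m)) (sum-cone (add ∘ (true ∷_)) m σ le)) (ℚₚ.+-identityˡ _))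

½^length-additive : Additive (λ σ → ½^ (length σ))
½^length-additive σ rewrite length-∷ʳ σ false | length-∷ʳ σ true = sym (½+½ (½^ (length σ)))

-- Division and real numbers

÷₀-≤ : ∀ {p q c} → 0ℚ ℚ.< q → p ℚ.≤ c ℚ.* q → p ÷₀ q ℚ.≤ c
÷₀-≤ {p} {q} {c} 0<q le with q ℚₚ.≟ 0ℚ
... | yes refl = contradiction 0<q (ℚₚ.<-irrefl refl)
... | no  q≢0  = ℚₚ.*-cancelʳ-≤-pos q {{ℚ.positive 0<q}} (ℚₚ.≤-trans (ℚₚ.≤-reflexive cancel) le)
  where
  instance _ = ℚ.≢-nonZero q≢0
  cancel : p ℚ.÷ q ℚ.* q ≡ p
  cancel = trans (ℚₚ.*-assoc p (ℚ.1/ q) q)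
    (trans (cong (p ℚ.*_) (ℚₚ.*-inverseˡ q)) (ℚₚ.*-identityʳ p))

≤-÷₀ : ∀ {p q c} → 0ℚ ℚ.< q → c ℚ.* q ℚ.≤ p → c ℚ.≤ p ÷₀ q
≤-÷₀ {p} {q} {c} 0<q le with q ℚₚ.≟ 0ℚ
... | yes refl = contradiction 0<q (ℚₚ.<-irrefl refl)
... | no  q≢0  = ℚₚ.*-cancelʳ-≤-pos q {{ℚ.positive 0<q}} (ℚₚ.≤-trans le (ℚₚ.≤-reflexive (sym cancel)))
  where
  instance _ = ℚ.≢-nonZero q≢0
  cancel : p ℚ.÷ q ℚ.* q ≡ p
  cancel = trans (ℚₚ.*-assoc p (ℚ.1/ q) q)
    (trans (cong (p ℚ.*_) (ℚₚ.*-inverseˡ q)) (ℚₚ.*-identityʳ p))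

≤-of-≤+ε : ∀ {p q} → (∀ ε → 0ℚ ℚ.< ε → p ℚ.≤ q ℚ.+ ε) → p ℚ.≤ q
≤-of-≤+ε {p} {q} le with p ℚₚ.≤? q
... | yes p≤q = p≤q
... | no  p≰q = let (r , q<r , r<p) = ℚₚ.<-dense (ℚₚ.≰⇒> p≰q) in
  contradiction (ℚₚ.<-≤-trans r<p (ℚₚ.≤-trans (le (r ℚ.- q) (gap q<r)) (ℚₚ.≤-reflexive (shift r))))
                (ℚₚ.<-irrefl refl)
  where
  gap : ∀ {r} → q ℚ.< r → 0ℚ ℚ.< r ℚ.- q
  gap {r} q<r = subst (ℚ._< r ℚ.- q) (ℚₚ.+-inverseʳ q) (ℚₚ.+-monoˡ-< (ℚ.- q) q<r)
  shift : ∀ r → q ℚ.+ (r ℚ.- q) ≡ r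
  shift r = solve 2 (λ q r → q :+ (r :- q) := r) refl q r
    where open +-*-Solver

fromℚ-cancel-≤ : ∀ {p q} → fromℚ p ≤ℝ fromℚ q → p ℚ.≤ q
fromℚ-cancel-≤ le = ≤-of-≤+ε λ ε 0<ε → let (N , at) = le ε 0<ε in at N ≤-refl

fromℚ-mono-≤ : ∀ {p q} → p ℚ.≤ q → fromℚ p ≤ℝ fromℚ q
fromℚ-mono-≤ {p} {q} p≤q ε 0<ε = 0 , λ _ _ → ℚₚ.≤-trans p≤q
  (subst (ℚ._≤ q ℚ.+ ε) (ℚₚ.+-identityʳ q) (ℚₚ.+-monoʳ-≤ q (ℚₚ.<⇒≤ 0<ε)))

≤ℝ-trans : ∀ {x y z} → x ≤ℝ y → y ≤ℝ z → x ≤ℝ z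
≤ℝ-trans {x} {y} {z} x≤y y≤z ε 0<ε =
  let (M , p) = x≤y (½ ℚ.* ε) (½*-pos 0<ε)
      (N , q) = y≤z (½ ℚ.* ε) (½*-pos 0<ε)
  in M ⊔ N , λ n n≥ → ℚₚ.≤-trans (p n (m⊔n≤o⇒m≤o M N n≥))
    (ℚₚ.≤-trans (ℚₚ.+-monoˡ-≤ (½ ℚ.* ε) (q n (m⊔n≤o⇒n≤o M N n≥)))
      (ℚₚ.≤-reflexive (trans (ℚₚ.+-assoc (ℝ.approx z n) _ _) (cong (ℝ.approx z n ℚ.+_) (½+½ ε)))))

+ℝ-mono-≤ : ∀ {x y z w} → x ≤ℝ y → z ≤ℝ w → x +ℝ z ≤ℝ y +ℝ w
+ℝ-mono-≤ {x} {y} {z} {w} x≤y z≤w ε 0<ε =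
  let (M , p) = x≤y (½ ℚ.* ε) (½*-pos 0<ε)
      (N , q) = z≤w (½ ℚ.* ε) (½*-pos 0<ε)
  in M ⊔ N , λ n n≥ → ℚₚ.≤-trans
    (ℚₚ.+-mono-≤ (p n (m⊔n≤o⇒m≤o M N n≥)) (q n (m⊔n≤o⇒n≤o M N n≥)))
    (ℚₚ.≤-reflexive (trans (interchange (ℝ.approx y n) (½ ℚ.* ε) (ℝ.approx w n) (½ ℚ.* ε))
                           (cong (ℝ.approx y n ℚ.+ ℝ.approx w n ℚ.+_) (½+½ ε))))
  where
  open +-*-Solver
  interchange : ∀ a b c d → (a ℚ.+ b) ℚ.+ (c ℚ.+ d) ≡ (a ℚ.+ c) ℚ.+ (b ℚ.+ d)
  interchange = solve 4 (λ a b c d → (a :+ b) :+ (c :+ d) := (a :+ c) :+ (b :+ d)) refl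

sumℝ : List String → (String → ℝ) → ℝ
sumℝ L μ = foldr (λ τ s → μ τ +ℝ s) (fromℚ 0ℚ) L

sum≤sumℝ : ∀ L f μ → (∀ τ → τ ∈ˡ L → fromℚ (f τ) ≤ℝ μ τ) → fromℚ (sum L f) ≤ℝ sumℝ L μ
sum≤sumℝ []      f μ le = fromℚ-mono-≤ ℚₚ.≤-refl
sum≤sumℝ (τ ∷ L) f μ le = +ℝ-mono-≤ {fromℚ (f τ)} {μ τ} {fromℚ (sum L f)} {sumℝ L μ}
  (le τ (here refl)) (sum≤sumℝ L f μ λ ρ ρ∈ → le ρ (there ρ∈))

sumℝ≤sum : ∀ L f μ → (∀ τ → τ ∈ˡ L → μ τ ≤ℝ fromℚ (f τ)) → sumℝ L μ ≤ℝ fromℚ (sum L f)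
sumℝ≤sum []      f μ le = fromℚ-mono-≤ ℚₚ.≤-refl
sumℝ≤sum (τ ∷ L) f μ le = +ℝ-mono-≤ {μ τ} {fromℚ (f τ)} {sumℝ L μ} {fromℚ (sum L f)}
  (le τ (here refl)) (sumℝ≤sum L f μ λ ρ ρ∈ → le ρ (there ρ∈))

-- Kraft's inequality

appendBit : ℕ → Bool → ℕ
appendBit v b = 2 * v + bit b

double-≤ : ∀ {a b} k → a ≤ 2 * b → a * 2 ^ k ≤ b * 2 ^ suc k
double-≤ {a} {b} k le = begin
  a * 2 ^ k        ≤⟨ *-monoˡ-≤ (2 ^ k) le ⟩
  2 * b * 2 ^ k    ≡⟨ solve 2 (λ b p → con 2 :* b :* p := b :* (con 2 :* p)) refl b (2 ^ k) ⟩
  b * 2 ^ suc k    ∎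
  where
  open ≤-Reasoning
  open ℕ-Solver

-- Together with `foldl-appendBit-<`: appending digits to a numeral stays within the dyadic interval
-- of that numeral, measured in the finer unit.
foldl-appendBit-≥ : ∀ v ρ → v * 2 ^ length ρ ≤ foldl appendBit v ρ
foldl-appendBit-≥ v []      = ≤-reflexive (*-identityʳ v)
foldl-appendBit-≥ v (b ∷ ρ) = begin
  v * (2 * 2 ^ length ρ)            ≡⟨ solve 2 (λ v p → v :* (con 2 :* p) := con 2 :* v :* p) refl v (2 ^ length ρ) ⟩
  2 * v * 2 ^ length ρ              ≤⟨ *-monoˡ-≤ (2 ^ length ρ) (m≤m+n (2 * v) (bit b)) ⟩
  appendBit v b * 2 ^ length ρ      ≤⟨ foldl-appendBit-≥ (appendBit v b) ρ ⟩
  foldl appendBit (appendBit v b) ρ ∎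
  where
  open ≤-Reasoning
  open ℕ-Solver

foldl-appendBit-< : ∀ v ρ → suc (foldl appendBit v ρ) ≤ suc v * 2 ^ length ρ
foldl-appendBit-< v []      = ≤-reflexive (sym (*-identityʳ (suc v)))
foldl-appendBit-< v (b ∷ ρ) = ≤-trans (foldl-appendBit-< (appendBit v b) ρ)
  (double-≤ (length ρ) (last b))
  where
  last : ∀ b → suc (appendBit v b) ≤ 2 * suc v
  last false = ≤-trans (≤-reflexive (cong suc (+-identityʳ (2 * v))))
                       (≤-trans (n≤1+n _) (≤-reflexive (sym (*-suc 2 v))))
  last true  = ≤-reflexive (trans (cong suc (+-comm (2 * v) 1)) (sym (*-suc 2 v)))

value-surjective : ∀ ℓ v → v < 2 ^ ℓ → ∃[ τ ] length τ ≡ ℓ × value τ ≡ v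
value-surjective zero    v v<     = [] , refl , sym (n<1⇒n≡0 v<)
value-surjective (suc ℓ) v v< with halve v
  where
  halve : ∀ v → ∃[ w ] ∃[ b ] appendBit w b ≡ v
  halve zero    = 0 , false , refl
  halve (suc v) with halve v
  ... | w , false , refl = w , true , +-suc (2 * w) 0
  ... | w , true  , refl = suc w , false ,
    trans (+-identityʳ _) (trans (*-suc 2 w) (cong suc (+-comm 1 (2 * w))))
... | w , b , refl with value-surjective ℓ w (*-cancelˡ-< 2 w (2 ^ ℓ) (≤-<-trans (m≤m+n (2 * w) (bit b)) v<))
...   | τ , refl , refl = τ ∷ʳ b , length-∷ʳ τ b , foldl-++ appendBit 0 τ (b ∷ [])

sum-upTo-suc : ∀ i (f : ℕ → ℚ) → sum (upTo (suc i)) f ≡ sum (upTo i) f ℚ.+ f i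
sum-upTo-suc i f = begin
  sum (upTo (suc i)) f             ≡⟨ cong (λ L → sum L f) (applyUpTo-∷ʳ id i) ⟨
  sum (upTo i ∷ʳ i) f              ≡⟨ sum-++ (upTo i) (i ∷ []) f ⟩
  sum (upTo i) f ℚ.+ (f i ℚ.+ 0ℚ)  ≡⟨ cong (sum (upTo i) f ℚ.+_) (ℚₚ.+-identityʳ (f i)) ⟩
  sum (upTo i) f ℚ.+ f i           ∎
  where open ≡-Reasoning

-- A nonempty `rest` shows that the marker 1ᵏ0 is complete, so an extension keeps it. With an empty
-- `rest` the run of ones might still go on.
rest-≼ : ∀ {τ τ′} → τ ≼ τ′ → rest τ ≢ [] → ∃[ ρ ] lead τ′ ≡ lead τ × rest τ′ ≡ rest τ ++ ρ
rest-≼ Prefix.[]                       ne = contradiction refl ne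
rest-≼ {true ∷ τ}  (refl Prefix.∷ p) ne =
  let (ρ , eq , eq′) = rest-≼ p ne in ρ , cong suc eq , eq′
rest-≼ {false ∷ τ} (refl Prefix.∷ p) ne = let (ρ , eq) = ≼⇒++ p in ρ , refl , eq

rest-injective : ∀ {τ τ′} → τ ≼ τ′ → rest τ ≢ [] → rest τ ≡ rest τ′ → τ ≡ τ′
rest-injective Prefix.[]                     ne eq = contradiction refl ne
rest-injective {true ∷ τ}  (refl Prefix.∷ p) ne eq = cong (true ∷_) (rest-injective p ne eq)
rest-injective {false ∷ τ} (refl Prefix.∷ p) ne eq = cong (false ∷_) eq

ι-2^-½^-+ : ∀ m n → ι (2 ^ m) ℚ.* ½^ (m + n) ≡ ½^ n
ι-2^-½^-+ m n = begin
  ι (2 ^ m) ℚ.* ½^ (m + n)           ≡⟨ cong (ι (2 ^ m) ℚ.*_) (½^-+ m n) ⟩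
  ι (2 ^ m) ℚ.* (½^ m ℚ.* ½^ n)      ≡⟨ ℚₚ.*-assoc (ι (2 ^ m)) (½^ m) (½^ n) ⟨
  ι (2 ^ m) ℚ.* ½^ m ℚ.* ½^ n        ≡⟨ cong (ℚ._* ½^ n) (ι-2^-½^ m) ⟩
  1ℚ ℚ.* ½^ n                        ≡⟨ ℚₚ.*-identityˡ (½^ n) ⟩
  ½^ n                               ∎
  where open ≡-Reasoning

-- The Kraft-Chaitin machine for decidable request sets

module KraftChaitin (A : Oracle) where
  open StringComputability A

  -- `D n σ` requests a description of σ that is shorter than t(σ) by n, up to a constant. The bound
  -- of t(σ) by the code of σ guarantees that the requests before the i-th code have weights with
  -- denominator dividing 2^i.
  module _ (D : ℕ → String → Bool) (t : String → ℕ)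
    (Dᶜ : ∀ {n} {h : Vec ℕ n → ℕ} {S : Vec ℕ n → String} → Computable h → Computableˢ S →
          Computableᵇ (λ xs → D (h xs) (S xs)))
    (tᶜ : ∀ {n} {S : Vec ℕ n → String} → Computableˢ S → Computable (λ xs → t (S xs)))
    (t≤⌜⌝ : ∀ σ → t σ ≤ ⌜ σ ⌝)
    where

    mass : ℕ → ℕ → ℚ
    mass n i = sum (upTo i) λ j → when (D n (decode j)) (½^ (t (decode j)))

    -- The numerator of `mass` over the denominator 2^B, which makes it accessible to programs; the
    -- truncated subtraction is exact as long as the codes summed over are at most B.
    scaledMass : ℕ → ℕ → ℕ → ℕ
    scaledMass n B = rec 0 λ j y → y + (if D n (decode j) then 2 ^ (B ∸ t (decode j)) else 0)

    t-decode≤ : ∀ j → t (decode j) ≤ j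
    t-decode≤ j = subst (t (decode j) ≤_) (⌜decode⌝ j) (t≤⌜⌝ (decode j))

    scaledMass-correct : ∀ n B i → i ≤ B → ι (scaledMass n B i) ℚ.* ½^ B ≡ mass n i
    scaledMass-correct n B zero    _   = ℚₚ.*-zeroˡ (½^ B)
    scaledMass-correct n B (suc i) i<B = begin
      ι (scaledMass n B i + w) ℚ.* ½^ B             ≡⟨ cong (ℚ._* ½^ B) (ι-+ (scaledMass n B i) w) ⟩
      (ι (scaledMass n B i) ℚ.+ ι w) ℚ.* ½^ B       ≡⟨ ℚₚ.*-distribʳ-+ (½^ B) (ι (scaledMass n B i)) (ι w) ⟩
      ι (scaledMass n B i) ℚ.* ½^ B ℚ.+ ι w ℚ.* ½^ B
        ≡⟨ cong₂ ℚ._+_ (scaledMass-correct n B i (<⇒≤ i<B)) (weight (D n (decode i))) ⟩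
      mass n i ℚ.+ when (D n (decode i)) (½^ (t (decode i)))
        ≡⟨ sum-upTo-suc i _ ⟨
      mass n (suc i) ∎
      where
      open ≡-Reasoning
      w = if D n (decode i) then 2 ^ (B ∸ t (decode i)) else 0
      weight : ∀ b → ι (if b then 2 ^ (B ∸ t (decode i)) else 0) ℚ.* ½^ B ≡ when b (½^ (t (decode i)))
      weight false = ℚₚ.*-zeroˡ (½^ B)
      weight true  = trans
        (cong (λ k → ι (2 ^ (B ∸ t (decode i))) ℚ.* ½^ k)
              (sym (m∸n+n≡m (≤-trans (t-decode≤ i) (<⇒≤ i<B)))))
        (ι-2^-½^-+ (B ∸ t (decode i)) (t (decode i)))

    -- The dyadic interval of the string 0²ⁿτ lies in [mass n i , mass n (i + 1))
    -- and has half its length.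
    record Describes (n : ℕ) (τ : String) (i : ℕ) : Set where
      field
        requested : D n (decode i) ≡ true
        level     : length τ + 2 * n ≡ suc (t (decode i))
        lower     : mass n i ℚ.≤ ι (value τ) ℚ.* ½^ (suc (t (decode i)))
        upper     : ι (value τ) ℚ.* ½^ (suc (t (decode i))) ℚ.≤ mass n i ℚ.+ ½^ (suc (t (decode i)))

    -- The interval length 2^-(t + 1) of the i-th request, counted in units of 2^-(i + 1).
    unit : ℕ → ℕ
    unit i = 2 ^ (i ∸ t (decode i))

    -- `Describes` over the common denominator 2^(i + 1), as a sum of truncated differences that
    -- vanishes when all its clauses hold: two for the equation between lengths, two for the end
    -- points.
    check : ℕ → String → ℕ → ℕ
    check n τ i = if D n (decode i)
      then (length τ + 2 * n ∸ suc (t (decode i))) + (suc (t (decode i)) ∸ (length τ + 2 * n))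
         + (scaledMass n (suc i) i ∸ value τ * unit i)
         + (value τ * unit i ∸ (scaledMass n (suc i) i + unit i))
      else 1

    checkᶜ : Computable {2} (λ xs → check (lead (decode (head (tail xs)))) (rest (decode (head (tail xs)))) (head xs))
    checkᶜ = boolᶜ (Dᶜ n (decodeᶜ i))
      ((ℓ ∸ᶜ t′) +ᶜ (t′ ∸ᶜ ℓ) +ᶜ (Z ∸ᶜ v *ᶜ u) +ᶜ (v *ᶜ u ∸ᶜ (Z +ᶜ u))) (constᶜ 1)
      where
      i = headᶜ idᵛ
      n = leadᶜ (decodeᶜ (headᶜ (tailᵛ idᵛ)))
      τ = restᶜ (decodeᶜ (headᶜ (tailᵛ idᵛ)))
      v = valueᶜ τ
      t′ = sucᶜ (tᶜ (decodeᶜ i))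
      ℓ = lengthᶜ τ +ᶜ constᶜ 2 *ᶜ n
      u = 2^ᶜ (i ∸ᶜ tᶜ (decodeᶜ i))
      Z = recᶜ (constᶜ 0)
        (v₁ +ᶜ boolᶜ (Dᶜ (weaken²ᶜ n) (decodeᶜ v₀))
                     (2^ᶜ (weaken²ᶜ (sucᶜ i) ∸ᶜ tᶜ (decodeᶜ v₀))) (constᶜ 0)) i

    module _ (n i : ℕ) where
      private
        tᵢ = t (decode i)
        Z  = scaledMass n (suc i) i
        u  = unit i

      ι-unit : ι u ℚ.* ½^ (suc i) ≡ ½^ (suc tᵢ)
      ι-unit = trans (cong (λ k → ι u ℚ.* ½^ k)
          (sym (trans (+-suc (i ∸ tᵢ) tᵢ) (cong suc (m∸n+n≡m (t-decode≤ i))))))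
        (ι-2^-½^-+ (i ∸ tᵢ) (suc tᵢ))

      ι-multiple : ∀ v → ι (v * u) ℚ.* ½^ (suc i) ≡ ι v ℚ.* ½^ (suc tᵢ)
      ι-multiple v = trans (cong (ℚ._* ½^ (suc i)) (ι-* v u))
        (trans (ℚₚ.*-assoc (ι v) (ι u) _) (cong (ι v ℚ.*_) ι-unit))

      ι-Z : ι Z ℚ.* ½^ (suc i) ≡ mass n i
      ι-Z = scaledMass-correct n (suc i) i (n≤1+n i)

      ι-Z+u : ι (Z + u) ℚ.* ½^ (suc i) ≡ mass n i ℚ.+ ½^ (suc tᵢ)
      ι-Z+u = trans (cong (ℚ._* ½^ (suc i)) (ι-+ Z u))
        (trans (ℚₚ.*-distribʳ-+ (½^ (suc i)) (ι Z) (ι u)) (cong₂ ℚ._+_ ι-Z ι-unit))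

      scale-≤ : ∀ {a b} → a ≤ b → ι a ℚ.* ½^ (suc i) ℚ.≤ ι b ℚ.* ½^ (suc i)
      scale-≤ le = *-monoʳ (½^-nonNeg (suc i)) (ι-mono-≤ le)

      describes : ∀ τ → D n (decode i) ≡ true → length τ + 2 * n ≡ suc tᵢ →
        Z ≤ value τ * u → value τ * u ≤ Z + u → Describes n τ i
      describes τ req lev lo up = record
        { requested = req ; level = lev
        ; lower = subst₂ ℚ._≤_ ι-Z (ι-multiple (value τ)) (scale-≤ lo)
        ; upper = subst₂ ℚ._≤_ (ι-multiple (value τ)) ι-Z+u (scale-≤ up) }

      check-sound : ∀ τ → check n τ i ≡ 0 → Describes n τ i
      check-sound τ eq with D n (decode i) in req
      ... | true =
        let e₃ = m+n≡0⇒m≡0 (((length τ + 2 * n ∸ suc tᵢ) + (suc tᵢ ∸ (length τ + 2 * n))) + (Z ∸ value τ * u)) eq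
            e₂ = m+n≡0⇒m≡0 ((length τ + 2 * n ∸ suc tᵢ) + (suc tᵢ ∸ (length τ + 2 * n))) e₃
        in describes τ req
          (≤-antisym (m∸n≡0⇒m≤n (m+n≡0⇒m≡0 (length τ + 2 * n ∸ suc tᵢ) e₂))
                     (m∸n≡0⇒m≤n (m+n≡0⇒n≡0 (length τ + 2 * n ∸ suc tᵢ) e₂)))
          (m∸n≡0⇒m≤n (m+n≡0⇒n≡0 _ e₃)) (m∸n≡0⇒m≤n (m+n≡0⇒n≡0 _ eq))

      check-complete : ∀ τ → D n (decode i) ≡ true → length τ + 2 * n ≡ suc tᵢ →
        Z ≤ value τ * u → value τ * u ≤ Z + u → check n τ i ≡ 0
      check-complete τ req lev lo up
        rewrite req | lev | n∸n≡0 (suc tᵢ) | m≤n⇒m∸n≡0 lo | m≤n⇒m∸n≡0 up = refl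

    mass-suc : ∀ n i → D n (decode i) ≡ true → mass n (suc i) ≡ mass n i ℚ.+ ½^ (t (decode i))
    mass-suc n i req = trans (sum-upTo-suc i _) (cong (λ b → mass n i ℚ.+ when b (½^ (t (decode i)))) req)

    mass-mono : ∀ n {i j} → i ≤ j → mass n i ℚ.≤ mass n j
    mass-mono n {i} {j} i≤j = subst (λ k → mass n i ℚ.≤ mass n k) (m∸n+n≡m i≤j) (go (j ∸ i))
      where
      go : ∀ k → mass n i ℚ.≤ mass n (k + i)
      go zero    = ℚₚ.≤-refl
      go (suc k) = ℚₚ.≤-trans (go k) (subst₂ ℚ._≤_ (ℚₚ.+-identityʳ _) (sym (sum-upTo-suc (k + i) _))
        (ℚₚ.+-monoʳ-≤ (mass n (k + i)) (when-nonNeg (D n (decode (k + i))) (½^-nonNeg (t (decode (k + i)))))))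

    ι-suc-* : ∀ v p → ι (suc v) ℚ.* p ≡ ι v ℚ.* p ℚ.+ p
    ι-suc-* v p = solve 2 (λ v p → (con 1ℚ :+ v) :* p := v :* p :+ p) refl (ι v) p
      where open +-*-Solver

    -- The share of a request is twice as long as the interval of τ, and that interval starts within
    -- the first half of the share.
    Describes-upper : ∀ {n τ i} → Describes n τ i →
      ι (suc (value τ)) ℚ.* ½^ (suc (t (decode i))) ℚ.≤ mass n (suc i)
    Describes-upper {n} {τ} {i} d = begin
      ι (suc (value τ)) ℚ.* h         ≡⟨ ι-suc-* (value τ) h ⟩
      ι (value τ) ℚ.* h ℚ.+ h         ≤⟨ ℚₚ.+-monoˡ-≤ h (Describes.upper d) ⟩
      mass n i ℚ.+ h ℚ.+ h            ≡⟨ ℚₚ.+-assoc (mass n i) h h ⟩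
      mass n i ℚ.+ (h ℚ.+ h)          ≡⟨ cong (mass n i ℚ.+_) (½+½ (½^ (t (decode i)))) ⟩
      mass n i ℚ.+ ½^ (t (decode i))  ≡⟨ mass-suc n i (Describes.requested d) ⟨
      mass n (suc i)                  ∎
      where
      open ℚₚ.≤-Reasoning
      h = ½^ (suc (t (decode i)))

    module _ {n τ ρ i j} (d : Describes n τ i) (e : Describes n (τ ++ ρ) j) where
      private
        open ℚₚ.≤-Reasoning
        hᵢ = ½^ (suc (t (decode i)))
        hⱼ = ½^ (suc (t (decode j)))
        ι-step : ι (value (τ ++ ρ)) ℚ.* hⱼ ℚ.< ι (suc (value (τ ++ ρ))) ℚ.* hⱼ
        ι-step = ℚₚ.*-monoˡ-<-pos hⱼ {{ℚ.positive (½^-pos (suc (t (decode j))))}} (ι<ι-suc (value (τ ++ ρ)))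
        exponent : suc (t (decode j)) ≡ length ρ + suc (t (decode i))
        exponent = trans (sym (Describes.level e)) (trans (cong (_+ 2 * n) (length-++ τ))
          (trans (trans (cong (_+ 2 * n) (+-comm (length τ) (length ρ))) (+-assoc (length ρ) (length τ) (2 * n)))
                 (cong (length ρ +_) (Describes.level d))))
        nested-upper : ι (suc (value (τ ++ ρ))) ℚ.* hⱼ ℚ.≤ ι (suc (value τ)) ℚ.* hᵢ
        nested-upper = begin
          ι (suc (value (τ ++ ρ))) ℚ.* hⱼ
            ≡⟨ cong (λ v → ι (suc v) ℚ.* hⱼ) (foldl-++ appendBit 0 τ ρ) ⟩
          ι (suc (foldl appendBit (value τ) ρ)) ℚ.* hⱼ
            ≤⟨ *-monoʳ (½^-nonNeg (suc (t (decode j)))) (ι-mono-≤ (foldl-appendBit-< (value τ) ρ)) ⟩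
          ι (suc (value τ) * 2 ^ length ρ) ℚ.* hⱼ
            ≡⟨ cong (ℚ._* hⱼ) (ι-* (suc (value τ)) (2 ^ length ρ)) ⟩
          ι (suc (value τ)) ℚ.* ι (2 ^ length ρ) ℚ.* hⱼ
            ≡⟨ ℚₚ.*-assoc (ι (suc (value τ))) (ι (2 ^ length ρ)) hⱼ ⟩
          ι (suc (value τ)) ℚ.* (ι (2 ^ length ρ) ℚ.* hⱼ)
            ≡⟨ cong (λ k → ι (suc (value τ)) ℚ.* (ι (2 ^ length ρ) ℚ.* ½^ k)) exponent ⟩
          ι (suc (value τ)) ℚ.* (ι (2 ^ length ρ) ℚ.* ½^ (length ρ + suc (t (decode i))))
            ≡⟨ cong (ι (suc (value τ)) ℚ.*_) (ι-2^-½^-+ (length ρ) (suc (t (decode i)))) ⟩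
          ι (suc (value τ)) ℚ.* hᵢ ∎
        nested-lower : ι (value τ) ℚ.* hᵢ ℚ.≤ ι (value (τ ++ ρ)) ℚ.* hⱼ
        nested-lower = begin
          ι (value τ) ℚ.* hᵢ
            ≡⟨ cong (ι (value τ) ℚ.*_) (ι-2^-½^-+ (length ρ) (suc (t (decode i)))) ⟨
          ι (value τ) ℚ.* (ι (2 ^ length ρ) ℚ.* ½^ (length ρ + suc (t (decode i))))
            ≡⟨ cong (λ k → ι (value τ) ℚ.* (ι (2 ^ length ρ) ℚ.* ½^ k)) exponent ⟨
          ι (value τ) ℚ.* (ι (2 ^ length ρ) ℚ.* hⱼ)
            ≡⟨ ℚₚ.*-assoc (ι (value τ)) (ι (2 ^ length ρ)) hⱼ ⟨
          ι (value τ) ℚ.* ι (2 ^ length ρ) ℚ.* hⱼ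
            ≡⟨ cong (ℚ._* hⱼ) (ι-* (value τ) (2 ^ length ρ)) ⟨
          ι (value τ * 2 ^ length ρ) ℚ.* hⱼ
            ≤⟨ *-monoʳ (½^-nonNeg (suc (t (decode j)))) (ι-mono-≤ (foldl-appendBit-≥ (value τ) ρ)) ⟩
          ι (foldl appendBit (value τ) ρ) ℚ.* hⱼ
            ≡⟨ cong (λ v → ι v ℚ.* hⱼ) (foldl-++ appendBit 0 τ ρ) ⟨
          ι (value (τ ++ ρ)) ℚ.* hⱼ ∎

      -- The interval of τρ is contained in that of τ, whereas different requests own disjoint
      -- shares of the unit interval. The case of empty ρ says that a description determines its
      -- request.
      Describes-unique : i ≡ j
      Describes-unique with <-cmp i j
      ... | tri≈ _ eq _ = eq
      ... | tri< i<j _ _ = contradiction (begin-strict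
        ι (value (τ ++ ρ)) ℚ.* hⱼ        <⟨ ι-step ⟩
        ι (suc (value (τ ++ ρ))) ℚ.* hⱼ  ≤⟨ nested-upper ⟩
        ι (suc (value τ)) ℚ.* hᵢ         ≤⟨ Describes-upper d ⟩
        mass n (suc i)                   ≤⟨ mass-mono n i<j ⟩
        mass n j                         ≤⟨ Describes.lower e ⟩
        ι (value (τ ++ ρ)) ℚ.* hⱼ        ∎) (ℚₚ.<-irrefl refl)
      ... | tri> _ _ j<i = contradiction (begin-strict
        ι (value (τ ++ ρ)) ℚ.* hⱼ        <⟨ ι-step ⟩
        ι (suc (value (τ ++ ρ))) ℚ.* hⱼ  ≤⟨ Describes-upper e ⟩
        mass n (suc j)                   ≤⟨ mass-mono n j<i ⟩
        mass n i                         ≤⟨ Describes.lower d ⟩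
        ι (value τ) ℚ.* hᵢ               ≤⟨ nested-lower ⟩
        ι (value (τ ++ ρ)) ℚ.* hⱼ        ∎) (ℚₚ.<-irrefl refl)

    -- On input 1ⁿ0τ it searches for the code of the string whose share contains the interval of
    -- 0²ⁿτ; the code found is itself the output.
    machine : Rec 1
    machine = μᶠ (program checkᶜ)

    module _ (light : ∀ n i → mass n i ℚ.≤ ½^ (2 * n)) where

      -- A single request already weighs 2^-t. As a consequence at least one digit of a description
      -- is left after its 2n zeros are dropped, as `rest-≼` requires.
      2n≤t : ∀ n i → D n (decode i) ≡ true → 2 * n ≤ t (decode i)
      2n≤t n i req = ½^-cancel-≤ (begin
        ½^ (t (decode i))                     ≡⟨ ℚₚ.+-identityˡ _ ⟨
        0ℚ ℚ.+ ½^ (t (decode i))              ≤⟨ ℚₚ.+-monoˡ-≤ _ (mass-mono n (z≤n {i})) ⟩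
        mass n i ℚ.+ ½^ (t (decode i))        ≡⟨ mass-suc n i req ⟨
        mass n (suc i)                        ≤⟨ light n (suc i) ⟩
        ½^ (2 * n)                            ∎)
        where open ℚₚ.≤-Reasoning

      Describes-nonempty : ∀ {n τ i} → Describes n τ i → τ ≢ []
      Describes-nonempty {n} {i = i} d refl = <-irrefl (Describes.level d) (s≤s (2n≤t n i (Describes.requested d)))

      halts⇒Describes : ∀ {τ y} → A ⊢ machine [ ⌜ τ ⌝ ∷ [] ]⇓ y → Describes (lead τ) (rest τ) y
      halts⇒Describes {τ} {y} d = check-sound (lead τ) y (rest τ)
        (subst (λ σ → check (lead σ) (rest σ) y ≡ 0) (decode⌜⌝ τ) (μ-zero checkᶜ d))

      -- Comparable inputs share the marker, hence n, and their remainders are comparable. They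
      -- serve the same request, whose weight fixes the length of the remainder.
      machine-prefixFree : PrefixFree A machine
      machine-prefixFree {τ} {τ′} {y} {y′} h h′ τ≼τ′ =
        let d  = halts⇒Describes {τ} h
            d′ = halts⇒Describes {τ′} h′
            (ρ , lead≡ , rest≡) = rest-≼ τ≼τ′ (Describes-nonempty d)
            e  = subst₂ (λ n τ → Describes n τ y′) lead≡ rest≡ d′
        in rest-injective τ≼τ′ (Describes-nonempty d)
             (trans (sym (trans (cong (rest τ ++_) (empty d e)) (++-identityʳ (rest τ)))) (sym rest≡))
        where
        empty : ∀ {n τ ρ i j} → Describes n τ i → Describes n (τ ++ ρ) j → ρ ≡ []
        empty {n} {τ} {ρ} d e = length≡0 ρ
          (+-cancelˡ-≡ (length τ) (length ρ) 0 (trans (sym (length-++ τ)) (trans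
            (+-cancelʳ-≡ (2 * n) (length (τ ++ ρ)) (length τ) (trans (Describes.level e) (trans
              (cong (λ k → suc (t (decode k))) (sym (Describes-unique {ρ = ρ} d e))) (sym (Describes.level d)))))
            (sym (+-identityʳ (length τ))))))
          where
          length≡0 : ∀ (ρ : String) → length ρ ≡ 0 → ρ ≡ []
          length≡0 [] _ = refl

      check-parse : ∀ n τ k → check (lead (decode ⌜ selfDelimit n τ ⌝)) (rest (decode ⌜ selfDelimit n τ ⌝)) k ≡ check n τ k
      check-parse n τ k = trans (cong (λ σ → check (lead σ) (rest σ) k) (decode⌜⌝ (selfDelimit n τ)))
        (cong₂ (λ m ρ → check m ρ k) (lead-selfDelimit n τ) (rest-selfDelimit n τ))

      machine-finds : ∀ n τ i → check n τ i ≡ 0 → A ⊢ machine [ ⌜ selfDelimit n τ ⌝ ∷ [] ]⇓ i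
      machine-finds n τ i eq = subst (A ⊢ machine [ ⌜ selfDelimit n τ ⌝ ∷ [] ]⇓_) y≡i (proj₂ run)
        where
        run = μ-converges checkᶜ {⌜ selfDelimit n τ ⌝ ∷ []} {i} (trans (check-parse n τ i) eq)
        y≡i : proj₁ run ≡ i
        y≡i = sym (Describes-unique {ρ = []} (check-sound n i τ eq)
          (subst (λ τ → Describes n τ (proj₁ run)) (sym (++-identityʳ τ))
            (check-sound n (proj₁ run) τ (trans (sym (check-parse n τ (proj₁ run))) (μ-zero checkᶜ (proj₂ run))))))

      description : ∀ n i → D n (decode i) ≡ true →
        ∃[ τ ] length τ + 2 * n ≡ suc (t (decode i)) × check n τ i ≡ 0
      description n i req = finish (value-surjective ℓ v v<2^ℓ)
        where
        tᵢ = t (decode i)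
        Z = scaledMass n (suc i) i
        u = unit i
        instance u≢0 = m^n≢0 2 (i ∸ tᵢ)
        v = suc (Z / u)
        ℓ = suc tᵢ ∸ 2 * n
        ℓ+2n : ℓ + 2 * n ≡ suc tᵢ
        ℓ+2n = m∸n+n≡m (m≤n⇒m≤1+n (2n≤t n i req))
        Z≤vu : Z ≤ v * u
        Z≤vu = ≤-trans (≤-reflexive (m≡m%n+[m/n]*n Z u)) (+-monoˡ-≤ (Z / u * u) (<⇒≤ (m%n<n Z u)))
        vu≤Z+u : v * u ≤ Z + u
        vu≤Z+u = ≤-trans (+-monoʳ-≤ u (m/n*n≤m Z u)) (≤-reflexive (+-comm u Z))
        -- Lightness keeps the right end of the interval at or below 2^-2n, so v written with t + 1
        -- digits begins with 2n zeros; ℓ counts the remaining digits.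
        v<2^ℓ : v < 2 ^ ℓ
        v<2^ℓ = ι-cancel-≤ (ℚₚ.*-cancelʳ-≤-pos (½^ (suc tᵢ)) {{ℚ.positive (½^-pos (suc tᵢ))}} (begin
          ι (suc v) ℚ.* ½^ (suc tᵢ)               ≡⟨ ι-suc-* v (½^ (suc tᵢ)) ⟩
          ι v ℚ.* ½^ (suc tᵢ) ℚ.+ ½^ (suc tᵢ)
            ≤⟨ ℚₚ.+-monoˡ-≤ (½^ (suc tᵢ)) (subst₂ ℚ._≤_ (ι-multiple n i v) (ι-Z+u n i) (scale-≤ n i vu≤Z+u)) ⟩
          mass n i ℚ.+ ½^ (suc tᵢ) ℚ.+ ½^ (suc tᵢ) ≡⟨ ℚₚ.+-assoc (mass n i) _ _ ⟩
          mass n i ℚ.+ (½^ (suc tᵢ) ℚ.+ ½^ (suc tᵢ)) ≡⟨ cong (mass n i ℚ.+_) (½+½ (½^ tᵢ)) ⟩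
          mass n i ℚ.+ ½^ tᵢ                      ≡⟨ mass-suc n i req ⟨
          mass n (suc i)                          ≤⟨ light n (suc i) ⟩
          ½^ (2 * n)                              ≡⟨ ι-2^-½^-+ ℓ (2 * n) ⟨
          ι (2 ^ ℓ) ℚ.* ½^ (ℓ + 2 * n)            ≡⟨ cong (λ k → ι (2 ^ ℓ) ℚ.* ½^ k) ℓ+2n ⟩
          ι (2 ^ ℓ) ℚ.* ½^ (suc tᵢ)               ∎))
          where open ℚₚ.≤-Reasoning
        finish : (∃[ τ ] length τ ≡ ℓ × value τ ≡ v) →
          ∃[ τ ] length τ + 2 * n ≡ suc tᵢ × check n τ i ≡ 0
        finish (τ , len , val) = τ , level , check-complete n i τ req level
          (subst (λ w → Z ≤ w * u) (sym val) Z≤vu) (subst (λ w → w * u ≤ Z + u) (sym val) vu≤Z+u)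
          where
          level : length τ + 2 * n ≡ suc tᵢ
          level = trans (cong (_+ 2 * n) len) ℓ+2n

      -- Of the constant 2, one bit pays for halving the share and one for the 0 that ends the
      -- marker. The marker adds n further bits where 2n have been dropped.
      machine-describes : ∀ n σ → D n σ ≡ true →
        ∃[ τ ] A ⊢ machine ⟨ τ ⟩≃ σ × length τ + n ≡ 2 + t σ
      machine-describes n σ req = finish (description n ⌜ σ ⌝ (trans (cong (D n) (decode⌜⌝ σ)) req))
        where
        finish : (∃[ τ ] length τ + 2 * n ≡ suc (t (decode ⌜ σ ⌝)) × check n τ ⌜ σ ⌝ ≡ 0) →
          ∃[ τ ] A ⊢ machine ⟨ τ ⟩≃ σ × length τ + n ≡ 2 + t σ
        finish (τ , level , ok) = selfDelimit n τ , machine-finds n τ ⌜ σ ⌝ ok , (begin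
          length (selfDelimit n τ) + n   ≡⟨ cong (_+ n) (length-selfDelimit n τ) ⟩
          suc (n + length τ) + n         ≡⟨ solve 2 (λ n l → con 1 :+ (n :+ l) :+ n := con 1 :+ (l :+ con 2 :* n)) refl n (length τ) ⟩
          suc (length τ + 2 * n)         ≡⟨ cong suc level ⟩
          2 + t (decode ⌜ σ ⌝)           ≡⟨ cong (λ σ → 2 + t σ) (decode⌜⌝ σ) ⟩
          2 + t σ                        ∎)
          where
          open ≡-Reasoning
          open ℕ-Solver

-- Randomness and incompressibility

∧-true⁻ : ∀ a {b} → a ∧ b ≡ true → a ≡ true × b ≡ true
∧-true⁻ true eq = refl , eq

stringsUpTo : ℕ → List String
stringsUpTo zero    = strings 0
stringsUpTo (suc m) = strings (suc m) ++ stringsUpTo m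

∈-stringsUpTo⁻ : ∀ m {τ} → τ ∈ˡ stringsUpTo m → length τ ≤ m
∈-stringsUpTo⁻ zero    τ∈ = ≤-reflexive (∈-strings⁻ 0 τ∈)
∈-stringsUpTo⁻ (suc m) τ∈ with ∈-++⁻ (strings (suc m)) τ∈
... | inj₁ τ∈ˡ = ≤-reflexive (∈-strings⁻ (suc m) τ∈ˡ)
... | inj₂ τ∈ʳ = m≤n⇒m≤1+n (∈-stringsUpTo⁻ m τ∈ʳ)

∈-stringsUpTo⁺ : ∀ m {τ} → length τ ≤ m → τ ∈ˡ stringsUpTo m
∈-stringsUpTo⁺ zero    {τ} le = subst (λ k → τ ∈ˡ strings k) (n≤0⇒n≡0 le) (∈-strings⁺ τ)
∈-stringsUpTo⁺ (suc m) {τ} le with m≤n⇒m<n∨m≡n le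
... | inj₁ (s≤s le′) = ∈-++⁺ʳ (strings (suc m)) (∈-stringsUpTo⁺ m le′)
... | inj₂ eq        = ∈-++⁺ˡ (subst (λ k → τ ∈ˡ strings k) eq (∈-strings⁺ τ))

stringsUpTo-unique : ∀ m → Unique (stringsUpTo m)
stringsUpTo-unique zero    = strings-unique 0
stringsUpTo-unique (suc m) = Uniqueₚ.++⁺ (strings-unique (suc m)) (stringsUpTo-unique m)
  λ (p , q) → <-irrefl (∈-strings⁻ (suc m) p) (s≤s (∈-stringsUpTo⁻ m q))

module Randomness (em : ExcludedMiddle 0ℓ) where
  open Classical em public

  ⟪_⟫ : Set → Bool
  ⟪ P ⟫ = does (em {P})

  ⟪⟫⁺ : ∀ {P} → P → ⟪ P ⟫ ≡ true
  ⟪⟫⁺ {P} p with em {P}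
  ... | yes _ = refl
  ... | no ¬p = contradiction p ¬p

  ⟪⟫⁻ : ∀ {P} → ⟪ P ⟫ ≡ true → P
  ⟪⟫⁻ {P} eq with em {P}
  ... | yes p = p

  ⟪⟫-false : ∀ {P} → ¬ P → ⟪ P ⟫ ≡ false
  ⟪⟫-false {P} ¬p with em {P}
  ... | yes p = contradiction p ¬p
  ... | no _  = refl

  ⟪⟫-false⁻ : ∀ {P} → ⟪ P ⟫ ≡ false → ¬ P
  ⟪⟫-false⁻ {P} eq with em {P}
  ... | no ¬p = ¬p

  by-contradiction : ∀ {P : Set} → ¬ ¬ P → P
  by-contradiction {P} ¬¬p with em {P}
  ... | yes p = p
  ... | no ¬p = contradiction ¬p ¬¬p

  ¬∀⇒∃¬ : ∀ {X : Set} {P : X → Set} → ¬ (∀ x → P x) → ∃[ x ] ¬ P x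
  ¬∀⇒∃¬ ¬∀ = by-contradiction λ ¬∃ → ¬∀ λ x → by-contradiction λ ¬p → ¬∃ (x , ¬p)

  -- Compactness of Cantor space

  module Compactness where
    Bounded : Pred String 0ℓ → Set
    Bounded V = ∃[ m ] ∀ X → ∃[ j ] j ≤ m × (X ↾ j) ∈ V

    Unbounded : Set₁
    Unbounded = ∃[ V ] ¬ Bounded V

    bounded : ∀ V → Bounded (λ σ → V (false ∷ σ)) → Bounded (λ σ → V (true ∷ σ)) → Bounded V
    bounded V (m , p) (n , q) = suc (m ⊔ n) , go
      where
      go : ∀ X → ∃[ j ] j ≤ suc (m ⊔ n) × (X ↾ j) ∈ V
      go X with X 0 in eq
      ... | false = let (j , j≤ , v) = p (X ∘ suc) in
        suc j , s≤s (≤-trans j≤ (m≤m⊔n m n)) , subst (λ b → V (b ∷ (X ∘ suc) ↾ j)) (sym eq) v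
      ... | true  = let (j , j≤ , v) = q (X ∘ suc) in
        suc j , s≤s (≤-trans j≤ (m≤n⊔m m n)) , subst (λ b → V (b ∷ (X ∘ suc) ↾ j)) (sym eq) v

    choose : Unbounded → Bool
    choose (V , _) = ⟪ Bounded (λ σ → V (false ∷ σ)) ⟫

    next : Unbounded → Unbounded
    next (V , unb) with em {Bounded (λ σ → V (false ∷ σ))}
    ... | yes b = (λ σ → V (true ∷ σ)) , λ b′ → unb (bounded V b b′)
    ... | no ¬b = (λ σ → V (false ∷ σ)) , ¬b

    path : Unbounded → Cantor
    path s zero    = choose s
    path s (suc i) = path (next s) i

    path-avoids : ∀ (j : ℕ) (s : Unbounded) → ¬ proj₁ s (path s ↾ j)
    path-avoids zero    (V , unb) v = unb (0 , λ X → 0 , z≤n , v)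
    path-avoids (suc j) s@(V , unb) v = path-avoids j (next s) (step s v)
      where
      step : ∀ (s : Unbounded) → proj₁ s (choose s ∷ path (next s) ↾ j) → proj₁ (next s) (path (next s) ↾ j)
      step (V , unb) with em {Bounded (λ σ → V (false ∷ σ))}
      ... | yes _ = id
      ... | no _  = id

    -- König's lemma: if the whole space has no bound, then neither has one of its halves. Moving
    -- into such a half again and again produces a path none of whose initial segments is in V.
    compactness : ∀ V → (∀ X → ∃[ j ] (X ↾ j) ∈ V) → Bounded V
    compactness V covers = by-contradiction λ unb →
      let (j , v) = covers (path (V , unb)) in path-avoids j (V , unb) v

  open Compactness using (compactness)

  -- Compactness is applied to a cover of the whole space: V together with the strings of length m
  -- whose cylinders are not inside ⟦V⟧. Below a cylinder that is inside, the bound can only be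
  -- realised by V. One M thus serves all τ of length m.
  cylinders-bounded : ∀ V m → ∃[ M ] ∀ τ → length τ ≡ m → (∀ {X} → X ∈ ⟦ τ ⟧ → X ∈ ⟦ V ⟧ˢ) →
    ∀ X → X ∈ ⟦ τ ⟧ → ∃[ j ] j ≤ M × (X ↾ j) ∈ V
  cylinders-bounded V m = let (M , bounded) = compactness V′ covers in
    M , λ τ len τ⊆ X τ≺X → let (j , j≤ , v′) = bounded X in j , j≤ , inV τ len τ⊆ X τ≺X j v′
    where
    V′ : Pred String 0ℓ
    V′ σ = V σ ⊎ (length σ ≡ m × ¬ (∀ X → X ∈ ⟦ σ ⟧ → X ∈ ⟦ V ⟧ˢ))
    covers : ∀ X → ∃[ j ] (X ↾ j) ∈ V′
    covers X with em {∀ Y → Y ∈ ⟦ X ↾ m ⟧ → Y ∈ ⟦ V ⟧ˢ}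
    ... | yes ⊆V = let (σ , v , σ≺X) = ⊆V X (↾-≺ X m) in length σ , inj₁ (subst V (sym σ≺X) v)
    ... | no ¬⊆V = m , inj₂ (length-↾ X m , ¬⊆V)
    inV : ∀ τ → length τ ≡ m → (∀ {X} → X ∈ ⟦ τ ⟧ → X ∈ ⟦ V ⟧ˢ) →
          ∀ X → X ∈ ⟦ τ ⟧ → ∀ j → V′ (X ↾ j) → V (X ↾ j)
    inV τ len τ⊆ X τ≺X j (inj₁ v) = v
    inV τ len τ⊆ X τ≺X j (inj₂ (j≡m , ¬⊆)) = contradiction (λ Y Y∈ → τ⊆ (subst (_≺ Y) X↾j≡τ Y∈)) ¬⊆
      where
      X↾j≡τ : X ↾ j ≡ τ
      X↾j≡τ = ≺-comparable (↾-≺ X j) τ≺X (trans j≡m (sym len))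

  -- Measures of open sets

  inside : Pred Cantor 0ℓ → String → Bool
  inside C τ = ⟪ (∀ {X} → X ∈ ⟦ τ ⟧ → X ∈ C) ⟫

  -- The rational counterpart of the sums in `MeasureAtMost`; `measure-lower` and `measure-upper`
  -- pass between the two.
  cylinderSum : (String → ℚ) → ℕ → Pred Cantor 0ℓ → ℚ
  cylinderSum ν m C = sum (strings m) λ τ → when (inside C τ) (ν τ)

  when-* : ∀ b a p → when b (a ℚ.* p) ≡ a ℚ.* when b p
  when-* true  a p = refl
  when-* false a p = sym (ℚₚ.*-zeroʳ a)

  cylinderSum-* : ∀ a ν m C → cylinderSum (λ τ → a ℚ.* ν τ) m C ≡ a ℚ.* cylinderSum ν m C
  cylinderSum-* a ν m C = trans (sum-cong (strings m) λ τ → when-* (inside C τ) a (ν τ)) (sum-* a (strings m) _)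

  measure-lower : ∀ {μ ν r C} → (∀ τ → fromℚ (ν τ) ≤ℝ μ τ) → MeasureAtMost μ C (fromℚ r) →
    ∀ m → cylinderSum ν m C ℚ.≤ r
  measure-lower {μ} {ν} {r} {C} lower atMost m = subst (ℚ._≤ r)
    (sum-filter (dec λ τ → ∀ {X} → X ∈ ⟦ τ ⟧ → X ∈ C) (strings m) ν)
    (fromℚ-cancel-≤ (≤ℝ-trans {fromℚ (sum L ν)} {sumℝ L μ} {fromℚ r}
      (sum≤sumℝ L ν μ λ τ _ → lower τ) (atMost m)))
    where L = cylindersIn m C

  measure-upper : ∀ {μ ν r C} → (∀ τ → μ τ ≤ℝ fromℚ (ν τ)) →
    (∀ m → cylinderSum ν m C ℚ.≤ r) → MeasureAtMost μ C (fromℚ r)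
  measure-upper {μ} {ν} {r} {C} upper le m = ≤ℝ-trans {sumℝ L μ} {fromℚ (sum L ν)} {fromℚ r}
    (sumℝ≤sum L ν μ λ τ _ → upper τ)
    (fromℚ-mono-≤ (subst (ℚ._≤ r)
      (sym (sum-filter (dec λ τ → ∀ {X} → X ∈ ⟦ τ ⟧ → X ∈ C) (strings m) ν)) (le m)))
    where L = cylindersIn m C

  -- Its negation says that K(X ↾ m) > t(X ↾ m) - c for all m, phrased through arbitrary
  -- descriptions so that no shortest one has to be produced.
  Compressed : Oracle → Rec 1 → (String → ℕ) → Cantor → ℕ → Set
  Compressed A U t X c = ∃[ m ] ∃[ τ ] A ⊢ U ⟨ τ ⟩≃ (X ↾ m) × length τ + c ≤ t (X ↾ m)

  -- The Levin–Schnorr theorem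

  module _ (A : Oracle) where
    open StringComputability A

    -- Stated for ν(σ) = 2^-t(σ) on S and a measure μ ≥ 2^-C ν because it is used twice: for T and
    -- λ_P with C = 2c, and for the full tree with t = `length` and C = 0.
    module _ (S : String → Bool) (t : String → ℕ)
      (Sᶜ : ∀ {n} {F : Vec ℕ n → String} → Computableˢ F → Computableᵇ (λ xs → S (F xs)))
      (tᶜ : ∀ {n} {F : Vec ℕ n → String} → Computableˢ F → Computable (λ xs → t (F xs)))
      (t≤⌜⌝ : ∀ σ → t σ ≤ ⌜ σ ⌝)
      (additive : Additive (λ σ → when (S σ) (½^ (t σ))))
      (μ : String → ℝ) (C : ℕ) (μ-lower : ∀ τ → fromℚ (½^ C ℚ.* when (S τ) (½^ (t τ))) ≤ℝ μ τ)
      where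
      private
        ν : String → ℚ
        ν σ = when (S σ) (½^ (t σ))

        ν-nonNeg : ∀ σ → 0ℚ ℚ.≤ ν σ
        ν-nonNeg σ = when-nonNeg (S σ) (½^-nonNeg (t σ))

      -- The index 2n + C provides 2n for the permitted weight of the n-th request set and C for the
      -- passage from μ to ν.
      freshIn : Rec 2 → ℕ → String → Bool
      freshIn e n σ = S σ ∧ fresh e (2 * n + C) σ

      freshIn⁻ : ∀ e n σ → freshIn e n σ ≡ true → S σ ≡ true × fresh e (2 * n + C) σ ≡ true
      freshIn⁻ e n σ = ∧-true⁻ (S σ)

      -- The requested cylinders are disjoint and lie in the open set. Strings with codes below i
      -- have length at most i, so the cylinders of level i refine all of them.
      freshIn-mass : ∀ e n i →
        sum (upTo i) (λ j → when (freshIn e n (decode j)) (½^ (t (decode j)))) ℚ.≤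
        cylinderSum ν i ⟦ W A e (2 * n + C) ⟧ˢ
      freshIn-mass e n i = double-count (upTo i) (strings i) w rows columns
        where
        N = 2 * n + C
        B : ℕ → String → Bool
        B j τ = freshIn e n (decode j) ∧ isPrefix (decode j) τ
        B⁻ : ∀ j τ → B j τ ≡ true → freshIn e n (decode j) ≡ true × isPrefix (decode j) τ ≡ true
        B⁻ j τ = ∧-true⁻ (freshIn e n (decode j))
        w : ℕ → String → ℚ
        w j τ = when (B j τ) (ν τ)
        length-decode< : ∀ j → length (decode j) ≤ j
        length-decode< j = subst (length (decode j) ≤_) (⌜decode⌝ j) (length≤⌜⌝ (decode j))
        row : ∀ j → j < i → ∀ b → freshIn e n (decode j) ≡ b →
          when b (½^ (t (decode j))) ℚ.≤ sum (strings i) (λ τ → when (b ∧ isPrefix (decode j) τ) (ν τ))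
        row j j<i false _  = ℚₚ.≤-reflexive (sym (sum-0 (strings i)))
        row j j<i true  eq = ℚₚ.≤-reflexive (trans
          (cong (λ b → when b (½^ (t (decode j)))) (sym (proj₁ (freshIn⁻ e n (decode j) eq))))
          (sym (sum-cone additive i (decode j) (≤-trans (length-decode< j) (<⇒≤ j<i)))))
        rows : ∀ j → j ∈ˡ upTo i → when (freshIn e n (decode j)) (½^ (t (decode j))) ℚ.≤ sum (strings i) (w j)
        rows j j∈ = row j (∈-upTo⁻ j∈) (freshIn e n (decode j)) refl
        prefixes : ∀ j τ → B j τ ≡ true → decode j ≺ nth τ × fresh e N (decode j) ≡ true
        prefixes j τ eq = let (p , q) = B⁻ j τ eq in
          proj₁ (isPrefix⁻ (decode j) τ q (≺-nth τ)) , proj₂ (freshIn⁻ e n (decode j) p)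
        same : ∀ j k τ → B j τ ≡ true → B k τ ≡ true → j ≡ k
        same j k τ p q =
          let (j≺ , fj) = prefixes j τ p
              (k≺ , fk) = prefixes k τ q
              lengths = fresh-unique e N (nth τ) (subst (λ σ → fresh e N σ ≡ true) (sym j≺) fj)
                                                 (subst (λ σ → fresh e N σ ≡ true) (sym k≺) fk)
          in trans (sym (⌜decode⌝ j)) (trans (cong ⌜_⌝ (≺-comparable j≺ k≺ lengths)) (⌜decode⌝ k))
        bound : ∀ j τ → B j τ ≡ true → inside ⟦ W A e N ⟧ˢ τ ≡ true
        bound j τ eq = let (p , q) = B⁻ j τ eq in ⟪⟫⁺ λ {X} τ≺X →
          fresh-⊆ e N (decode j) (proj₂ (freshIn⁻ e n (decode j) p)) {X}
            (proj₁ (isPrefix⁻ (decode j) τ q τ≺X))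
        columns : ∀ τ → τ ∈ˡ strings i → sum (upTo i) (λ j → w j τ) ℚ.≤ when (inside ⟦ W A e N ⟧ˢ τ) (ν τ)
        columns τ _ = sum-atMostOne (Uniqueₚ.upTo⁺ i) (λ j → B j τ)
          (when-nonNeg (inside ⟦ W A e N ⟧ˢ τ) (ν-nonNeg τ))
          (λ j k _ _ p q → same j k τ p q)
          (λ j _ eq → ℚₚ.≤-reflexive (cong (λ b → when b (ν τ)) (sym (bound j τ eq))))

      incompressible⇒random : ∀ {U} → OptimalPrefixFree A U → ∀ X → (∀ m → S (X ↾ m) ≡ true) →
        (∃[ c ] ¬ Compressed A U t X c) → X ∈ MLR A μ
      incompressible⇒random {U} (_ , optimal) X X∈S (c , inc) e test inAll =
        compress (optimal M M-prefixFree)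
        where
        open KraftChaitin A
        D = freshIn e
        Dᶜ : ∀ {n} {h : Vec ℕ n → ℕ} {F : Vec ℕ n → String} → Computable h → Computableˢ F →
             Computableᵇ (λ xs → D (h xs) (F xs))
        Dᶜ h f = Sᶜ f ∧ᶜ freshᶜ e (constᶜ 2 *ᶜ h +ᶜ constᶜ C) f
        light : ∀ n i → mass D t Dᶜ tᶜ t≤⌜⌝ n i ℚ.≤ ½^ (2 * n)
        light n i = ℚₚ.≤-trans (freshIn-mass e n i)
          (ℚₚ.*-cancelˡ-≤-pos (½^ C) {{ℚ.positive (½^-pos C)}} (ℚₚ.≤-trans
            (ℚₚ.≤-reflexive (sym (cylinderSum-* (½^ C) ν i ⟦ W A e (2 * n + C) ⟧ˢ)))
            (ℚₚ.≤-trans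
              (measure-lower {μ} {λ τ → ½^ C ℚ.* ν τ} {½^ (2 * n + C)} {⟦ W A e (2 * n + C) ⟧ˢ} μ-lower (test (2 * n + C)) i)
              (ℚₚ.≤-reflexive (trans (cong ½^ (+-comm (2 * n) C)) (½^-+ C (2 * n)))))))
        M = machine D t Dᶜ tᶜ t≤⌜⌝
        M-prefixFree : PrefixFree A M
        M-prefixFree = machine-prefixFree D t Dᶜ tᶜ t≤⌜⌝ light
        compress : (∃[ d ] ∀ τ σ → A ⊢ M ⟨ τ ⟩≃ σ → ∃[ τ′ ] A ⊢ U ⟨ τ′ ⟩≃ σ × length τ′ ≤ length τ + d) → _
        compress (d , optimalM) = inc (m , τ′ , U-halts , short)
          where
          -- The gain n outweighs the overhead 2 of the machine, the overhead d of simulating it by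
          -- U, and the assumed deficiency c.
          n = 2 + d + c
          first = fresh-covers e (2 * n + C) X (inAll (2 * n + C))
          m = proj₁ first
          requested : D n (X ↾ m) ≡ true
          requested = cong₂ _∧_ (X∈S m) (proj₂ first)
          description′ = machine-describes D t Dᶜ tᶜ t≤⌜⌝ light n (X ↾ m) requested
          τ = proj₁ description′
          better = optimalM τ (X ↾ m) (proj₁ (proj₂ description′))
          τ′ = proj₁ better
          U-halts = proj₁ (proj₂ better)
          short : length τ′ + c ≤ t (X ↾ m)
          short = +-cancelˡ-≤ 2 _ _ (begin
            2 + (length τ′ + c)        ≤⟨ +-monoʳ-≤ 2 (+-monoˡ-≤ c (proj₂ (proj₂ better))) ⟩
            2 + (length τ + d + c)     ≡⟨ solve 3 (λ l d c → con 2 :+ (l :+ d :+ c) := l :+ (con 2 :+ d :+ c)) refl (length τ) d c ⟩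
            length τ + n               ≡⟨ proj₂ (proj₂ description′) ⟩
            2 + t (X ↾ m)              ∎)
            where
            open ≤-Reasoning
            open ℕ-Solver

-- The test of compressible strings

module Compression (em : ExcludedMiddle 0ℓ) where
  open Randomness em public

  module _ (A : Oracle) where
    open StringComputability A

    module _ (U : Rec 1) (U-prefixFree : PrefixFree A U) where

      Short : ℕ → Pred String 0ℓ
      Short n σ = ∃[ τ ] A ⊢ U ⟨ τ ⟩≃ σ × length τ + n ≤ length σ

      private
        -- The witness sought codes 1ˢ0τ, for a description τ on which U halts within s steps.
        search : Vec ℕ 3 → ℕ
        search xs = (ev U (lead i) (⌜ rest i ⌝ ∷ []) ∸ suc x) + (suc x ∸ ev U (lead i) (⌜ rest i ⌝ ∷ []))
                  + (length (rest i) + head (tail xs) ∸ length (decode x))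
          where
          i = decode (head xs)
          x = head (tail (tail xs))

        searchᶜ : Computable search
        searchᶜ = (run ∸ᶜ sucᶜ x) +ᶜ (sucᶜ x ∸ᶜ run) +ᶜ
                  (lengthᶜ (restᶜ i) +ᶜ headᶜ (tailᵛ idᵛ) ∸ᶜ lengthᶜ (decodeᶜ x))
          where
          i = decodeᶜ (headᶜ idᵛ)
          x = headᶜ (tailᵛ (tailᵛ idᵛ))
          run = subᶜ (evᶜ U) (leadᶜ i ∷ᵛ code (restᶜ i) ∷ᵛ []ᵛ)

        search-sound : ∀ n σ i → search (i ∷ n ∷ ⌜ σ ⌝ ∷ []) ≡ 0 → Short n σ
        search-sound n σ i eq =
          rest (decode i) , ev-sound U (lead (decode i)) (⌜ rest (decode i) ⌝ ∷ []) runs ,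
          subst (length (rest (decode i)) + n ≤_) (cong length (decode⌜⌝ σ))
            (m∸n≡0⇒m≤n (m+n≡0⇒n≡0 (a + b) {c} eq))
          where
          r = ev U (lead (decode i)) (⌜ rest (decode i) ⌝ ∷ [])
          a = r ∸ suc ⌜ σ ⌝
          b = suc ⌜ σ ⌝ ∸ r
          c = length (rest (decode i)) + n ∸ length (decode ⌜ σ ⌝)
          a+b≡0 : a + b ≡ 0
          a+b≡0 = m+n≡0⇒m≡0 (a + b) {c} eq
          runs : r ≡ suc ⌜ σ ⌝
          runs = ≤-antisym (m∸n≡0⇒m≤n {r} {suc ⌜ σ ⌝} (m+n≡0⇒m≡0 a {b} a+b≡0))
                           (m∸n≡0⇒m≤n {suc ⌜ σ ⌝} {r} (m+n≡0⇒n≡0 a {b} a+b≡0))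

        search-complete : ∀ n σ → Short n σ → ∃[ i ] search (i ∷ n ∷ ⌜ σ ⌝ ∷ []) ≡ 0
        search-complete n σ (τ , d , le) with ev-complete d
        ... | s , at = ⌜ selfDelimit s τ ⌝ , zeroes
          where
          zeroes : search (⌜ selfDelimit s τ ⌝ ∷ n ∷ ⌜ σ ⌝ ∷ []) ≡ 0
          zeroes rewrite decode⌜⌝ (selfDelimit s τ) | lead-selfDelimit s τ | rest-selfDelimit s τ
            | at s ≤-refl | decode⌜⌝ σ | n∸n≡0 ⌜ σ ⌝ = m≤n⇒m∸n≡0 le

      abstract
        shortTest : Rec 2
        shortTest = μᶠ (program searchᶜ)

        shortTest⁻ : ∀ n σ → W A shortTest n σ → Short n σ
        shortTest⁻ n σ (i , d) = search-sound n σ i (μ-zero searchᶜ d)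

        shortTest⁺ : ∀ n σ → Short n σ → W A shortTest n σ
        shortTest⁺ n σ s = let (i , eq) = search-complete n σ s in μ-converges searchᶜ {m = i} eq

      halts : String → Bool
      halts ρ = ⟪ (∃[ y ] A ⊢ U [ ⌜ ρ ⌝ ∷ [] ]⇓ y) ⟫

      -- By prefix-freeness, a string of length M extends at most one input on which U halts.
      kraft : ∀ M → sum (stringsUpTo M) (λ ρ → when (halts ρ) (½^ (length ρ))) ℚ.≤ 1ℚ
      kraft M = ℚₚ.≤-trans (double-count (stringsUpTo M) (strings M) w rows columns)
                           (ℚₚ.≤-reflexive (sum-level ½^length-additive M))
        where
        w : String → String → ℚ
        w ρ τ = when (halts ρ ∧ isPrefix ρ τ) (½^ (length τ))
        rows : ∀ ρ → ρ ∈ˡ stringsUpTo M → when (halts ρ) (½^ (length ρ)) ℚ.≤ sum (strings M) (w ρ)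
        rows ρ ρ∈ with halts ρ
        ... | false = ℚₚ.≤-reflexive (sym (sum-0 (strings M)))
        ... | true  = ℚₚ.≤-reflexive (sym (sum-cone ½^length-additive M ρ (∈-stringsUpTo⁻ M ρ∈)))
        one : ∀ τ ρ ρ′ → halts ρ ∧ isPrefix ρ τ ≡ true → halts ρ′ ∧ isPrefix ρ′ τ ≡ true → ρ ≡ ρ′
        one τ ρ ρ′ p q with ∧-true⁻ (halts ρ) p | ∧-true⁻ (halts ρ′) q
        ... | h , i | h′ , i′
          with proj₁ (isPrefix⁻ ρ τ i (≺-nth τ)) | proj₁ (isPrefix⁻ ρ′ τ i′ (≺-nth τ)) | ≤-total (length ρ) (length ρ′)
        ... | ρ≺ | ρ′≺ | inj₁ le =
          U-prefixFree (proj₂ (⟪⟫⁻ h)) (proj₂ (⟪⟫⁻ h′)) (isPrefix⇒≼ ρ ρ′ (isPrefix⁺ ρ ρ′ ρ≺ ρ′≺ le))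
        ... | ρ≺ | ρ′≺ | inj₂ le =
          sym (U-prefixFree (proj₂ (⟪⟫⁻ h′)) (proj₂ (⟪⟫⁻ h)) (isPrefix⇒≼ ρ′ ρ (isPrefix⁺ ρ′ ρ ρ′≺ ρ≺ le)))
        columns : ∀ τ → τ ∈ˡ strings M → sum (stringsUpTo M) (λ ρ → w ρ τ) ℚ.≤ ½^ (length τ)
        columns τ _ = sum-atMostOne (stringsUpTo-unique M) (λ ρ → halts ρ ∧ isPrefix ρ τ)
          (½^-nonNeg (length τ)) (λ ρ ρ′ _ _ → one τ ρ ρ′) (λ _ _ _ → ℚₚ.≤-refl)

      -- A cylinder may lie in the open set although only longer strings are in `Short n`, so it is
      -- first cut to a level M where, by compactness, every piece τ has a prefix σ in `Short n`.
      -- Each piece is then charged to a description ρ of σ. As U is deterministic, the pieces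
      -- charged to ρ all extend one σ and measure at most 2^-|σ| ≤ 2^-n · 2^-|ρ|; Kraft's
      -- inequality sums this over ρ.
      short-measure : ∀ n m → cylinderSum (λ σ → ½^ (length σ)) m ⟦ Short n ⟧ˢ ℚ.≤ ½^ n
      short-measure n m = ℚₚ.≤-trans refine (ℚₚ.≤-trans describe (ℚₚ.≤-trans
        (ℚₚ.≤-reflexive (sum-* (½^ n) (stringsUpTo M) _))
        (ℚₚ.≤-trans (*-monoˡ (½^-nonNeg n) (kraft M)) (ℚₚ.≤-reflexive (ℚₚ.*-identityʳ (½^ n))))))
        where
        λ₀ : String → ℚ
        λ₀ σ = ½^ (length σ)
        M₀ = proj₁ (cylinders-bounded (Short n) m)
        M₀-bounds = proj₂ (cylinders-bounded (Short n) m)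
        M = M₀ ⊔ m
        V = ⟦ Short n ⟧ˢ
        Covered : String → Set
        Covered τ = ∃[ σ ] Short n σ × isPrefix σ τ ≡ true
        Describes′ : String → String → Set
        Describes′ τ ρ = ∃[ σ ] A ⊢ U ⟨ ρ ⟩≃ σ × length ρ + n ≤ length σ × isPrefix σ τ ≡ true
        refine : cylinderSum λ₀ m V ℚ.≤ sum (strings M) (λ τ → when ⟪ Covered τ ⟫ (λ₀ τ))
        refine = double-count (strings m) (strings M) w rows columns
          where
          w : String → String → ℚ
          w σ τ = when (inside V σ ∧ isPrefix σ τ) (λ₀ τ)
          rows : ∀ σ → σ ∈ˡ strings m → when (inside V σ) (λ₀ σ) ℚ.≤ sum (strings M) (w σ)
          rows σ σ∈ with inside V σ
          ... | false = ℚₚ.≤-reflexive (sym (sum-0 (strings M)))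
          ... | true  = ℚₚ.≤-reflexive (sym (sum-cone ½^length-additive M σ
                          (≤-trans (≤-reflexive (∈-strings⁻ m σ∈)) (m≤n⊔m M₀ m))))
          prefix : ∀ σ τ → inside V σ ∧ isPrefix σ τ ≡ true → σ ≺ nth τ
          prefix σ τ eq = proj₁ (isPrefix⁻ σ τ (proj₂ (∧-true⁻ (inside V σ) eq)) (≺-nth τ))
          covered : ∀ σ τ → σ ∈ˡ strings m → τ ∈ˡ strings M → inside V σ ∧ isPrefix σ τ ≡ true → Covered τ
          covered σ τ σ∈ τ∈ eq =
            let (j , j≤ , s) = M₀-bounds σ (∈-strings⁻ m σ∈) (⟪⟫⁻ (proj₁ (∧-true⁻ (inside V σ) eq)))
                                 (nth τ) (prefix σ τ eq)
            in nth τ ↾ j , s , isPrefix⁺ (nth τ ↾ j) τ (↾-≺ (nth τ) j) (≺-nth τ)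
                 (≤-trans (≤-reflexive (length-↾ (nth τ) j))
                   (≤-trans j≤ (≤-trans (m≤m⊔n M₀ m) (≤-reflexive (sym (∈-strings⁻ M τ∈))))))
          columns : ∀ τ → τ ∈ˡ strings M → sum (strings m) (λ σ → w σ τ) ℚ.≤ when ⟪ Covered τ ⟫ (λ₀ τ)
          columns τ τ∈ = sum-atMostOne (strings-unique m) (λ σ → inside V σ ∧ isPrefix σ τ)
            (when-nonNeg ⟪ Covered τ ⟫ (½^-nonNeg (length τ)))
            (λ σ σ′ σ∈ σ′∈ p q → ≺-comparable (prefix σ τ p) (prefix σ′ τ q)
              (trans (∈-strings⁻ m σ∈) (sym (∈-strings⁻ m σ′∈))))
            (λ σ σ∈ eq → ℚₚ.≤-reflexive (cong (λ b → when b (λ₀ τ)) (sym (⟪⟫⁺ (covered σ τ σ∈ τ∈ eq)))))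
        describe : sum (strings M) (λ τ → when ⟪ Covered τ ⟫ (λ₀ τ)) ℚ.≤
                   sum (stringsUpTo M) (λ ρ → ½^ n ℚ.* when (halts ρ) (½^ (length ρ)))
        describe = double-count (strings M) (stringsUpTo M) w rows columns
          where
          w : String → String → ℚ
          w τ ρ = when ⟪ Describes′ τ ρ ⟫ (λ₀ τ)
          rows : ∀ τ → τ ∈ˡ strings M → when ⟪ Covered τ ⟫ (λ₀ τ) ℚ.≤ sum (stringsUpTo M) (w τ)
          rows τ τ∈ with em {Covered τ}
          ... | no _ = sum-nonNeg (stringsUpTo M) λ ρ _ → when-nonNeg ⟪ Describes′ τ ρ ⟫ (½^-nonNeg (length τ))
          ... | yes (σ , (ρ , d , le) , pre) = ℚₚ.≤-trans
            (ℚₚ.≤-reflexive (cong (λ b → when b (λ₀ τ)) (sym (⟪⟫⁺ {Describes′ τ ρ} (σ , d , le , pre)))))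
            (sum-member {f = w τ} (λ ρ _ → when-nonNeg ⟪ Describes′ τ ρ ⟫ (½^-nonNeg (length τ)))
              {ρ} (∈-stringsUpTo⁺ M (≤-trans (≤-trans (m≤m+n (length ρ) n) le)
                (≤-trans (proj₂ (isPrefix⁻ σ τ pre (≺-nth τ))) (≤-reflexive (∈-strings⁻ M τ∈))))))
          columns : ∀ ρ → ρ ∈ˡ stringsUpTo M → sum (strings M) (λ τ → w τ ρ) ℚ.≤
                    ½^ n ℚ.* when (halts ρ) (½^ (length ρ))
          columns ρ _ with em {∃[ τ ] τ ∈ˡ strings M × Describes′ τ ρ}
          ... | no none = ℚₚ.≤-trans (sum-mono (strings M) λ τ τ∈ → ℚₚ.≤-reflexive
                    (cong (λ b → when b (λ₀ τ)) (⟪⟫-false λ d → none (τ , τ∈ , d))))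
                  (ℚₚ.≤-trans (ℚₚ.≤-reflexive (sum-0 (strings M)))
                    (*-nonNeg (½^-nonNeg n) (when-nonNeg (halts ρ) (½^-nonNeg (length ρ)))))
          ... | yes (τ₀ , τ₀∈ , σ , d , le , pre) = begin
            sum (strings M) (λ τ → w τ ρ)                       ≤⟨ sum-mono (strings M) onlyσ ⟩
            sum (strings M) (λ τ → when (isPrefix σ τ) (λ₀ τ))  ≡⟨ sum-cone ½^length-additive M σ
              (≤-trans (proj₂ (isPrefix⁻ σ τ₀ pre (≺-nth τ₀))) (≤-reflexive (∈-strings⁻ M τ₀∈))) ⟩
            ½^ (length σ)                                       ≤⟨ ½^-antitone le ⟩
            ½^ (length ρ + n)                                   ≡⟨ cong ½^ (+-comm (length ρ) n) ⟩
            ½^ (n + length ρ)                                   ≡⟨ ½^-+ n (length ρ) ⟩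
            ½^ n ℚ.* ½^ (length ρ)
              ≡⟨ cong (λ b → ½^ n ℚ.* when b (½^ (length ρ))) (⟪⟫⁺ (⌜ σ ⌝ , d)) ⟨
            ½^ n ℚ.* when (halts ρ) (½^ (length ρ))             ∎
            where
            open ℚₚ.≤-Reasoning
            onlyσ : ∀ τ → τ ∈ˡ strings M → w τ ρ ℚ.≤ when (isPrefix σ τ) (λ₀ τ)
            onlyσ τ _ with em {Describes′ τ ρ}
            ... | no _ = when-nonNeg (isPrefix σ τ) (½^-nonNeg (length τ))
            ... | yes (σ′ , d′ , _ , pre′) = ℚₚ.≤-reflexive (cong (λ b → when b (λ₀ τ)) (sym
              (subst (λ σ → isPrefix σ τ ≡ true) (⌜⌝-injective σ′ σ (deterministic d′ d)) pre′)))

      shortTest-inside : ∀ n τ → inside ⟦ W A shortTest n ⟧ˢ τ ≡ true → inside ⟦ Short n ⟧ˢ τ ≡ true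
      shortTest-inside n τ eq = ⟪⟫⁺ λ {X} τ≺X →
        let (σ , w , σ≺X) = ⟪⟫⁻ eq {X} τ≺X in σ , shortTest⁻ n σ w , σ≺X

      shortTest-measure : ∀ n m → cylinderSum (λ σ → ½^ (length σ)) m ⟦ W A shortTest n ⟧ˢ ℚ.≤ ½^ n
      shortTest-measure n m = ℚₚ.≤-trans
        (sum-mono (strings m) λ τ _ → when-mono (shortTest-inside n τ) (½^-nonNeg (length τ)))
        (short-measure n m)

      shortTest-MLTest : ∀ {μ} → (∀ τ → μ τ ≤ℝ fromℚ (½^ (length τ))) → MLTest A μ shortTest
      shortTest-MLTest {μ} upper n = measure-upper {μ} {λ σ → ½^ (length σ)} {½^ n} {⟦ W A shortTest n ⟧ˢ}
        upper (shortTest-measure n)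

      avoids⇒incompressible : ∀ {n X} → X ∉ ⟦ W A shortTest n ⟧ˢ → ¬ Compressed A U length X n
      avoids⇒incompressible {n} {X} X∉ (m , τ , d , le) = X∉ (X ↾ m , shortTest⁺ n (X ↾ m) (τ , d , le) , ↾-≺ X m)

      random⇒incompressible : ∀ {μ} → (∀ τ → μ τ ≤ℝ fromℚ (½^ (length τ))) →
        ∀ {X} → X ∈ MLR A μ → ∃[ c ] ¬ Compressed A U length X c
      random⇒incompressible {μ} upper random =
        let (n , X∉) = ¬∀⇒∃¬ (random shortTest (shortTest-MLTest {μ} upper)) in n , avoids⇒incompressible X∉

      incompressible-extension : ∀ ρ → ∃[ X ] X ∈ ⟦ ρ ⟧ × ∃[ c ] ¬ Compressed A U length X c
      incompressible-extension ρ =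
        let (X , ¬imp) = ¬∀⇒∃¬ notInside
            X∈ = by-contradiction λ X∉ρ → ¬imp λ X∈ρ → contradiction X∈ρ X∉ρ
        in X , X∈ , n , avoids⇒incompressible λ X∈W → ¬imp λ _ → X∈W
        where
        -- The n-th set has measure at most 2^-n, less than that of the cylinder of ρ, and so misses
        -- a point of it.
        n = suc (length ρ)
        V = ⟦ W A shortTest n ⟧ˢ
        notInside : ¬ (∀ X → X ∈ ⟦ ρ ⟧ → X ∈ V)
        notInside ρ⊆ = ℚₚ.<-irrefl refl (ℚₚ.≤-<-trans big (½^-suc-< (length ρ)))
          where
          big : ½^ (length ρ) ℚ.≤ ½^ n
          big = ℚₚ.≤-trans
            (ℚₚ.≤-trans (ℚₚ.≤-reflexive (cong (λ b → when b (½^ (length ρ))) (sym (⟪⟫⁺ λ {X} → ρ⊆ X))))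
              (sum-member {f = λ τ → when (inside V τ) (½^ (length τ))}
                (λ τ _ → when-nonNeg (inside V τ) (½^-nonNeg (length τ))) (∈-strings⁺ ρ)))
            (shortTest-measure n (length ρ))

-- The tree of extendible nodes

flipLast-∷ʳ : ∀ σ b → flipLast (σ ∷ʳ b) ≡ σ ∷ʳ not b
flipLast-∷ʳ []          b = refl
flipLast-∷ʳ (_ ∷ [])    b = refl
flipLast-∷ʳ (a ∷ c ∷ σ) b = cong (a ∷_) (flipLast-∷ʳ (c ∷ σ) b)

take-suc : ∀ k (σ : String) → k < length σ → take (suc k) σ ≡ take k σ ∷ʳ nth σ k
take-suc zero    (b ∷ σ) _        = refl
take-suc (suc k) (b ∷ σ) (s≤s k<) = cong (b ∷_) (take-suc k σ k<)

count-suc : ∀ {P : Pred ℕ 0ℓ} (P? : ∀ x → Dec (P x)) f n →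
  length (filter P? (applyUpTo f (suc n))) ≡ length (filter P? (applyUpTo f n)) + bit (does (P? (f n)))
count-suc P? f n = begin
  length (filter P? (applyUpTo f (suc n)))
    ≡⟨ cong (length ∘ filter P?) (applyUpTo-∷ʳ f n) ⟨
  length (filter P? (applyUpTo f n ∷ʳ f n))
    ≡⟨ cong length (filter-++ P? (applyUpTo f n) (f n ∷ [])) ⟩
  length (filter P? (applyUpTo f n) ++ filter P? (f n ∷ []))
    ≡⟨ length-++ (filter P? (applyUpTo f n)) ⟩
  length (filter P? (applyUpTo f n)) + length (filter P? (f n ∷ []))
    ≡⟨ cong (length (filter P? (applyUpTo f n)) +_) (single (does (P? (f n))) refl) ⟩
  length (filter P? (applyUpTo f n)) + bit (does (P? (f n))) ∎
  where
  open ≡-Reasoning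
  single : ∀ b → does (P? (f n)) ≡ b → length (filter P? (f n ∷ [])) ≡ bit b
  single b eq with does (P? (f n))
  single b refl | true  = refl
  single b refl | false = refl

length-extendIf : ∀ c ρ b → length (extendIf c ρ b) ≡ length ρ + bit c
length-extendIf true  ρ b = trans (length-∷ʳ ρ b) (+-comm 1 (length ρ))
length-extendIf false ρ b = sym (+-identityʳ (length ρ))

ι-count : ∀ {X : Set} {P : Pred X 0ℓ} (P? : ∀ x → Dec (P x)) xs →
  ι (length (filter P? xs)) ≡ sum xs (λ x → when (does (P? x)) 1ℚ)
ι-count P? []       = refl
ι-count P? (x ∷ xs) with does (P? x)
... | true  = cong (1ℚ ℚ.+_) (ι-count P? xs)
... | false = trans (ι-count P? xs) (sym (ℚₚ.+-identityˡ _))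

bool-≡ : ∀ {a b} → (a ≡ true → b ≡ true) → (b ≡ true → a ≡ true) → a ≡ b
bool-≡ {true}  {b}     f g = sym (f refl)
bool-≡ {false} {false} f g = refl
bool-≡ {false} {true}  f g = g refl

≤ℝ-fromℚ : ∀ {x q} → (∀ ε → 0ℚ ℚ.< ε → x ≤ℝ fromℚ (q ℚ.+ ε)) → x ≤ℝ fromℚ q
≤ℝ-fromℚ {x} {q} le ε 0<ε =
  let (N , at) = le (½ ℚ.* ε) (½*-pos 0<ε) (½ ℚ.* ε) (½*-pos 0<ε)
  in N , λ n n≥ → ℚₚ.≤-trans (at n n≥) (ℚₚ.≤-reflexive
       (trans (ℚₚ.+-assoc q (½ ℚ.* ε) (½ ℚ.* ε)) (cong (q ℚ.+_) (½+½ ε))))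

fromℚ-≤ℝ : ∀ {x q} → (∀ ε → 0ℚ ℚ.< ε → fromℚ (q ℚ.- ε) ≤ℝ x) → fromℚ q ≤ℝ x
fromℚ-≤ℝ {x} {q} le ε 0<ε =
  let (N , at) = le (½ ℚ.* ε) (½*-pos 0<ε) (½ ℚ.* ε) (½*-pos 0<ε)
  in N , λ n n≥ → subst₂ ℚ._≤_ (cancel q (½ ℚ.* ε))
       (trans (ℚₚ.+-assoc (ℝ.approx x n) (½ ℚ.* ε) (½ ℚ.* ε)) (cong (ℝ.approx x n ℚ.+_) (½+½ ε)))
       (ℚₚ.+-monoˡ-≤ (½ ℚ.* ε) (at n n≥))
  where
  cancel : ∀ q e → (q ℚ.- e) ℚ.+ e ≡ q
  cancel = solve 2 (λ q e → (q :- e) :+ e := q) refl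
    where open +-*-Solver

Lim-upper : ∀ {q x b} N → Lim q x → (∀ n → N ≤ n → q n ℚ.≤ b) → x ≤ℝ fromℚ b
Lim-upper {q} {x} {b} N lim le = ≤ℝ-fromℚ {x} {b} λ ε 0<ε →
  let (M , at) = lim ε 0<ε
      n = M ⊔ N
  in ≤ℝ-trans {x} {fromℚ (q n ℚ.+ ε)} {fromℚ (b ℚ.+ ε)} (proj₂ (at n (m≤m⊔n M N)))
       (fromℚ-mono-≤ (ℚₚ.+-monoˡ-≤ ε (le n (m≤n⊔m M N))))

Lim-lower : ∀ {q x b} N → Lim q x → (∀ n → N ≤ n → b ℚ.≤ q n) → fromℚ b ≤ℝ x
Lim-lower {q} {x} {b} N lim le = fromℚ-≤ℝ {x} {b} λ ε 0<ε →
  let (M , at) = lim ε 0<ε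
      n = M ⊔ N
  in ≤ℝ-trans {fromℚ (b ℚ.- ε)} {fromℚ (q n ℚ.- ε)} {x}
       (fromℚ-mono-≤ (ℚₚ.+-monoˡ-≤ (ℚ.- ε) (le n (m≤n⊔m M N)))) (proj₁ (at n (m≤m⊔n M N)))

module Tree (em : ExcludedMiddle 0ℓ) (P : Pred Cantor 0ℓ) (P≢∅ : Satisfiable P)
            (closed : ∀ X → (∀ m → Classical.T em P (X ↾ m)) → X ∈ P) where
  open Classical em
  open Randomness em using (⟪_⟫; ⟪⟫⁺; ⟪⟫⁻; ⟪⟫-false⁻; by-contradiction; Compressed; inside)

  A : Oracle
  A = χ (T P)

  A⁺ : ∀ {σ} → T P σ → A σ ≡ true
  A⁺ = ⟪⟫⁺

  A⁻ : ∀ {σ} → A σ ≡ true → T P σ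
  A⁻ = ⟪⟫⁻

  t : String → ℕ
  t σ = length (bits A σ)

  t≤⌜⌝ : ∀ σ → t σ ≤ ⌜ σ ⌝
  t≤⌜⌝ σ = ≤-trans (length-bits≤ A σ) (length≤⌜⌝ σ)

  ν : String → ℚ
  ν σ = when (A σ) (½^ (t σ))

  ν-nonNeg : ∀ σ → 0ℚ ℚ.≤ ν σ
  ν-nonNeg σ = when-nonNeg (A σ) (½^-nonNeg (t σ))

  T-↾ : ∀ {X} → X ∈ P → ∀ m → T P (X ↾ m)
  T-↾ {X} X∈P m = X , X∈P , ↾-≺ X m

  T-prefix : ∀ {σ ρ} → T P (σ ++ ρ) → T P σ
  T-prefix {σ} (X , X∈P , σρ≺X) = X , X∈P , ≺-++ σ σρ≺X

  T-take : ∀ k {σ} → T P σ → T P (take k σ)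
  T-take k {σ} σ∈T with k ≤? length σ
  ... | no k≰ = subst (T P) (sym (take-all k σ (<⇒≤ (≰⇒> k≰)))) σ∈T
    where
    take-all : ∀ k (σ : String) → length σ ≤ k → take k σ ≡ σ
    take-all zero    []      _        = refl
    take-all (suc k) []      _        = refl
    take-all (suc k) (b ∷ σ) (s≤s le) = cong (b ∷_) (take-all k σ le)
  ... | yes k≤ = let (X , X∈P , σ≺X) = σ∈T in
    subst (T P) (trans (sym (take-↾ X k≤)) (cong (take k) σ≺X)) (T-↾ X∈P k)

  T-child : ∀ {σ} → T P σ → ∃[ b ] T P (σ ∷ʳ b)
  T-child {σ} (X , X∈P , σ≺X) = X (length σ) ,
    subst (T P) (trans (↾-suc X (length σ)) (cong (_∷ʳ X (length σ)) σ≺X)) (T-↾ X∈P (suc (length σ)))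

  t-∷ʳ : ∀ σ b → t (σ ∷ʳ b) ≡ t σ + bit (branches A σ)
  t-∷ʳ σ b = trans (cong length (bits-∷ʳ A σ b)) (length-extendIf (branches A σ) (bits A σ) b)

  -- A branching node gives half of its weight to each child, while a node with one child in T
  -- passes everything on. A node with no child in T is itself outside T.
  ν-additive : Additive ν
  ν-additive σ rewrite t-∷ʳ σ false | t-∷ʳ σ true with A (σ ∷ʳ false) in eq₀ | A (σ ∷ʳ true) in eq₁
  ... | true  | true  = trans (cong (λ b → when b (½^ (t σ))) (A⁺ (T-prefix {σ} (A⁻ eq₀))))
    (trans (sym (½+½ (½^ (t σ)))) (cong (λ k → ½^ k ℚ.+ ½^ k) (+-comm 1 (t σ))))
  ... | true  | false = trans (cong (λ b → when b (½^ (t σ))) (A⁺ (T-prefix {σ} (A⁻ eq₀))))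
    (trans (cong ½^ (sym (+-identityʳ (t σ)))) (sym (ℚₚ.+-identityʳ _)))
  ... | false | true  = trans (cong (λ b → when b (½^ (t σ))) (A⁺ (T-prefix {σ} (A⁻ eq₁))))
    (trans (cong ½^ (sym (+-identityʳ (t σ)))) (sym (ℚₚ.+-identityˡ _)))
  ... | false | false with A σ in eq
  ...   | false = sym (ℚₚ.+-identityˡ 0ℚ)
  ...   | true  with T-child (A⁻ eq)
  ...     | false , c = contradiction c (⟪⟫-false⁻ eq₀)
  ...     | true  , c = contradiction c (⟪⟫-false⁻ eq₁)

  A[] : A [] ≡ true
  A[] = let (X , X∈P) = P≢∅ in A⁺ {[]} (X , X∈P , refl)

  ν[] : ν [] ≡ 1ℚ
  ν[] = cong (λ b → when b 1ℚ) A[]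

  -- Links the proposition that defines Ψ to the pair of oracle queries that programs can make.
  Branching≡branches : ∀ σ → ⟪ Branching P σ ⟫ ≡ branches A σ
  Branching≡branches σ = bool-≡
    (λ eq → let (p , q) = ⟪⟫⁻ {Branching P σ} eq in cong₂ _∧_ (A⁺ p) (A⁺ q))
    (λ eq → let (p , q) = ∧-true⁻ (A (σ ∷ʳ false)) eq in ⟪⟫⁺ {Branching P σ} (A⁻ p , A⁻ q))

  bitsUsed≡t : ∀ σ → bitsUsed P σ ≡ t σ
  bitsUsed≡t σ = go (length σ)
    where
    go : ∀ k → length (filter (dec (λ j → take j σ ∈ Branching P)) (upTo k)) ≡ length (bitsTo A σ k)
    go zero    = refl
    go (suc k) = trans (count-suc (dec (λ j → take j σ ∈ Branching P)) id k)
      (trans (cong₂ _+_ (go k) (cong bit (Branching≡branches (take k σ))))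
             (sym (length-extendIf (branches A (take k σ)) (bitsTo A σ k) (nth σ k))))

  -- As σ ↾ (k + 1) is in T, its sibling is in T exactly when σ ↾ k branches.
  θ≡t : ∀ σ → T P σ → θ P σ ≡ t σ
  θ≡t σ σ∈T = go (length σ) ≤-refl
    where
    Flip : ℕ → Set
    Flip n = flipLast (take n σ) ∈ T P
    sibling : ∀ ρ b → T P (ρ ∷ʳ b) → ⟪ T P (ρ ∷ʳ not b) ⟫ ≡ branches A ρ
    sibling ρ false p = cong (_∧ A (ρ ∷ʳ true)) (sym (A⁺ p))
    sibling ρ true  p = bool-≡ (λ eq → cong₂ _∧_ eq (A⁺ p)) (λ eq → proj₁ (∧-true⁻ (A (ρ ∷ʳ false)) eq))
    flip : ∀ k → k < length σ → ⟪ Flip (suc k) ⟫ ≡ branches A (take k σ)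
    flip k k< = trans
      (cong (λ τ → ⟪ T P τ ⟫) (trans (cong flipLast (take-suc k σ k<)) (flipLast-∷ʳ (take k σ) (nth σ k))))
      (sibling (take k σ) (nth σ k) (subst (T P) (take-suc k σ k<) (T-take (suc k) σ∈T)))
    go : ∀ k → k ≤ length σ → length (filter (dec Flip) (applyUpTo suc k)) ≡ length (bitsTo A σ k)
    go zero    _  = refl
    go (suc k) k< = trans (count-suc (dec Flip) suc k)
      (trans (cong₂ _+_ (go k (<⇒≤ k<)) (cong bit (flip k k<)))
             (sym (length-extendIf (branches A (take k σ)) (bitsTo A σ k) (nth σ k))))

  -- Homogeneity and the size of the levels

  module Homogeneous (c : ℕ)
    (hom : ∀ n σ τ → σ ∈ Tlevel P n → τ ∈ Tlevel P n → ∣ θ P σ - θ P τ ∣ ≤ c) where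

    t-close : ∀ {σ τ} → T P σ → T P τ → length σ ≡ length τ → t σ ≤ t τ + c
    t-close {σ} {τ} σ∈T τ∈T eq = subst₂ (λ a b → a ≤ b + c) (θ≡t σ σ∈T) (θ≡t τ τ∈T)
      (≤-trans (m≤n+∣m-n∣ (θ P σ) (θ P τ))
               (+-monoʳ-≤ (θ P τ) (hom (length τ) σ τ (σ∈T , eq) (τ∈T , refl))))

    ½^t-lower : ∀ {σ τ} → T P σ → T P τ → length σ ≡ length τ → ½^ c ℚ.* ½^ (t τ) ℚ.≤ ½^ (t σ)
    ½^t-lower {σ} {τ} σ∈T τ∈T eq = ℚₚ.≤-trans (ℚₚ.≤-reflexive (sym (½^-+ c (t τ))))
      (½^-antitone (≤-trans (t-close σ∈T τ∈T eq) (≤-reflexive (+-comm (t τ) c))))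

    module _ (n : ℕ) {τ₀ : String} (τ₀∈T : T P τ₀) (len₀ : length τ₀ ≡ n) where
      private
        h = ½^ (t τ₀)
        κ = ½^ c

      -- A weighted count of the extensions of σ in T on level n: the weight q = 1 gives their
      -- number, q = 2^-n their Lebesgue measure.
      levelSum : String → ℚ → ℚ
      levelSum σ q = sum (strings n) λ τ → when (A τ ∧ isPrefix σ τ) q

      -- By homogeneity each node counted has ν at least κh, and by additivity their total is ν(σ).
      -- The lower bound uses in the same way that κν is at most h on the level.
      levelSum-upper : ∀ σ {q} → 0ℚ ℚ.≤ q → length σ ≤ n → levelSum σ q ℚ.* (κ ℚ.* h) ℚ.≤ q ℚ.* ν σ
      levelSum-upper σ {q} 0≤q le = begin
        levelSum σ q ℚ.* (κ ℚ.* h)  ≡⟨ ℚₚ.*-comm (levelSum σ q) (κ ℚ.* h) ⟩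
        (κ ℚ.* h) ℚ.* levelSum σ q  ≡⟨ sum-* (κ ℚ.* h) (strings n) _ ⟨
        sum (strings n) (λ τ → (κ ℚ.* h) ℚ.* when (A τ ∧ isPrefix σ τ) q)
          ≤⟨ sum-mono (strings n) (λ τ τ∈ → term τ (∈-strings⁻ n τ∈)) ⟩
        sum (strings n) (λ τ → q ℚ.* when (isPrefix σ τ) (ν τ))
          ≡⟨ sum-* q (strings n) _ ⟩
        q ℚ.* sum (strings n) (λ τ → when (isPrefix σ τ) (ν τ))
          ≡⟨ cong (q ℚ.*_) (sum-cone ν-additive n σ le) ⟩
        q ℚ.* ν σ ∎
        where
        open ℚₚ.≤-Reasoning
        term : ∀ τ → length τ ≡ n →
          (κ ℚ.* h) ℚ.* when (A τ ∧ isPrefix σ τ) q ℚ.≤ q ℚ.* when (isPrefix σ τ) (ν τ)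
        term τ len with A τ in eq | isPrefix σ τ
        ... | true  | true  = ℚₚ.≤-trans (*-monoʳ 0≤q (½^t-lower (A⁻ eq) τ₀∈T (trans len (sym len₀))))
                                         (ℚₚ.≤-reflexive (ℚₚ.*-comm (½^ (t τ)) q))
        ... | true  | false = ℚₚ.≤-reflexive (trans (ℚₚ.*-zeroʳ (κ ℚ.* h)) (sym (ℚₚ.*-zeroʳ q)))
        ... | false | true  = ℚₚ.≤-reflexive (trans (ℚₚ.*-zeroʳ (κ ℚ.* h)) (sym (ℚₚ.*-zeroʳ q)))
        ... | false | false = ℚₚ.≤-reflexive (trans (ℚₚ.*-zeroʳ (κ ℚ.* h)) (sym (ℚₚ.*-zeroʳ q)))

      levelSum-lower : ∀ σ {q} → 0ℚ ℚ.≤ q → length σ ≤ n → κ ℚ.* (q ℚ.* ν σ) ℚ.≤ levelSum σ q ℚ.* h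
      levelSum-lower σ {q} 0≤q le = begin
        κ ℚ.* (q ℚ.* ν σ)    ≡⟨ ℚₚ.*-assoc κ q (ν σ) ⟨
        (κ ℚ.* q) ℚ.* ν σ    ≡⟨ cong ((κ ℚ.* q) ℚ.*_) (sum-cone ν-additive n σ le) ⟨
        (κ ℚ.* q) ℚ.* sum (strings n) (λ τ → when (isPrefix σ τ) (ν τ))
          ≡⟨ sum-* (κ ℚ.* q) (strings n) _ ⟨
        sum (strings n) (λ τ → (κ ℚ.* q) ℚ.* when (isPrefix σ τ) (ν τ))
          ≤⟨ sum-mono (strings n) (λ τ τ∈ → term τ (∈-strings⁻ n τ∈)) ⟩
        sum (strings n) (λ τ → h ℚ.* when (A τ ∧ isPrefix σ τ) q)
          ≡⟨ sum-* h (strings n) _ ⟩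
        h ℚ.* levelSum σ q   ≡⟨ ℚₚ.*-comm h (levelSum σ q) ⟩
        levelSum σ q ℚ.* h   ∎
        where
        open ℚₚ.≤-Reasoning
        rearrange : ∀ a b d → (a ℚ.* b) ℚ.* d ≡ (a ℚ.* d) ℚ.* b
        rearrange = solve 3 (λ a b d → (a :* b) :* d := (a :* d) :* b) refl
          where open +-*-Solver
        term : ∀ τ → length τ ≡ n →
          (κ ℚ.* q) ℚ.* when (isPrefix σ τ) (ν τ) ℚ.≤ h ℚ.* when (A τ ∧ isPrefix σ τ) q
        term τ len with A τ in eq | isPrefix σ τ
        ... | true  | true  = ℚₚ.≤-trans (ℚₚ.≤-reflexive (rearrange κ q (½^ (t τ))))
          (*-monoʳ 0≤q (½^t-lower τ₀∈T (A⁻ eq) (trans len₀ (sym len))))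
        ... | true  | false = ℚₚ.≤-reflexive (trans (ℚₚ.*-zeroʳ (κ ℚ.* q)) (sym (ℚₚ.*-zeroʳ h)))
        ... | false | true  = ℚₚ.≤-reflexive (trans (ℚₚ.*-zeroʳ (κ ℚ.* q)) (sym (ℚₚ.*-zeroʳ h)))
        ... | false | false = ℚₚ.≤-reflexive (trans (ℚₚ.*-zeroʳ (κ ℚ.* q)) (sym (ℚₚ.*-zeroʳ h)))

      ι-#T : ι (#T P n) ≡ levelSum [] 1ℚ
      ι-#T = trans (ι-count (dec (Tlevel P n)) (strings n)) (sum-cong-∈ λ τ τ∈ →
        cong (λ b → when b 1ℚ) (bool-≡
          (λ eq → cong₂ _∧_ (A⁺ (proj₁ (⟪⟫⁻ {Tlevel P n τ} eq))) refl)
          (λ eq → ⟪⟫⁺ {Tlevel P n τ} (A⁻ (proj₁ (∧-true⁻ (A τ) eq)) , ∈-strings⁻ n τ∈))))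
        where
        sum-cong-∈ : ∀ {f g} → (∀ τ → τ ∈ˡ strings n → f τ ≡ g τ) → sum (strings n) f ≡ sum (strings n) g
        sum-cong-∈ eq = ℚₚ.≤-antisym (sum-mono (strings n) λ τ τ∈ → ℚₚ.≤-reflexive (eq τ τ∈))
                                     (sum-mono (strings n) λ τ τ∈ → ℚₚ.≤-reflexive (sym (eq τ τ∈)))

      #T-upper : #T P n ≤ 2 ^ (t τ₀ + c)
      #T-upper = ι-cancel-≤ (ℚₚ.*-cancelʳ-≤-pos (½^ (t τ₀ + c)) {{ℚ.positive (½^-pos (t τ₀ + c))}} (begin
        ι (#T P n) ℚ.* ½^ (t τ₀ + c)      ≡⟨ cong₂ ℚ._*_ ι-#T (trans (cong ½^ (+-comm (t τ₀) c)) (½^-+ c (t τ₀))) ⟩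
        levelSum [] 1ℚ ℚ.* (κ ℚ.* h)      ≤⟨ levelSum-upper [] (ℚₚ.nonNegative⁻¹ 1ℚ) z≤n ⟩
        1ℚ ℚ.* ν []                       ≡⟨ trans (ℚₚ.*-identityˡ (ν [])) ν[] ⟩
        1ℚ                                ≡⟨ ι-2^-½^ (t τ₀ + c) ⟨
        ι (2 ^ (t τ₀ + c)) ℚ.* ½^ (t τ₀ + c) ∎))
        where open ℚₚ.≤-Reasoning

      #T-lower : 2 ^ t τ₀ ≤ #T P n * 2 ^ c
      #T-lower = ι-cancel-≤ (ℚₚ.*-cancelʳ-≤-pos (½^ (c + t τ₀)) {{ℚ.positive (½^-pos (c + t τ₀))}} (begin
        ι (2 ^ t τ₀) ℚ.* ½^ (c + t τ₀)        ≡⟨ cong (λ k → ι (2 ^ t τ₀) ℚ.* ½^ k) (+-comm c (t τ₀)) ⟩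
        ι (2 ^ t τ₀) ℚ.* ½^ (t τ₀ + c)        ≡⟨ ι-2^-½^-+ (t τ₀) c ⟩
        κ                                     ≡⟨ ℚₚ.*-identityʳ κ ⟨
        κ ℚ.* 1ℚ                              ≡⟨ cong (κ ℚ.*_) (trans (ℚₚ.*-identityˡ (ν [])) ν[]) ⟨
        κ ℚ.* (1ℚ ℚ.* ν [])                   ≤⟨ levelSum-lower [] (ℚₚ.nonNegative⁻¹ 1ℚ) z≤n ⟩
        levelSum [] 1ℚ ℚ.* h                  ≡⟨ cong₂ ℚ._*_ (sym ι-#T) (sym (ι-2^-½^-+ c (t τ₀))) ⟩
        ι (#T P n) ℚ.* (ι (2 ^ c) ℚ.* ½^ (c + t τ₀)) ≡⟨ ℚₚ.*-assoc (ι (#T P n)) (ι (2 ^ c)) _ ⟨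
        ι (#T P n) ℚ.* ι (2 ^ c) ℚ.* ½^ (c + t τ₀)   ≡⟨ cong (ℚ._* ½^ (c + t τ₀)) (ι-* (#T P n) (2 ^ c)) ⟨
        ι (#T P n * 2 ^ c) ℚ.* ½^ (c + t τ₀)  ∎))
        where open ℚₚ.≤-Reasoning

-- The limiting relative measure and incompressibility in a homogeneous tree

-- Here x and y stand for the level sums over σ and over the root, q for the weight and v for ν(σ).
-- Both sums are known up to a factor κ, so their quotient is known up to κ², whose inverse is B;
-- the reference weight h cancels.
ratio-upper : ∀ {x y q v h κ B} → 0ℚ ℚ.≤ κ → 0ℚ ℚ.≤ v → 0ℚ ℚ.< (κ ℚ.* κ) ℚ.* h → B ℚ.* (κ ℚ.* κ) ≡ 1ℚ →
  x ℚ.* (κ ℚ.* h) ℚ.≤ q ℚ.* v → κ ℚ.* q ℚ.≤ y ℚ.* h → x ℚ.≤ (B ℚ.* v) ℚ.* y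
ratio-upper {x} {y} {q} {v} {h} {κ} {B} 0≤κ 0≤v 0<κκh Bκκ≡1 le le′ =
  ℚₚ.*-cancelʳ-≤-pos ((κ ℚ.* κ) ℚ.* h) {{ℚ.positive 0<κκh}} (begin
    x ℚ.* ((κ ℚ.* κ) ℚ.* h)                     ≡⟨ e₁ x κ h ⟩
    κ ℚ.* (x ℚ.* (κ ℚ.* h))                     ≤⟨ *-monoˡ 0≤κ le ⟩
    κ ℚ.* (q ℚ.* v)                             ≡⟨ e₂ κ q v ⟩
    v ℚ.* (κ ℚ.* q)                             ≤⟨ *-monoˡ 0≤v le′ ⟩
    v ℚ.* (y ℚ.* h)                             ≡⟨ ℚₚ.*-identityˡ (v ℚ.* (y ℚ.* h)) ⟨
    1ℚ ℚ.* (v ℚ.* (y ℚ.* h))                    ≡⟨ cong (ℚ._* (v ℚ.* (y ℚ.* h))) Bκκ≡1 ⟨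
    (B ℚ.* (κ ℚ.* κ)) ℚ.* (v ℚ.* (y ℚ.* h))     ≡⟨ e₃ B κ v y h ⟩
    ((B ℚ.* v) ℚ.* y) ℚ.* ((κ ℚ.* κ) ℚ.* h)     ∎)
  where
  open ℚₚ.≤-Reasoning
  open +-*-Solver
  e₁ : ∀ x κ h → x ℚ.* ((κ ℚ.* κ) ℚ.* h) ≡ κ ℚ.* (x ℚ.* (κ ℚ.* h))
  e₁ = solve 3 (λ x κ h → x :* ((κ :* κ) :* h) := κ :* (x :* (κ :* h))) refl
  e₂ : ∀ κ q v → κ ℚ.* (q ℚ.* v) ≡ v ℚ.* (κ ℚ.* q)
  e₂ = solve 3 (λ κ q v → κ :* (q :* v) := v :* (κ :* q)) refl
  e₃ : ∀ B κ v y h → (B ℚ.* (κ ℚ.* κ)) ℚ.* (v ℚ.* (y ℚ.* h)) ≡ ((B ℚ.* v) ℚ.* y) ℚ.* ((κ ℚ.* κ) ℚ.* h)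
  e₃ = solve 5 (λ B κ v y h → (B :* (κ :* κ)) :* (v :* (y :* h)) := ((B :* v) :* y) :* ((κ :* κ) :* h)) refl

ratio-lower : ∀ {x y q v h κ} → 0ℚ ℚ.≤ κ ℚ.* v → 0ℚ ℚ.< h →
  κ ℚ.* (q ℚ.* v) ℚ.≤ x ℚ.* h → y ℚ.* (κ ℚ.* h) ℚ.≤ q → ((κ ℚ.* κ) ℚ.* v) ℚ.* y ℚ.≤ x
ratio-lower {x} {y} {q} {v} {h} {κ} 0≤κv 0<h le le′ =
  ℚₚ.*-cancelʳ-≤-pos h {{ℚ.positive 0<h}} (begin
    (((κ ℚ.* κ) ℚ.* v) ℚ.* y) ℚ.* h      ≡⟨ e₁ κ v y h ⟩
    (κ ℚ.* v) ℚ.* (y ℚ.* (κ ℚ.* h))      ≤⟨ *-monoˡ 0≤κv le′ ⟩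
    (κ ℚ.* v) ℚ.* q                      ≡⟨ e₂ κ v q ⟩
    κ ℚ.* (q ℚ.* v)                      ≤⟨ le ⟩
    x ℚ.* h                              ∎)
  where
  open ℚₚ.≤-Reasoning
  open +-*-Solver
  e₁ : ∀ κ v y h → (((κ ℚ.* κ) ℚ.* v) ℚ.* y) ℚ.* h ≡ (κ ℚ.* v) ℚ.* (y ℚ.* (κ ℚ.* h))
  e₁ = solve 4 (λ κ v y h → (((κ :* κ) :* v) :* y) :* h := (κ :* v) :* (y :* (κ :* h))) refl
  e₂ : ∀ κ v q → (κ ℚ.* v) ℚ.* q ≡ κ ℚ.* (q ℚ.* v)
  e₂ = solve 3 (λ κ v q → (κ :* v) :* q := κ :* (q :* v)) refl

*-pos : ∀ {p q} → 0ℚ ℚ.< p → 0ℚ ℚ.< q → 0ℚ ℚ.< p ℚ.* q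
*-pos {p} {q} 0<p 0<q = subst (ℚ._< p ℚ.* q) (ℚₚ.*-zeroʳ p) (ℚₚ.*-monoʳ-<-pos p {{ℚ.positive 0<p}} 0<q)

module Bounds (em : ExcludedMiddle 0ℓ) (P : Pred Cantor 0ℓ) (P≢∅ : Satisfiable P)
  (closed : ∀ X → (∀ m → Classical.T em P (X ↾ m)) → X ∈ P) (c : ℕ)
  (hom : ∀ n σ τ → σ ∈ Classical.Tlevel em P n → τ ∈ Classical.Tlevel em P n →
         ∣ Classical.θ em P σ - Classical.θ em P τ ∣ ≤ c) where
  open Classical em
  open Randomness em using (⟪_⟫; ⟪⟫⁺; ⟪⟫⁻; ⟪⟫-false; ⟪⟫-false⁻; by-contradiction; Compressed; inside)
  open Tree em P P≢∅ closed
  open Homogeneous c hom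

  clopenLebesgue≡levelSum : ∀ n {τ₀} (τ₀∈T : T P τ₀) (len₀ : length τ₀ ≡ n) σ C → length σ ≤ n →
    (∀ τ → length τ ≡ n → (∀ {X} → X ∈ ⟦ τ ⟧ → X ∈ C) → T P τ × σ ≺ nth τ) →
    (∀ τ → length τ ≡ n → T P τ → (∀ {X} → X ∈ ⟦ τ ⟧ → σ ≺ X) → ∀ {X} → X ∈ ⟦ τ ⟧ → X ∈ C) →
    clopenLebesgue n C ≡ levelSum n τ₀∈T len₀ σ (½^ n)
  clopenLebesgue≡levelSum n τ₀∈T len₀ σ C le ⇒ ⇐ = begin
    clopenLebesgue n C
      ≡⟨ foldr≡sum (cylindersIn n C) (λ τ → ½^ (length τ)) ⟩
    sum (cylindersIn n C) (λ τ → ½^ (length τ))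
      ≡⟨ sum-filter (dec λ τ → ∀ {X} → X ∈ ⟦ τ ⟧ → X ∈ C) (strings n) (λ τ → ½^ (length τ)) ⟩
    sum (strings n) (λ τ → when (inside C τ) (½^ (length τ)))
      ≡⟨ ℚₚ.≤-antisym (sum-mono (strings n) λ τ τ∈ → ℚₚ.≤-reflexive (same τ (∈-strings⁻ n τ∈)))
                      (sum-mono (strings n) λ τ τ∈ → ℚₚ.≤-reflexive (sym (same τ (∈-strings⁻ n τ∈)))) ⟩
    levelSum n τ₀∈T len₀ σ (½^ n) ∎
    where
    open ≡-Reasoning
    same : ∀ τ → length τ ≡ n → when (inside C τ) (½^ (length τ)) ≡ when (A τ ∧ isPrefix σ τ) (½^ n)
    same τ len = cong₂ when (bool-≡
        (λ eq → let (τ∈T , σ≺) = ⇒ τ len (⟪⟫⁻ {∀ {X} → X ∈ ⟦ τ ⟧ → X ∈ C} eq) in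
          cong₂ _∧_ (A⁺ τ∈T) (isPrefix⁺ σ τ σ≺ (≺-nth τ) (≤-trans le (≤-reflexive (sym len)))))
        (λ eq → let (a , p) = ∧-true⁻ (A τ) eq in ⟪⟫⁺ {∀ {X} → X ∈ ⟦ τ ⟧ → X ∈ C}
          (⇐ τ len (A⁻ a) λ τ≺X → proj₁ (isPrefix⁻ σ τ p τ≺X))))
      (cong ½^ len)

  inLevel : ∀ n τ → length τ ≡ n → (nth τ) ∈ ⟦ Tlevel P n ⟧ˢ → T P τ
  inLevel n τ len (ρ , (ρ∈T , len′) , ρ≺) =
    subst (T P) (≺-comparable ρ≺ (≺-nth τ) (trans len′ (sym len))) ρ∈T

  private
    X₀ : Cantor
    X₀ = proj₁ P≢∅
    X₀∈T : ∀ n → T P (X₀ ↾ n)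
    X₀∈T = T-↾ (proj₂ P≢∅)
    κ : ℚ
    κ = ½^ c
    h : ℕ → ℚ
    h n = ½^ (t (X₀ ↾ n))

    level : ℕ → String → ℚ
    level n σ = levelSum n (X₀∈T n) (length-↾ X₀ n) σ (½^ n)

    numerator : ∀ σ n → length σ ≤ n → clopenLebesgue (n ⊔ length σ) (⟦ σ ⟧ ∩ ⟦ Tlevel P n ⟧ˢ) ≡ level n σ
    numerator σ n le = trans (cong (λ k → clopenLebesgue k (⟦ σ ⟧ ∩ ⟦ Tlevel P n ⟧ˢ)) (m≥n⇒m⊔n≡m le))
      (clopenLebesgue≡levelSum n (X₀∈T n) (length-↾ X₀ n) σ (⟦ σ ⟧ ∩ ⟦ Tlevel P n ⟧ˢ) le
        (λ τ len τ⊆ → let (σ≺ , lvl) = τ⊆ {nth τ} (≺-nth τ) in inLevel n τ len lvl , σ≺)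
        (λ τ len τ∈T σ≺ {X} τ≺X → σ≺ τ≺X , (τ , (τ∈T , len) , τ≺X)))

    denominator : ∀ n → clopenLebesgue n ⟦ Tlevel P n ⟧ˢ ≡ level n []
    denominator n = clopenLebesgue≡levelSum n (X₀∈T n) (length-↾ X₀ n) [] ⟦ Tlevel P n ⟧ˢ z≤n
      (λ τ len τ⊆ → inLevel n τ len (τ⊆ {nth τ} (≺-nth τ)) , refl)
      (λ τ len τ∈T _ {X} τ≺X → τ , (τ∈T , len) , τ≺X)

    level-upper : ∀ n → level n [] ℚ.* (κ ℚ.* h n) ℚ.≤ ½^ n
    level-upper n = ℚₚ.≤-trans (levelSum-upper n (X₀∈T n) (length-↾ X₀ n) [] (½^-nonNeg n) z≤n)
      (ℚₚ.≤-reflexive (trans (cong (½^ n ℚ.*_) ν[]) (ℚₚ.*-identityʳ (½^ n))))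

    level-lower : ∀ n → κ ℚ.* ½^ n ℚ.≤ level n [] ℚ.* h n
    level-lower n = ℚₚ.≤-trans
      (ℚₚ.≤-reflexive (cong (κ ℚ.*_) (sym (trans (cong (½^ n ℚ.*_) ν[]) (ℚₚ.*-identityʳ (½^ n))))))
      (levelSum-lower n (X₀∈T n) (length-↾ X₀ n) [] (½^-nonNeg n) z≤n)

    level-pos : ∀ n → 0ℚ ℚ.< level n []
    level-pos n = ℚₚ.*-cancelʳ-<-nonNeg (h n) {{ℚ.nonNegative (½^-nonNeg (t (X₀ ↾ n)))}}
      (ℚₚ.<-≤-trans (subst (ℚ._< κ ℚ.* ½^ n) (sym (ℚₚ.*-zeroˡ (h n))) (*-pos (½^-pos c) (½^-pos n)))
                    (level-lower n))

  relativeMeasure-upper : ∀ σ n → length σ ≤ n → relativeMeasure P σ n ℚ.≤ ι (2 ^ (c + c)) ℚ.* ν σ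
  relativeMeasure-upper σ n le = subst₂ (λ x y → x ÷₀ y ℚ.≤ ι (2 ^ (c + c)) ℚ.* ν σ)
    (sym (numerator σ n le)) (sym (denominator n))
    (÷₀-≤ (level-pos n) (ratio-upper {level n σ} {level n []} {½^ n} {ν σ} {h n} {κ} {ι (2 ^ (c + c))}
      (½^-nonNeg c) (ν-nonNeg σ) (*-pos (*-pos (½^-pos c) (½^-pos c)) (½^-pos (t (X₀ ↾ n))))
      (trans (cong (ι (2 ^ (c + c)) ℚ.*_) (sym (½^-+ c c))) (ι-2^-½^ (c + c)))
      (levelSum-upper n (X₀∈T n) (length-↾ X₀ n) σ (½^-nonNeg n) le) (level-lower n)))

  relativeMeasure-lower : ∀ σ n → length σ ≤ n → ½^ (c + c) ℚ.* ν σ ℚ.≤ relativeMeasure P σ n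
  relativeMeasure-lower σ n le = subst₂ (λ x y → ½^ (c + c) ℚ.* ν σ ℚ.≤ x ÷₀ y)
    (sym (numerator σ n le)) (sym (denominator n))
    (≤-÷₀ (level-pos n) (subst (λ k → (k ℚ.* ν σ) ℚ.* level n [] ℚ.≤ level n σ) (sym (½^-+ c c))
      (ratio-lower {level n σ} {level n []} {½^ n} {ν σ} {h n} {κ}
        (*-nonNeg (½^-nonNeg c) (ν-nonNeg σ)) (½^-pos (t (X₀ ↾ n)))
        (levelSum-lower n (X₀∈T n) (length-↾ X₀ n) σ (½^-nonNeg n) le) (level-upper n))))

  ν-outside : ∀ {σ} → ¬ T P σ → ν σ ≡ 0ℚ
  ν-outside {σ} σ∉T = cong (λ b → when b (½^ (t σ))) (⟪⟫-false σ∉T)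

  module _ (defined : LimitingRelativeMeasureDefined P) where

    limitingRelativeMeasure-cases : ∀ (Q : ℝ → Set) σ → (∀ σ∈T → Q (proj₁ (defined σ σ∈T))) →
      (¬ T P σ → Q (fromℚ 0ℚ)) → Q (limitingRelativeMeasure P defined σ)
    limitingRelativeMeasure-cases Q σ q₁ q₀ with dec (T P) σ
    ... | yes σ∈T = q₁ σ∈T
    ... | no  σ∉T = q₀ σ∉T

    limitingRelativeMeasure-upper : ∀ σ →
      limitingRelativeMeasure P defined σ ≤ℝ fromℚ (ι (2 ^ (c + c)) ℚ.* ν σ)
    limitingRelativeMeasure-upper σ = limitingRelativeMeasure-cases (λ x → x ≤ℝ fromℚ (ι (2 ^ (c + c)) ℚ.* ν σ)) σ
      (λ σ∈T → Lim-upper {relativeMeasure P σ} {proj₁ (defined σ σ∈T)} (length σ) (proj₂ (defined σ σ∈T))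
                 (relativeMeasure-upper σ))
      (λ σ∉T → fromℚ-mono-≤ (*-nonNeg (ι-nonNeg (2 ^ (c + c))) (ν-nonNeg σ)))

    limitingRelativeMeasure-lower : ∀ σ →
      fromℚ (½^ (c + c) ℚ.* ν σ) ≤ℝ limitingRelativeMeasure P defined σ
    limitingRelativeMeasure-lower σ = limitingRelativeMeasure-cases (λ x → fromℚ (½^ (c + c) ℚ.* ν σ) ≤ℝ x) σ
      (λ σ∈T → Lim-lower {relativeMeasure P σ} {proj₁ (defined σ σ∈T)} (length σ) (proj₂ (defined σ σ∈T))
                 (relativeMeasure-lower σ))
      (λ σ∉T → fromℚ-mono-≤ (ℚₚ.≤-reflexive
        (trans (cong (½^ (c + c) ℚ.*_) (ν-outside σ∉T)) (ℚₚ.*-zeroʳ (½^ (c + c))))))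

  -- `Incompressible` speaks only of actual values of K, so a short description has to be traded for
  -- a shortest one.
  K-exists : ∀ {U σ} τ → A ⊢ U ⟨ τ ⟩≃ σ → ∃[ k ] k ≤ length τ × K A U σ k
  K-exists {U} {σ} τ d = go (length τ) τ d ≤-refl
    where
    go : ∀ b τ → A ⊢ U ⟨ τ ⟩≃ σ → length τ ≤ b → ∃[ k ] k ≤ length τ × K A U σ k
    go b τ d le with em {∃[ ρ ] A ⊢ U ⟨ ρ ⟩≃ σ × length ρ < length τ}
    ... | no minimal = length τ , ≤-refl , (τ , d , refl) ,
      λ ρ e → ≮⇒≥ λ lt → minimal (ρ , e , lt)
    go zero    τ d le | yes (ρ , e , lt) = contradiction (<-≤-trans lt le) λ ()
    go (suc b) τ d le | yes (ρ , e , lt) =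
      let (k , k≤ , isK) = go b ρ e (s≤s⁻¹ (<-≤-trans lt le)) in k , ≤-trans k≤ (<⇒≤ lt) , isK

  2^-cancel-≤ : ∀ {m n} → 2 ^ m ≤ 2 ^ n → m ≤ n
  2^-cancel-≤ {m} {n} le with m ≤? n
  ... | yes m≤n = m≤n
  ... | no  m≰n = contradiction (≤-<-trans le (^-monoʳ-< 2 (s≤s (s≤s z≤n)) (≰⇒> m≰n))) (<-irrefl refl)

  module _ {U : Rec 1} {X : Cantor} (X∈P : X ∈ P) where

    Incompressible⇒¬Compressed : Incompressible P U X → ∃[ d ] ¬ Compressed A U t X d
    -- The constant d comes from incompressibility and c from 2^t ≤ #T · 2^c; the extra 1 makes the
    -- resulting inequality strict, hence absurd.
    Incompressible⇒¬Compressed (d , inc) = suc (d + c) , λ (m , τ , e , le) →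
      let (k , k≤ , isK) = K-exists {U} {X ↾ m} τ e
          bound : 2 ^ t (X ↾ m) ≤ 2 ^ (k + d + c)
          bound = ≤-trans (#T-lower m (T-↾ X∈P m) (length-↾ X m))
            (≤-trans (*-monoˡ-≤ (2 ^ c) (inc m k isK)) (≤-reflexive (sym (^-distribˡ-+-* 2 (k + d) c))))
      in <-irrefl refl (≤-trans (≤-reflexive (sym (+-suc (length τ) (d + c)))) (≤-trans le
           (≤-trans (2^-cancel-≤ bound) (≤-trans (≤-reflexive (+-assoc k d c)) (+-monoˡ-≤ (d + c) k≤)))))

    ¬Compressed⇒Incompressible : ∃[ d ] ¬ Compressed A U t X d → Incompressible P U X
    ¬Compressed⇒Incompressible (d , inc) = d + c , λ n k → λ { ((τ , e , refl) , _) →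
      let t≤ : t (X ↾ n) ≤ length τ + d
          t≤ = <⇒≤ (≰⇒> λ le → inc (n , τ , e , le))
      in ≤-trans (#T-upper n (T-↾ X∈P n) (length-↾ X n))
           (^-monoʳ-≤ 2 (≤-trans (+-monoˡ-≤ c t≤) (≤-reflexive (+-assoc (length τ) d c)))) }

-- Randomly produced paths

≺-∷ʳ : ∀ {ρ R} → ρ ≺ R → ρ ∷ʳ R (length ρ) ≺ R
≺-∷ʳ {ρ} {R} ρ≺R = trans (cong (R ↾_) (length-∷ʳ ρ (R (length ρ))))
  (trans (↾-suc R (length ρ)) (cong (_∷ʳ R (length ρ)) ρ≺R))

≺-nth≡ : ∀ {ρ R k} → ρ ≺ R → k < length ρ → nth ρ k ≡ R k
≺-nth≡ {ρ} {R} {k} ρ≺R k< = trans (cong (λ σ → nth σ k) (sym ρ≺R)) (nth-↾ R k<)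

≺-last : ∀ {ρ b R} → ρ ∷ʳ b ≺ R → R (length ρ) ≡ b
≺-last {ρ} {b} ρb≺R = trans
  (sym (≺-nth≡ ρb≺R (≤-reflexive (sym (length-∷ʳ ρ b))))) (nth-∷ʳ-last ρ b)

≺-intro : ∀ ρ {R} → (∀ k → k < length ρ → R k ≡ nth ρ k) → ρ ≺ R
≺-intro []      eq = refl
≺-intro (b ∷ ρ) eq = cong₂ _∷_ (eq 0 (s≤s z≤n)) (≺-intro ρ λ k k< → eq (suc k) (s≤s k<))

module RandomPaths (em : ExcludedMiddle 0ℓ) (P : Pred Cantor 0ℓ) (P≢∅ : Satisfiable P)
  (closed : ∀ X → (∀ m → Classical.T em P (X ↾ m)) → X ∈ P) where
  open Classical em
  open Randomness em using (⟪_⟫; ⟪⟫⁺; ⟪⟫⁻; ⟪⟫-false; ⟪⟫-false⁻; by-contradiction; ¬∀⇒∃¬; inside;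
    cylinderSum; cylinderSum-*; measure-lower; measure-upper; Compressed; incompressible⇒random)
  open Tree em P P≢∅ closed
  open StringComputability A

  bits-↾ : ∀ X m → bits A (X ↾ suc m) ≡ extendIf (branches A (X ↾ m)) (bits A (X ↾ m)) (X m)
  bits-↾ X m = trans (cong (bits A) (↾-suc X m)) (bits-∷ʳ A (X ↾ m) (X m))

  bits-↾-≺ : ∀ X {m m′ R} → m ≤ m′ → bits A (X ↾ m′) ≺ R → bits A (X ↾ m) ≺ R
  bits-↾-≺ X {m} {m′} {R} m≤m′ = go (m′ ∸ m) ∘ subst (λ k → bits A (X ↾ k) ≺ R) (sym (m∸n+n≡m m≤m′))
    where
    drop-last : ∀ b {ρ c} → extendIf b ρ c ≺ R → ρ ≺ R
    drop-last true  {ρ} ≺R = ≺-++ ρ ≺R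
    drop-last false     ≺R = ≺R
    go : ∀ k → bits A (X ↾ (k + m)) ≺ R → bits A (X ↾ m) ≺ R
    go zero    ≺R = ≺R
    go (suc k) ≺R = go k (drop-last (branches A (X ↾ (k + m))) (subst (_≺ R) (bits-↾ X (k + m)) ≺R))

  t-↾-suc : ∀ X m → t (X ↾ suc m) ≡ t (X ↾ m) + bit (branches A (X ↾ m))
  t-↾-suc X m = trans (cong length (bits-↾ X m)) (length-extendIf (branches A (X ↾ m)) (bits A (X ↾ m)) (X m))

  t-↾-mono : ∀ X {m m′} → m ≤ m′ → t (X ↾ m) ≤ t (X ↾ m′)
  t-↾-mono X {m} {m′} m≤m′ = subst (λ k → t (X ↾ m) ≤ t (X ↾ k)) (m∸n+n≡m m≤m′) (go (m′ ∸ m))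
    where
    go : ∀ k → t (X ↾ m) ≤ t (X ↾ (k + m))
    go zero    = ≤-refl
    go (suc k) = ≤-trans (go k) (≤-trans (m≤m+n _ _) (≤-reflexive (sym (t-↾-suc X (k + m)))))

  -- At most one bit is added per step, so no value is skipped. Hence an initial segment of R is
  -- exactly the bits of some X ↾ m′, as soon as X has used that many.
  t-↾-intermediate : ∀ X m k → k ≤ t (X ↾ m) → ∃[ m′ ] t (X ↾ m′) ≡ k
  t-↾-intermediate X zero    k k≤ = 0 , sym (n≤0⇒n≡0 k≤)
  t-↾-intermediate X (suc m) k k≤ with k ≤? t (X ↾ m)
  ... | yes k≤′ = t-↾-intermediate X m k k≤′
  ... | no  k≰  = suc m , ≤-antisym
    (≤-trans (≤-reflexive (t-↾-suc X m))
      (≤-trans (+-monoʳ-≤ (t (X ↾ m)) (bit≤1 (branches A (X ↾ m)))) (≤-trans (≤-reflexive (+-comm (t (X ↾ m)) 1)) (≰⇒> k≰)))) k≤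
    where
    bit≤1 : ∀ b → bit b ≤ 1
    bit≤1 true  = ≤-refl
    bit≤1 false = z≤n

  Ψ↾≡ : ∀ R m → Ψ↾ P R m ≡ Ψ P R ↾ m
  Ψ↾≡ R zero    = refl
  Ψ↾≡ R (suc m) = trans (cong (_∷ʳ Ψ P R m) (Ψ↾≡ R m)) (sym (↾-suc (Ψ P R) m))

  nextBit≡ : ∀ R σ → nextBit P R σ ≡ (if branches A σ then R (t σ) else A (σ ∷ʳ true))
  nextBit≡ R σ = cong₂ (λ b k → if b then R k else A (σ ∷ʳ true)) (Branching≡branches σ) (bitsUsed≡t σ)

  bits-Ψ↾ : ∀ R m → bits A (Ψ↾ P R m) ≺ R
  bits-Ψ↾ R zero    = refl
  bits-Ψ↾ R (suc m) = subst (_≺ R) (sym (bits-∷ʳ A σ (nextBit P R σ))) (step (branches A σ) refl)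
    where
    σ = Ψ↾ P R m
    step : ∀ b → branches A σ ≡ b → extendIf b (bits A σ) (nextBit P R σ) ≺ R
    step false _  = bits-Ψ↾ R m
    step true  eq = subst (λ b → bits A σ ∷ʳ b ≺ R)
      (sym (trans (nextBit≡ R σ) (cong (λ b → if b then R (t σ) else A (σ ∷ʳ true)) eq)))
      (≺-∷ʳ {bits A σ} (bits-Ψ↾ R m))

  bits-Ψ : ∀ R m → bits A (Ψ P R ↾ m) ≺ R
  bits-Ψ R m = subst (λ σ → bits A σ ≺ R) (Ψ↾≡ R m) (bits-Ψ↾ R m)

  nextBit-follows : ∀ R σ b → T P (σ ∷ʳ b) → bits A (σ ∷ʳ b) ≺ R → nextBit P R σ ≡ b
  nextBit-follows R σ b σb∈T bits≺R = trans (nextBit≡ R σ) (cases (branches A σ) refl)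
    where
    only : ∀ b → T P (σ ∷ʳ b) → branches A σ ≡ false → A (σ ∷ʳ true) ≡ b
    only true  p _  = A⁺ p
    only false p eq = trans (cong (_∧ A (σ ∷ʳ true)) (sym (A⁺ p))) eq
    cases : ∀ d → branches A σ ≡ d → (if d then R (t σ) else A (σ ∷ʳ true)) ≡ b
    cases true  eq = ≺-last {bits A σ} (subst (_≺ R)
      (trans (bits-∷ʳ A σ b) (cong (λ d → extendIf d (bits A σ) b) eq)) bits≺R)
    cases false eq = only b σb∈T eq

  -- At a branching node Ψ copies R, which agrees there with X; at any other node on the way X takes
  -- the only child in T.
  Ψ-follows : ∀ R X m → T P (X ↾ m) → bits A (X ↾ m) ≺ R → Ψ↾ P R m ≡ X ↾ m
  Ψ-follows R X zero    _   _ = refl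
  Ψ-follows R X (suc m) X∈T ≺R = trans
    (cong₂ _∷ʳ_ previous (trans (cong (nextBit P R) previous)
      (nextBit-follows R (X ↾ m) (X m) X′∈T (subst (λ σ → bits A σ ≺ R) (↾-suc X m) ≺R))))
    (sym (↾-suc X m))
    where
    X′∈T : T P (X ↾ m ∷ʳ X m)
    X′∈T = subst (T P) (↾-suc X m) X∈T
    previous : Ψ↾ P R m ≡ X ↾ m
    previous = Ψ-follows R X m (T-prefix {X ↾ m} X′∈T) (bits-↾-≺ X (n≤1+n m) ≺R)

  Ψ-produces : ∀ {R X} → X ∈ P → (∀ m → bits A (X ↾ m) ≺ R) → X ≗ Ψ P R
  Ψ-produces {R} {X} X∈P ≺R m = sym (trans
    (cong (nextBit P R) (Ψ-follows R X m (T-↾ X∈P m) (≺R m)))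
    (nextBit-follows R (X ↾ m) (X m) (subst (T P) (↾-suc X m) (T-↾ X∈P (suc m)))
      (subst (λ σ → bits A σ ≺ R) (↾-suc X m) (≺R (suc m)))))

  Ψ-follows-string : ∀ R τ → T P τ → bits A τ ≺ R → Ψ P R ↾ length τ ≡ τ
  Ψ-follows-string R τ τ∈T ≺R = trans (sym (Ψ↾≡ R (length τ))) (trans
    (Ψ-follows R (nth τ) (length τ) (subst (T P) (sym (≺-nth τ)) τ∈T)
      (subst (λ σ → bits A σ ≺ R) (sym (≺-nth τ)) ≺R)) (≺-nth τ))

  -- U followed by `bits` halts only where U does and so is a prefix-free machine. Thus bits(X ↾ m),
  -- the initial segment of R of length t(X ↾ m), costs at most a constant more than X ↾ m.
  produced⇒¬Compressed : ∀ {U R X} → OptimalPrefixFree A U → X ≗ Ψ P R →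
    (∃[ d ] ¬ Compressed A U length R d) → ∃[ d ] ¬ Compressed A U t X d
  produced⇒¬Compressed {U} {R} {X} (U-prefixFree , optimal) X≗ΨR (n , inc) =
    let (d , better) = optimal M M-prefixFree in d + n , λ (m , τ , e , le) →
      let β = bits A (X ↾ m)
          (τ′ , e′ , le′) = better τ β (M-computes {τ} {X ↾ m} e)
          β≺R = subst (λ σ → bits A σ ≺ R) (sym (↾-cong X≗ΨR m)) (bits-Ψ R m)
      in inc (length β , τ′ , subst (A ⊢ U ⟨ τ′ ⟩≃_) (sym β≺R) e′ ,
              ≤-trans (+-monoˡ-≤ n le′) (≤-trans (≤-reflexive (+-assoc (length τ) d n))
                (≤-trans le (≤-reflexive (cong length (sym β≺R))))))
    where
    bitsCode : Computable {1} (λ xs → ⌜ bits A (decode (head xs)) ⌝)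
    bitsCode = code (bitsᶜ (decodeᶜ (headᶜ idᵛ)))
    M : Rec 1
    M = comp (program bitsCode) (U ∷ [])
    M-prefixFree : PrefixFree A M
    M-prefixFree (comp⇓ (h ∷ []) _) (comp⇓ (h′ ∷ []) _) = U-prefixFree h h′
    M-computes : ∀ {τ σ} → A ⊢ U ⟨ τ ⟩≃ σ → A ⊢ M ⟨ τ ⟩≃ bits A σ
    M-computes {τ} {σ} e = comp⇓ (e ∷ []) (subst (λ ρ → A ⊢ program bitsCode [ ⌜ σ ⌝ ∷ [] ]⇓ ⌜ bits A ρ ⌝)
      (decode⌜⌝ σ) (computes bitsCode (⌜ σ ⌝ ∷ [])))

  module _ (C : ℕ) (e : Rec 2) where
    private
      arguments : ComputableVec {2} (λ xs → head xs + C ∷ ⌜ bits A (decode (head (tail xs))) ⌝ ∷ [])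
      arguments = (headᶜ idᵛ +ᶜ constᶜ C) ∷ᵛ code (bitsᶜ (decodeᶜ (headᶜ (tailᵛ idᵛ)))) ∷ᵛ []ᵛ

    abstract
      -- The shift of the index by C compensates the factor 2^C by which μ may exceed ν.
      pullback : Rec 2
      pullback = comp e (programs arguments)

      pullback⁻ : ∀ n σ → W A pullback n σ → W A e (n + C) (bits A σ)
      pullback⁻ n σ (y , d) = y , subst (λ ρ → A ⊢ e [ n + C ∷ ⌜ bits A ρ ⌝ ∷ [] ]⇓ y)
        (decode⌜⌝ σ) (comp-total⁻ arguments d)

      pullback⁺ : ∀ n σ → W A e (n + C) (bits A σ) → W A pullback n σ
      pullback⁺ n σ (y , d) = y , comp-total⁺ arguments
        (subst (λ ρ → A ⊢ e [ n + C ∷ ⌜ bits A ρ ⌝ ∷ [] ]⇓ y) (sym (decode⌜⌝ σ)) d)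

    -- Ψ(R) extends τ, hence has an initial segment in the pulled-back set, and the bits of that
    -- segment begin R.
    pullback-inside : ∀ n τ → T P τ → inside ⟦ W A pullback n ⟧ˢ τ ≡ true →
      ∀ {R} → bits A τ ≺ R → R ∈ ⟦ W A e (n + C) ⟧ˢ
    pullback-inside n τ τ∈T eq {R} ≺R =
      let (σ , w , σ≺) = ⟪⟫⁻ {∀ {X} → X ∈ ⟦ τ ⟧ → X ∈ ⟦ W A pullback n ⟧ˢ} eq {Ψ P R} (Ψ-follows-string R τ τ∈T ≺R)
      in bits A σ , pullback⁻ n σ w , subst (λ ρ → bits A ρ ≺ R) σ≺ (bits-Ψ R (length σ))

    -- For τ in T, ν(τ) is the Lebesgue measure of the cylinder of bits(τ). For different τ of
    -- length m these cylinders are disjoint, because Ψ recovers τ from any point of its cylinder.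
    pullback-measure : ∀ n m → cylinderSum ν m ⟦ W A pullback n ⟧ˢ ℚ.≤
      cylinderSum (λ σ → ½^ (length σ)) m ⟦ W A e (n + C) ⟧ˢ
    pullback-measure n m = double-count (strings m) (strings m) w rows columns
      where
      V = ⟦ W A pullback n ⟧ˢ
      V′ = ⟦ W A e (n + C) ⟧ˢ
      B : String → String → Bool
      B τ ρ = (inside V τ ∧ A τ) ∧ isPrefix (bits A τ) ρ
      w : String → String → ℚ
      w τ ρ = when (B τ ρ) (½^ (length ρ))
      row : ∀ τ a b → length τ ≡ m → when a (when b (½^ (t τ))) ℚ.≤
        sum (strings m) (λ ρ → when ((a ∧ b) ∧ isPrefix (bits A τ) ρ) (½^ (length ρ)))
      row τ true  true  len = ℚₚ.≤-reflexive (sym (sum-cone ½^length-additive m (bits A τ)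
        (≤-trans (length-bits≤ A τ) (≤-reflexive len))))
      row τ true  false len = ℚₚ.≤-reflexive (sym (sum-0 (strings m)))
      row τ false b     len = ℚₚ.≤-reflexive (sym (sum-0 (strings m)))
      rows : ∀ τ → τ ∈ˡ strings m → when (inside V τ) (ν τ) ℚ.≤ sum (strings m) (w τ)
      rows τ τ∈ = row τ (inside V τ) (A τ) (∈-strings⁻ m τ∈)
      B⁻ : ∀ τ ρ → B τ ρ ≡ true → inside V τ ≡ true × T P τ × isPrefix (bits A τ) ρ ≡ true
      B⁻ τ ρ eq = let (p , q) = ∧-true⁻ (inside V τ ∧ A τ) eq
                      (i , a) = ∧-true⁻ (inside V τ) p in i , A⁻ a , q
      follows : ∀ τ ρ → τ ∈ˡ strings m → B τ ρ ≡ true → Ψ P (nth ρ) ↾ m ≡ τ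
      follows τ ρ τ∈ eq = let (_ , τ∈T , q) = B⁻ τ ρ eq in
        subst (λ k → Ψ P (nth ρ) ↾ k ≡ τ) (∈-strings⁻ m τ∈)
          (Ψ-follows-string (nth ρ) τ τ∈T (proj₁ (isPrefix⁻ (bits A τ) ρ q (≺-nth ρ))))
      insideV′ : ∀ τ ρ → B τ ρ ≡ true → inside V′ ρ ≡ true
      insideV′ τ ρ eq = let (i , τ∈T , q) = B⁻ τ ρ eq in
        ⟪⟫⁺ {∀ {X} → X ∈ ⟦ ρ ⟧ → X ∈ V′} λ ρ≺R →
          pullback-inside n τ τ∈T i (proj₁ (isPrefix⁻ (bits A τ) ρ q ρ≺R))
      columns : ∀ ρ → ρ ∈ˡ strings m → sum (strings m) (λ τ → w τ ρ) ℚ.≤ when (inside V′ ρ) (½^ (length ρ))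
      columns ρ _ = sum-atMostOne (strings-unique m) (λ τ → B τ ρ)
        (when-nonNeg (inside V′ ρ) (½^-nonNeg (length ρ)))
        (λ τ τ′ τ∈ τ′∈ p q → trans (sym (follows τ ρ τ∈ p)) (follows τ′ ρ τ′∈ q))
        (λ τ _ eq → ℚₚ.≤-reflexive (cong (λ b → when b (½^ (length ρ))) (sym (insideV′ τ ρ eq))))

    pullback-MLTest : ∀ {μ ℓ} → (∀ σ → μ σ ≤ℝ fromℚ (ι (2 ^ C) ℚ.* ν σ)) →
      (∀ σ → fromℚ (½^ (length σ)) ≤ℝ ℓ σ) → MLTest A ℓ e → MLTest A μ pullback
    pullback-MLTest {μ} {ℓ} upper lower test n =
      measure-upper {μ} {λ σ → ι (2 ^ C) ℚ.* ν σ} {½^ n} {⟦ W A pullback n ⟧ˢ} upper λ m → begin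
        cylinderSum (λ σ → ι (2 ^ C) ℚ.* ν σ) m ⟦ W A pullback n ⟧ˢ
          ≡⟨ cylinderSum-* (ι (2 ^ C)) ν m ⟦ W A pullback n ⟧ˢ ⟩
        ι (2 ^ C) ℚ.* cylinderSum ν m ⟦ W A pullback n ⟧ˢ
          ≤⟨ *-monoˡ (ι-nonNeg (2 ^ C)) (pullback-measure n m) ⟩
        ι (2 ^ C) ℚ.* cylinderSum (λ σ → ½^ (length σ)) m ⟦ W A e (n + C) ⟧ˢ
          ≤⟨ *-monoˡ (ι-nonNeg (2 ^ C)) (measure-lower {ℓ} {λ σ → ½^ (length σ)} {½^ (n + C)} {⟦ W A e (n + C) ⟧ˢ}
               lower (test (n + C)) m) ⟩
        ι (2 ^ C) ℚ.* ½^ (n + C)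
          ≡⟨ cong (λ k → ι (2 ^ C) ℚ.* ½^ k) (+-comm n C) ⟩
        ι (2 ^ C) ℚ.* ½^ (C + n)
          ≡⟨ ι-2^-½^-+ C n ⟩
        ½^ n ∎
      where open ℚₚ.≤-Reasoning

  unbounded-MLR : ∀ C {μ ℓ X R} → (∀ σ → μ σ ≤ℝ fromℚ (ι (2 ^ C) ℚ.* ν σ)) →
    (∀ σ → fromℚ (½^ (length σ)) ≤ℝ ℓ σ) → X ∈ MLR A μ →
    (∀ k → ∃[ m ] k ≤ t (X ↾ m)) → (∀ m → bits A (X ↾ m) ≺ R) → R ∈ MLR A ℓ
  unbounded-MLR C {μ} {ℓ} {X} {R} upper lower random unbounded ≺R e test inAll =
    random (pullback C e) (pullback-MLTest C e {μ} {ℓ} upper lower test) λ n →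
      let (ρ , w , ρ≺R) = inAll (n + C)
          (m , le)      = unbounded (length ρ)
          (m′ , eq)     = t-↾-intermediate X m (length ρ) le
      in X ↾ m′ , pullback⁺ C e n (X ↾ m′)
           (subst (W A e (n + C)) (≺-comparable ρ≺R (≺R m′) (sym eq)) w) , ↾-≺ X m′

  unbounded-source : ∀ X → (∀ k → ∃[ m ] k ≤ t (X ↾ m)) → ∃[ R ] (∀ m → bits A (X ↾ m) ≺ R)
  unbounded-source X unbounded = R , λ m → ≺-intro (bits A (X ↾ m)) λ k k< → agree k m k<
    where
    R : Cantor
    R k = nth (bits A (X ↾ proj₁ (unbounded (suc k)))) k
    agree : ∀ k m → k < t (X ↾ m) → R k ≡ nth (bits A (X ↾ m)) k
    agree k m k< = trans (≺-nth≡ (bits-↾-≺ X (m≤m⊔n m₁ m) big) (proj₂ (unbounded (suc k))))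
                         (sym (≺-nth≡ (bits-↾-≺ X (m≤n⊔m m₁ m) big) k<))
      where
      m₁ = proj₁ (unbounded (suc k))
      big : bits A (X ↾ (m₁ ⊔ m)) ≺ nth (bits A (X ↾ (m₁ ⊔ m)))
      big = ≺-nth (bits A (X ↾ (m₁ ⊔ m)))

  -- Excluded middle lowers the bound until it is attained.
  longest-bits : ∀ X k → (∀ m → t (X ↾ m) ≤ k) → ∃[ m₀ ] ∀ m → t (X ↾ m) ≤ t (X ↾ m₀)
  longest-bits X k le with em {∃[ m ] k ≤ t (X ↾ m)}
  ... | yes (m₀ , k≤) = m₀ , λ m → ≤-trans (le m) k≤
  longest-bits X zero    le | no none = contradiction (0 , z≤n) none
  longest-bits X (suc k) le | no none = longest-bits X k λ m → s≤s⁻¹ (≰⇒> λ k≤ → none (m , k≤))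

  bounded-source : ∀ X {R} m₀ → (∀ m → t (X ↾ m) ≤ t (X ↾ m₀)) → bits A (X ↾ m₀) ≺ R →
    ∀ m → bits A (X ↾ m) ≺ R
  bounded-source X {R} m₀ max ≺R m with ≤-total m m₀
  ... | inj₁ m≤m₀ = bits-↾-≺ X m≤m₀ ≺R
  ... | inj₂ m₀≤m = subst (_≺ R) (≺-comparable prefix (≺-nth (bits A (X ↾ m))) (≤-antisym longer (max m))) ≺R
    where
    prefix : bits A (X ↾ m₀) ≺ nth (bits A (X ↾ m))
    prefix = bits-↾-≺ X m₀≤m (≺-nth (bits A (X ↾ m)))
    longer : t (X ↾ m₀) ≤ t (X ↾ m)
    longer = t-↾-mono X m₀≤m

  random-source : ∀ C {U μ ℓ} → OptimalPrefixFree A U → (∀ σ → μ σ ≤ℝ fromℚ (ι (2 ^ C) ℚ.* ν σ)) →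
    (∀ σ → fromℚ (½^ (length σ)) ≤ℝ ℓ σ) → ∀ X → X ∈ MLR A μ →
    ∃[ R ] R ∈ MLR A ℓ × (∀ m → bits A (X ↾ m) ≺ R)
  random-source C {U} {μ} {ℓ} optimal upper lower X random with em {∀ k → ∃[ m ] k ≤ t (X ↾ m)}
  ... | yes unbounded = let (R , ≺R) = unbounded-source X unbounded in
    R , unbounded-MLR C {μ} {ℓ} upper lower random unbounded ≺R , ≺R
  ... | no ¬unbounded =
    let (k , none)    = ¬∀⇒∃¬ ¬unbounded
        (m₀ , max)    = longest-bits X k λ m → <⇒≤ (≰⇒> λ k≤ → none (m , k≤))
        (R , ≺R , inc) = Compression.incompressible-extension em A U (proj₁ optimal) (bits A (X ↾ m₀))
    in R , incompressible⇒random A (λ _ → true) length (λ _ → trueᶜ) lengthᶜ length≤⌜⌝ ½^length-additive ℓ 0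
             (λ τ → subst (λ q → fromℚ q ≤ℝ ℓ τ) (sym (ℚₚ.*-identityˡ (½^ (length τ)))) (lower τ))
             optimal R (λ _ → refl) inc ,
       bounded-source X m₀ max ≺R

Π⁰₁-closed : (em : ExcludedMiddle 0ℓ) (P : Pred Cantor 0ℓ) → Π⁰₁ P →
  ∀ X → (∀ m → Classical.T em P (X ↾ m)) → X ∈ P
Π⁰₁-closed em P (T₀ , _ , _ , paths) X X∈T = Equivalence.from (paths X) λ n →
  let (Y , Y∈P , X↾n≺Y) = X∈T n in
  subst (λ σ → T₀ σ ≡ true) (trans (cong (Y ↾_) (sym (length-↾ X n))) X↾n≺Y)
    (Equivalence.to (paths Y) Y∈P n)

-- The three implications

module Equivalences (em : ExcludedMiddle 0ℓ) (P : Pred Cantor 0ℓ) (P≢∅ : Satisfiable P)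
  (closed : ∀ X → (∀ m → Classical.T em P (X ↾ m)) → X ∈ P) (c : ℕ)
  (hom : ∀ n σ τ → σ ∈ Classical.Tlevel em P n → τ ∈ Classical.Tlevel em P n →
         ∣ Classical.θ em P σ - Classical.θ em P τ ∣ ≤ c)
  (defined : Classical.LimitingRelativeMeasureDefined em P)
  {U : Rec 1} (optimal : OptimalPrefixFree (Classical.χ em (Classical.T em P)) U)
  {X : Cantor} (X∈P : X ∈ P) where
  open Classical em
  open Randomness em using (incompressible⇒random)
  open Tree em P P≢∅ closed
  open Bounds em P P≢∅ closed c hom
  open RandomPaths em P P≢∅ closed
  open StringComputability A

  produced⇒incompressible : ∀ ℓ → (∀ τ → ℓ τ ≤ℝ fromℚ (½^ (length τ))) →
    (∃[ R ] R ∈ MLR A ℓ × X ≗ Ψ P R) → Incompressible P U X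
  produced⇒incompressible ℓ upper (R , random , X≗ΨR) = ¬Compressed⇒Incompressible {U} {X} X∈P
    (produced⇒¬Compressed optimal X≗ΨR
      (Compression.random⇒incompressible em A U (proj₁ optimal) {ℓ} upper {R} random))

  incompressible⇒globallyRandom : Incompressible P U X → GloballyRandom P defined X
  incompressible⇒globallyRandom inc = incompressible⇒random A A t oracleᶜ (λ s → lengthᶜ (bitsᶜ s)) t≤⌜⌝
    ν-additive (limitingRelativeMeasure P defined) (c + c) (limitingRelativeMeasure-lower defined)
    optimal X (λ m → A⁺ (T-↾ X∈P m)) (Incompressible⇒¬Compressed {U} {X} X∈P inc)

  globallyRandom⇒produced : GloballyRandom P defined X → ∀ ℓ → (∀ τ → fromℚ (½^ (length τ)) ≤ℝ ℓ τ) →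
    ∃[ R ] R ∈ MLR A ℓ × X ≗ Ψ P R
  globallyRandom⇒produced random ℓ lower =
    let (R , R-random , ≺R) = random-source (c + c) {U} {limitingRelativeMeasure P defined} {ℓ} optimal
                                (limitingRelativeMeasure-upper defined) lower X random
    in R , R-random , Ψ-produces X∈P ≺R

-- lebesgue enters only through a variable ℓ equal to it, in the form in which
-- RandomlyProduced mentions it: two forms of an ℝ-valued function would be
-- compared up to η, which unfolds their Cauchy proofs.

module AtLebesgue (em : ExcludedMiddle 0ℓ) where

  produced-with⁻ : ∀ P X (Q : Set) →
    (∀ ℓ → (∀ τ → ℓ τ ≤ℝ fromℚ (½^ (length τ))) →
      (∃[ R ] R ∈ Classical.MLR em (Classical.χ em (Classical.T em P)) ℓ × X ≗ Classical.Ψ em P R) → Q) →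
    ∀ ℓ → ℓ ≡ Classical.lebesgue em →
    (∃[ R ] R ∈ Classical.MLR em (Classical.χ em (Classical.T em P)) ℓ × X ≗ Classical.Ψ em P R) → Q
  produced-with⁻ P X Q f ℓ eq = f ℓ λ τ → subst (λ x → x ≤ℝ fromℚ (½^ (length τ)))
    (cong (λ g → g τ) (sym eq)) (fromℚ-mono-≤ {½^ (length τ)} {½^ (length τ)} ℚₚ.≤-refl)

  produced⁻ : ∀ P X (Q : Set) →
    (∀ ℓ → (∀ τ → ℓ τ ≤ℝ fromℚ (½^ (length τ))) →
      (∃[ R ] R ∈ Classical.MLR em (Classical.χ em (Classical.T em P)) ℓ × X ≗ Classical.Ψ em P R) → Q) →
    Classical.RandomlyProduced em P X → Q
  produced⁻ P X Q f produced = produced-with⁻ P X Q f _ refl produced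

  produced-with⁺ : ∀ P X (Q : Set) →
    (Q → ∀ ℓ → (∀ τ → fromℚ (½^ (length τ)) ≤ℝ ℓ τ) →
      ∃[ R ] R ∈ Classical.MLR em (Classical.χ em (Classical.T em P)) ℓ × X ≗ Classical.Ψ em P R) →
    ∀ ℓ → ℓ ≡ Classical.lebesgue em → Q →
    ∃[ R ] R ∈ Classical.MLR em (Classical.χ em (Classical.T em P)) ℓ × X ≗ Classical.Ψ em P R
  produced-with⁺ P X Q f ℓ eq q = f q ℓ λ τ → subst (λ x → fromℚ (½^ (length τ)) ≤ℝ x)
    (cong (λ g → g τ) (sym eq)) (fromℚ-mono-≤ {½^ (length τ)} {½^ (length τ)} ℚₚ.≤-refl)

  produced⁺ : ∀ P X (Q : Set) →
    (Q → ∀ ℓ → (∀ τ → fromℚ (½^ (length τ)) ≤ℝ ℓ τ) →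
      ∃[ R ] R ∈ Classical.MLR em (Classical.χ em (Classical.T em P)) ℓ × X ≗ Classical.Ψ em P R) →
    Q → Classical.RandomlyProduced em P X
  produced⁺ P X Q f q = produced-with⁺ P X Q f _ refl q

  equivalences : let open Classical em in
    (P : Pred Cantor 0ℓ) → Satisfiable P → Π⁰₁ P → AdditivelyHomogeneous P →
    (λP-defined : LimitingRelativeMeasureDefined P) →
    (U : Rec 1) → OptimalPrefixFree (χ (T P)) U →
    (X : Cantor) → X ∈ P →
    (RandomlyProduced P X ⇔ Incompressible P U X) ×
    (Incompressible P U X ⇔ GloballyRandom P λP-defined X)
  equivalences P P≢∅ Π (c , hom) defined U optimal X X∈P =
    mk⇔ (λ a → produced⁻ P X _ E.produced⇒incompressible a)
        (λ b → produced⁺ P X _ E.globallyRandom⇒produced (E.incompressible⇒globallyRandom b)) ,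
    mk⇔ E.incompressible⇒globallyRandom
        (λ g → produced⁻ P X _ E.produced⇒incompressible (produced⁺ P X _ E.globallyRandom⇒produced g))
    where module E = Equivalences em P P≢∅ (Π⁰₁-closed em P Π) c hom defined optimal X∈P

theorem6p23 : (em : ExcludedMiddle 0ℓ) → let open Classical em in
    (P : Pred Cantor 0ℓ) → Satisfiable P → Π⁰₁ P → AdditivelyHomogeneous P →
    (λP-defined : LimitingRelativeMeasureDefined P) →
    (U : Rec 1) → OptimalPrefixFree (χ (T P)) U →
    (X : Cantor) → X ∈ P →
    (RandomlyProduced P X ⇔ Incompressible P U X) ×
    (Incompressible P U X ⇔ GloballyRandom P λP-defined X)
theorem6p23 = AtLebesgue.equivalences
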